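{- Let $k\geq 1$ and $n\geq 4k-1$ be integers such that $k\cdot n$ is even, and let $G$ be a graph of order $n$. If $\rho(G)>\rho(H_{n,k})$, where $H_{n,k}=K_{k-1}\nabla(K_{1}\cup K_{n-k})$, then $G$ contains a $k$-factor.
   Context: All graphs are finite, simple and undirected (not necessarily connected). The order of a graph is its number of vertices. For a graph $G$ with adjacency matrix $A(G)$, the spectral radius $\rho(G)$ is the largest eigenvalue of $A(G)$. $K_m$ is the complete graph on $m$ vertices ($K_0$ is the graph with no vertices, so $H_{n,1}=K_1\cup K_{n-1}$), $\cup$ denotes the disjoint union of graphs, and $G_1\nabla G_2$ denotes the join, obtained from the disjoint union of $G_1$ and $G_2$ by adding all edges between $V(G_1)$ and $V(G_2)$. A $k$-factor of a graph $G$ is a spanning subgraph $H$ of $G$ such that every vertex has degree exactly $k$ in $H$. -}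

module Defs where

open import Algebra.Bundles.Raw using (RawMonoid)
import Algebra.Definitions.RawMonoid as RawMonoidDefs
open import Data.Bool.Base using (Bool; true; false; not; if_then_else_)
open import Data.Fin.Base using (Fin; splitAt)
open import Data.Fin.Properties using (_≟_)
open import Data.Fin.Subset using (∣_∣)
open import Data.Nat.Base as ℕ using (ℕ; _∸_)
import Data.Nat.Properties as ℕ
open import Data.Product.Base using (∃-syntax; _×_; _,_)
open import Data.Rational.Base as ℚ using (ℚ; 0ℚ; 1ℚ; ½)
import Data.Rational.Properties as ℚ
open import Data.Rational.Solver using (module +-*-Solver)
open import Data.Sum.Base using (_⊎_; inj₁; inj₂)
open import Data.Vec.Base using (tabulate)
open import Data.Vec.Functional using (Vector)
open import Level using (0ℓ)
open import Relation.Binary.PropositionalEquality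
  using (_≡_; refl; sym; trans; cong; subst)
open import Relation.Nullary using (¬_; does; yes; no; contradiction)

------------------------------------------------------------------------
-- Real numbers, as Cauchy sequences of rationals considered up to _≈ℝ_.

Cauchy : (ℕ → ℚ) → Set
Cauchy x = ∀ ε → 0ℚ ℚ.< ε →
  ∃[ N ] (∀ m n → N ℕ.≤ m → N ℕ.≤ n → ℚ.∣ x m ℚ.- x n ∣ ℚ.< ε)

record ℝ : Set where
  constructor mkℝ
  field
    seq    : ℕ → ℚ
    cauchy : Cauchy seq

open ℝ public

infix 4 _≈ℝ_ _<ℝ_ _≤ℝ_

_≈ℝ_ : ℝ → ℝ → Set
x ≈ℝ y = ∀ ε → 0ℚ ℚ.< ε →
  ∃[ N ] (∀ n → N ℕ.≤ n → ℚ.∣ seq x n ℚ.- seq y n ∣ ℚ.< ε)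

_<ℝ_ : ℝ → ℝ → Set
x <ℝ y = ∃[ ε ] 0ℚ ℚ.< ε ×
  ∃[ N ] (∀ n → N ℕ.≤ n → seq x n ℚ.+ ε ℚ.< seq y n)

_≤ℝ_ : ℝ → ℝ → Set
x ≤ℝ y = ¬ (y <ℝ x)

fromℚ : ℚ → ℝ
fromℚ q = mkℝ (λ _ → q) λ ε 0<ε → 0 , λ _ _ _ _ →
  subst (ℚ._< ε) (sym (cong ℚ.∣_∣ (ℚ.+-inverseʳ q))) 0<ε

0ℝ 1ℝ : ℝ
0ℝ = fromℚ 0ℚ
1ℝ = fromℚ 1ℚ

private
  half-pos : ∀ {ε} → 0ℚ ℚ.< ε → 0ℚ ℚ.< ½ ℚ.* ε
  half-pos {ε} 0<ε = ℚ.positive⁻¹ (½ ℚ.* ε) {{ℚ.pos*pos⇒pos ½ ε {{ℚ.positive 0<ε}}}}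

  half+half : ∀ ε → ½ ℚ.* ε ℚ.+ ½ ℚ.* ε ≡ ε
  half+half ε = trans (sym (ℚ.*-distribʳ-+ ε ½ ½)) (ℚ.*-identityˡ ε)

  diff-+ : ∀ a b c d →
    (a ℚ.+ b) ℚ.- (c ℚ.+ d) ≡ (a ℚ.- c) ℚ.+ (b ℚ.- d)
  diff-+ = solve 4 (λ a b c d →
    (a :+ b) :- (c :+ d) := (a :- c) :+ (b :- d)) refl
    where open +-*-Solver

  diff-* : ∀ a b c d →
    (a ℚ.* b) ℚ.- (c ℚ.* d) ≡ a ℚ.* (b ℚ.- d) ℚ.+ d ℚ.* (a ℚ.- c)
  diff-* = solve 4 (λ a b c d →
    (a :* b) :- (c :* d) := a :* (b :- d) :+ d :* (a :- c)) refl
    where open +-*-Solver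

  sub-add : ∀ a b → (a ℚ.- b) ℚ.+ b ≡ a
  sub-add = solve 2 (λ a b → (a :- b) :+ b := a) refl
    where open +-*-Solver

  quotient : ∀ {B ε} → 0ℚ ℚ.< B → 0ℚ ℚ.< ε →
    ∃[ δ ] 0ℚ ℚ.< δ × B ℚ.* δ ≡ ε
  quotient {B} {ε} 0<B 0<ε =
    1/B ℚ.* ε
    , ℚ.positive⁻¹ (1/B ℚ.* ε)
        {{ℚ.pos*pos⇒pos 1/B {{ℚ.1/pos⇒pos B}} ε {{ℚ.positive 0<ε}}}}
    , trans (sym (ℚ.*-assoc B 1/B ε))
        (trans (cong (ℚ._* ε) (ℚ.*-inverseʳ B)) (ℚ.*-identityˡ ε))
    where
    instance
      posB : ℚ.Positive B
      posB = ℚ.positive 0<B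
      nzB : ℚ.NonZero B
      nzB = ℚ.pos⇒nonZero B
    1/B : ℚ
    1/B = ℚ.1/ B

  eventually-bounded : ∀ {x} → Cauchy x →
    ∃[ B ] 0ℚ ℚ.< B × ∃[ N ] (∀ n → N ℕ.≤ n → ℚ.∣ x n ∣ ℚ.< B)
  eventually-bounded {x} cx with cx 1ℚ (ℚ.positive⁻¹ 1ℚ)
  ... | N , close =
    1ℚ ℚ.+ ℚ.∣ x N ∣
    , ℚ.+-mono-<-≤ (ℚ.positive⁻¹ 1ℚ) (ℚ.0≤∣p∣ (x N))
    , N , λ n N≤n → ℚ.≤-<-trans
        (subst (λ t → ℚ.∣ t ∣ ℚ.≤ ℚ.∣ x n ℚ.- x N ∣ ℚ.+ ℚ.∣ x N ∣)
          (sub-add (x n) (x N)) (ℚ.∣p+q∣≤∣p∣+∣q∣ (x n ℚ.- x N) (x N)))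
        (ℚ.+-monoˡ-< ℚ.∣ x N ∣ (close n N N≤n ℕ.≤-refl))

  ∣*∣-< : ∀ {p q B δ} → ℚ.∣ p ∣ ℚ.< B → 0ℚ ℚ.< δ → ℚ.∣ q ∣ ℚ.< δ →
    ℚ.∣ p ℚ.* q ∣ ℚ.< B ℚ.* δ
  ∣*∣-< {p} {q} {B} {δ} p<B 0<δ q<δ =
    subst (ℚ._< B ℚ.* δ) (sym (ℚ.∣p*q∣≡∣p∣*∣q∣ p q))
      (ℚ.≤-<-trans
        (ℚ.*-monoˡ-≤-nonNeg ℚ.∣ p ∣ {{ℚ.nonNegative (ℚ.0≤∣p∣ p)}} (ℚ.<⇒≤ q<δ))
        (ℚ.*-monoˡ-<-pos δ {{ℚ.positive 0<δ}} p<B))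

  ∣+∣-<-halves : ∀ {p q ε} → ℚ.∣ p ∣ ℚ.< ½ ℚ.* ε → ℚ.∣ q ∣ ℚ.< ½ ℚ.* ε →
    ℚ.∣ p ℚ.+ q ∣ ℚ.< ε
  ∣+∣-<-halves {p} {q} {ε} hp hq = ℚ.≤-<-trans (ℚ.∣p+q∣≤∣p∣+∣q∣ p q)
    (subst (ℚ.∣ p ∣ ℚ.+ ℚ.∣ q ∣ ℚ.<_) (half+half ε) (ℚ.+-mono-< hp hq))

  +-cauchy : ∀ {x y} → Cauchy x → Cauchy y → Cauchy (λ n → x n ℚ.+ y n)
  +-cauchy {x} {y} cx cy ε 0<ε
    with cx (½ ℚ.* ε) (half-pos 0<ε) | cy (½ ℚ.* ε) (half-pos 0<ε)
  ... | M , hx | N , hy = M ℕ.⊔ N , λ m n m≥ n≥ →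
    subst (λ t → ℚ.∣ t ∣ ℚ.< ε) (sym (diff-+ (x m) (y m) (x n) (y n)))
      (∣+∣-<-halves
        (hx m n (ℕ.m⊔n≤o⇒m≤o M N m≥) (ℕ.m⊔n≤o⇒m≤o M N n≥))
        (hy m n (ℕ.m⊔n≤o⇒n≤o M N m≥) (ℕ.m⊔n≤o⇒n≤o M N n≥)))

  product-close : ∀ {a b c d B C δ η} ε →
    0ℚ ℚ.< δ → B ℚ.* δ ≡ ½ ℚ.* ε → 0ℚ ℚ.< η → C ℚ.* η ≡ ½ ℚ.* ε →
    ℚ.∣ a ∣ ℚ.< B → ℚ.∣ d ∣ ℚ.< C →
    ℚ.∣ b ℚ.- d ∣ ℚ.< δ → ℚ.∣ a ℚ.- c ∣ ℚ.< η →
    ℚ.∣ a ℚ.* b ℚ.- c ℚ.* d ∣ ℚ.< ε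
  product-close {a} {b} {c} {d} ε 0<δ Bδ≡ 0<η Cη≡ a<B d<C b-d a-c =
    subst (λ t → ℚ.∣ t ∣ ℚ.< ε) (sym (diff-* a b c d))
      (∣+∣-<-halves {a ℚ.* (b ℚ.- d)} {d ℚ.* (a ℚ.- c)} {ε}
        (subst (ℚ.∣ a ℚ.* (b ℚ.- d) ∣ ℚ.<_) Bδ≡
          (∣*∣-< {a} {b ℚ.- d} a<B 0<δ b-d))
        (subst (ℚ.∣ d ℚ.* (a ℚ.- c) ∣ ℚ.<_) Cη≡
          (∣*∣-< {d} {a ℚ.- c} d<C 0<η a-c)))

  *-cauchy : ∀ {x y} → Cauchy x → Cauchy y → Cauchy (λ n → x n ℚ.* y n)
  *-cauchy {x} {y} cx cy ε 0<ε =
    let B , 0<B , M₁ , bx = eventually-bounded cx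
        C , 0<C , M₂ , by = eventually-bounded cy
        δ , 0<δ , Bδ≡ = quotient 0<B (half-pos 0<ε)
        η , 0<η , Cη≡ = quotient 0<C (half-pos 0<ε)
        N₁ , hx = cx η 0<η
        N₂ , hy = cy δ 0<δ
    in (M₁ ℕ.⊔ M₂) ℕ.⊔ (N₁ ℕ.⊔ N₂) , λ m n m≥ n≥ →
    let Ms≤m = ℕ.m⊔n≤o⇒m≤o (M₁ ℕ.⊔ M₂) (N₁ ℕ.⊔ N₂) m≥
        Ms≤n = ℕ.m⊔n≤o⇒m≤o (M₁ ℕ.⊔ M₂) (N₁ ℕ.⊔ N₂) n≥
        Ns≤m = ℕ.m⊔n≤o⇒n≤o (M₁ ℕ.⊔ M₂) (N₁ ℕ.⊔ N₂) m≥
        Ns≤n = ℕ.m⊔n≤o⇒n≤o (M₁ ℕ.⊔ M₂) (N₁ ℕ.⊔ N₂) n≥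
    in product-close {x m} {y m} {x n} {y n} ε 0<δ Bδ≡ 0<η Cη≡
        (bx m (ℕ.m⊔n≤o⇒m≤o M₁ M₂ Ms≤m))
        (by n (ℕ.m⊔n≤o⇒n≤o M₁ M₂ Ms≤n))
        (hy m n (ℕ.m⊔n≤o⇒n≤o N₁ N₂ Ns≤m) (ℕ.m⊔n≤o⇒n≤o N₁ N₂ Ns≤n))
        (hx m n (ℕ.m⊔n≤o⇒m≤o N₁ N₂ Ns≤m) (ℕ.m⊔n≤o⇒m≤o N₁ N₂ Ns≤n))

infixl 6 _+ℝ_
infixl 7 _*ℝ_

_+ℝ_ : ℝ → ℝ → ℝ
x +ℝ y = mkℝ (λ n → seq x n ℚ.+ seq y n) (+-cauchy {seq x} {seq y} (cauchy x) (cauchy y))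

_*ℝ_ : ℝ → ℝ → ℝ
x *ℝ y = mkℝ (λ n → seq x n ℚ.* seq y n) (*-cauchy {seq x} {seq y} (cauchy x) (cauchy y))

+ℝ-0ℝ-rawMonoid : RawMonoid 0ℓ 0ℓ
+ℝ-0ℝ-rawMonoid = record { Carrier = ℝ ; _≈_ = _≈ℝ_ ; _∙_ = _+ℝ_ ; ε = 0ℝ }

open RawMonoidDefs +ℝ-0ℝ-rawMonoid public using () renaming (sum to sumℝ)

Matrix : ℕ → Set
Matrix n = Fin n → Fin n → ℝ

_*ᵥ_ : ∀ {n} → Matrix n → Vector ℝ n → Vector ℝ n
(A *ᵥ x) i = sumℝ λ j → A i j *ℝ x j

IsEigenvalue : ∀ {n} → Matrix n → ℝ → Set
IsEigenvalue {n} A μ = ∃[ x ]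
  ¬ (∀ (i : Fin n) → x i ≈ℝ 0ℝ) × (∀ i → (A *ᵥ x) i ≈ℝ μ *ℝ x i)

IsLargestEigenvalue : ∀ {n} → Matrix n → ℝ → Set
IsLargestEigenvalue A μ =
  IsEigenvalue A μ × (∀ ν → IsEigenvalue A ν → ν ≤ℝ μ)

------------------------------------------------------------------------
-- Finite simple graphs; the index is the order of the graph.

record Graph (n : ℕ) : Set where
  field
    adj        : Fin n → Fin n → Bool
    adj-sym    : ∀ i j → adj i j ≡ adj j i
    adj-irrefl : ∀ i → adj i i ≡ false

open Graph public

degree : ∀ {n} → Graph n → Fin n → ℕ
degree G i = ∣ tabulate (adj G i) ∣

adjacencyMatrix : ∀ {n} → Graph n → Matrix n
adjacencyMatrix G i j = if adj G i j then 1ℝ else 0ℝ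

-- "ρ(G) = r"; a relation, since it determines r only up to _≈ℝ_.
IsSpectralRadius : ∀ {n} → Graph n → ℝ → Set
IsSpectralRadius G r = IsLargestEigenvalue (adjacencyMatrix G) r

K : ∀ m → Graph m
K m = record
  { adj        = λ i j → not (does (i ≟ j))
  ; adj-sym    = symm
  ; adj-irrefl = irr
  }
  where
  symm : ∀ i j → not (does (i ≟ j)) ≡ not (does (j ≟ i))
  symm i j with i ≟ j | j ≟ i
  ... | yes _ | yes _ = refl
  ... | no  _ | no  _ = refl
  ... | yes p | no ¬q = contradiction (sym p) ¬q
  ... | no ¬p | yes q = contradiction (sym q) ¬p
  irr : ∀ i → not (does (i ≟ i)) ≡ false
  irr i with i ≟ i
  ... | yes _ = refl
  ... | no ¬p = contradiction refl ¬p

-- G and H side by side on Fin (m + n), the first m vertices being those of G;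
-- the Boolean says whether each vertex of G is adjacent to each vertex of H.
module Combine (cross : Bool) {m n} (G : Graph m) (H : Graph n) where
  adj⊎ : Fin m ⊎ Fin n → Fin m ⊎ Fin n → Bool
  adj⊎ (inj₁ i) (inj₁ j) = adj G i j
  adj⊎ (inj₂ i) (inj₂ j) = adj H i j
  adj⊎ (inj₁ _) (inj₂ _) = cross
  adj⊎ (inj₂ _) (inj₁ _) = cross

  adj⊎-sym : ∀ s t → adj⊎ s t ≡ adj⊎ t s
  adj⊎-sym (inj₁ i) (inj₁ j) = adj-sym G i j
  adj⊎-sym (inj₂ i) (inj₂ j) = adj-sym H i j
  adj⊎-sym (inj₁ _) (inj₂ _) = refl
  adj⊎-sym (inj₂ _) (inj₁ _) = refl

  adj⊎-irrefl : ∀ s → adj⊎ s s ≡ false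
  adj⊎-irrefl (inj₁ i) = adj-irrefl G i
  adj⊎-irrefl (inj₂ i) = adj-irrefl H i

  combine : Graph (m ℕ.+ n)
  combine = record
    { adj        = λ i j → adj⊎ (splitAt m i) (splitAt m j)
    ; adj-sym    = λ i j → adj⊎-sym (splitAt m i) (splitAt m j)
    ; adj-irrefl = λ i → adj⊎-irrefl (splitAt m i)
    }

infixr 6 _∪_
infixr 7 _∇_

_∪_ : ∀ {m n} → Graph m → Graph n → Graph (m ℕ.+ n)
G ∪ H = Combine.combine false G H

_∇_ : ∀ {m n} → Graph m → Graph n → Graph (m ℕ.+ n)
G ∇ H = Combine.combine true G H

-- The index equals n only when 1 ≤ k ≤ n, the range of interest.
H[_,_] : ∀ n k → Graph ((k ∸ 1) ℕ.+ (1 ℕ.+ (n ∸ k)))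
H[ n , k ] = K (k ∸ 1) ∇ (K 1 ∪ K (n ∸ k))

record Factor (k : ℕ) {n : ℕ} (G : Graph n) : Set where
  field
    factor   : Graph n
    subgraph : ∀ i j → adj factor i j ≡ true → adj G i j ≡ true
    regular  : ∀ i → degree factor i ≡ k

{-# OPTIONS --safe #-}

-- The bound ρ(G) > ρ(H) is used only through Collatz–Wielandt: if a vector x ≥ 1 satisfies
-- A x ≤ q x, then no eigenvalue of G exceeds q.
--
-- The graph H = K_j ∇ (K₁ ∪ K_{m+1}), j = k - 1, has an eigenvalue j + m + τ ≥ n - 2 with τ the
-- root in [0, 1] of a cubic, found by bisection, and its eigenvector takes three values. Placing
-- these values on a vertex of degree < k, its neighbours and the remaining vertices of G gives a
-- supersolution for G, so every degree of G is at least k. When 2 e(G) ≤ n² - 3n + 3, the vector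
-- (n - 2) + deg is a supersolution for q = n - 2, because the row sums of A² are at most
-- 2 e(G) - n + 1; hence the complement of G has at most n - 2 edges.
--
-- Under these two conditions, take a subgraph F with degrees at most k that minimises the sum
-- of (k - deg_F v) (1 + codeg v), where codeg is the degree in the complement of G. Let u, w be
-- deficient (possibly equal) with codeg w ≤ codeg u. Exchanges along u x ∈ G∖F, x y ∈ F,
-- y w ∈ G∖F show that codeg u + codeg w ≥ n + 2 - 2k. Moving the deficiency of u along
-- u v ∈ G∖F, v x ∈ F shows that codeg x ≥ codeg u for k such vertices x, which is too much for a
-- complement with n - 2 edges unless (k, n) is (2, 8) or (3, 12); there, counting over all v is
-- contradictory as well.

module Submission where

open import Defs

-- The bound `n² - 3n + 3` is where `2 e(G) - n + 1` reaches `(n - 2)²`. The spectral half is shaped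
-- by the reals being Cauchy sequences: their order is undecidable and an eigenvalue equation holds
-- at rational terms only up to a residual tending to 0. No eigenvector of `G` can be normalised or
-- chosen positive, so a rational supersolution is paired with the terms of an arbitrary
-- eigenvector. `ρ(H)` is compared through its maximality, hence an eigenvalue `μ` of `H` must be
-- constructed. Bisection keeps the upper endpoints, so that every rational term of `μ`, and not
-- just the limit, satisfies the inequalities of a supersolution. The gap between `ρ(H)` and `ρ(G)`
-- leaves room for one such term below `ρ(G)`, and from there on only rational inequalities remain.

module FactorExistence where

  open import Data.Bool.Base using (Bool; true; false; not; T; _∧_; _∨_; _xor_)
  open import Data.Bool.Properties using (∧-comm; ∨-comm) renaming (_≟_ to _≟ᵇ_)
  open import Data.Empty using (⊥; ⊥-elim)
  open import Data.Fin.Base using (Fin; zero; suc)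
  open import Data.Fin.Properties using (_≟_; any?)
  open import Data.Fin.Subset using (∣_∣)
  open import Data.Nat.Base using
    (ℕ; zero; suc; _+_; _*_; _∸_; _≤_; _<_; _≤ᵇ_; z≤n; s≤s; NonZero; >-nonZero)
  open import Data.Nat.Divisibility using (_∣_; divides; ∣m∣n⇒∣m+n; ∣m+n∣m⇒∣n; ∣⇒≤; _∣0)
  open import Data.Nat.Induction using (<-wellFounded)
  import Data.Nat.Properties as ℕ
  open import Data.Nat.Tactic.RingSolver using (solve-∀)
  open import Data.Product.Base using (∃-syntax; _×_; _,_; proj₂)
  open import Data.Sum.Base using (_⊎_; inj₁; inj₂; [_,_]′)
  open import Data.Vec.Base using (tabulate)
  open import Function.Base using (_∘_)
  open import Induction.WellFounded using (Acc; acc)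
  open import Relation.Binary.PropositionalEquality
  open import Relation.Nullary using (Dec; does; yes; no; contradiction)
  open import Relation.Nullary.Decidable using (_×-dec_; _⊎-dec_; ¬?; map′)
  open import Algebra.Properties.Semiring.Sum ℕ.+-*-semiring
    using (sum; sum-cong-≗; ∑-distrib-+; ∑-comm; *-distribˡ-sum; *-distribʳ-sum)

  -- Finite sums and indicators.

  sum-mono : ∀ {n} {f g : Fin n → ℕ} → (∀ i → f i ≤ g i) → sum f ≤ sum g
  sum-mono {zero}  f≤g = z≤n
  sum-mono {suc n} f≤g = ℕ.+-mono-≤ (f≤g zero) (sum-mono (f≤g ∘ suc))

  sum-const : ∀ n c → sum {n} (λ _ → c) ≡ n * c
  sum-const zero    c = refl
  sum-const (suc n) c = cong (c +_) (sum-const n c)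

  sum-≡0 : ∀ {n} {f : Fin n → ℕ} → (∀ i → f i ≡ 0) → sum f ≡ 0
  sum-≡0 {n} f≡0 = trans (sum-cong-≗ f≡0) (trans (sum-const n 0) (ℕ.*-zeroʳ n))

  0<sum⇒∃0< : ∀ {n} (f : Fin n → ℕ) → 0 < sum f → ∃[ i ] 0 < f i
  0<sum⇒∃0< {suc n} f 0<Σ with f zero in eq
  ... | suc _ = zero , subst (0 <_) (sym eq) (s≤s z≤n)
  ... | zero with 0<sum⇒∃0< (f ∘ suc) 0<Σ
  ...   | i , 0<fi = suc i , 0<fi

  ind : Bool → ℕ
  ind true  = 1
  ind false = 0

  ind≤1 : ∀ b → ind b ≤ 1
  ind≤1 true  = ℕ.≤-refl
  ind≤1 false = z≤n

  ind-*≤ : ∀ b m → ind b * m ≤ m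
  ind-*≤ true  m = ℕ.≤-reflexive (ℕ.*-identityˡ m)
  ind-*≤ false m = z≤n

  0<ind : ∀ {b} → 0 < ind b → b ≡ true
  0<ind {true} _ = refl

  δ : ∀ {n} → Fin n → Fin n → ℕ
  δ i j = ind (does (i ≟ j))

  δ-refl : ∀ {n} (i : Fin n) → δ i i ≡ 1
  δ-refl i with i ≟ i
  ... | yes _  = refl
  ... | no i≢i = contradiction refl i≢i

  δ-≢ : ∀ {n} {i j : Fin n} → i ≢ j → δ i j ≡ 0
  δ-≢ {i = i} {j} i≢j with i ≟ j
  ... | yes i≡j = contradiction i≡j i≢j
  ... | no _    = refl

  sum-δ : ∀ {n} (a : Fin n) (f : Fin n → ℕ) → sum (λ i → δ i a * f i) ≡ f a
  sum-δ {suc n} zero f = trans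
    (cong₂ _+_ (ℕ.*-identityˡ (f zero)) (sum-≡0 {n} (λ i → refl)))
    (ℕ.+-identityʳ (f zero))
  sum-δ {suc n} (suc a) f = sum-δ a (f ∘ suc)

  sum-δ₁ : ∀ {n} (a : Fin n) → sum (λ i → δ i a) ≡ 1
  sum-δ₁ a = trans (sum-cong-≗ (λ i → sym (ℕ.*-identityʳ (δ i a)))) (sum-δ a (λ _ → 1))

  -- Induction on the order: the first row and the first column have the same sum `r`, and what
  -- remains is again symmetric with zero diagonal.
  sym-sum-even : ∀ {n} (f : Fin n → Fin n → ℕ) → (∀ i j → f i j ≡ f j i) →
    (∀ i → f i i ≡ 0) → 2 ∣ sum (λ i → sum (f i))
  sym-sum-even {zero}  f f-sym f-irrefl = 2 ∣0
  sym-sum-even {suc n} f f-sym f-irrefl = subst (2 ∣_) (sym total)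
    (∣m∣n⇒∣m+n (divides r (ℕ.*-comm 2 r))
      (sym-sum-even (λ i j → f (suc i) (suc j)) (λ i j → f-sym (suc i) (suc j))
        (λ i → f-irrefl (suc i))))
    where
    r inner : ℕ
    r = sum (λ j → f zero (suc j))
    inner = sum (λ i → sum (λ j → f (suc i) (suc j)))
    double : ∀ x y → x + (x + y) ≡ 2 * x + y
    double = solve-∀
    total : sum (λ i → sum (f i)) ≡ 2 * r + inner
    total = begin
      f zero zero + r + sum (λ i → f (suc i) zero + sum (λ j → f (suc i) (suc j)))
        ≡⟨ cong₂ (λ x y → x + r + y) (f-irrefl zero)
             (∑-distrib-+ (λ i → f (suc i) zero) _) ⟩
      r + (sum (λ i → f (suc i) zero) + inner)
        ≡⟨ cong (λ x → r + (x + inner)) (sum-cong-≗ (λ i → f-sym (suc i) zero)) ⟩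
      r + (r + inner)
        ≡⟨ double r inner ⟩
      2 * r + inner ∎
      where open ≡-Reasoning

  -- Degrees and complements.

  α : ∀ {n} → Graph n → Fin n → Fin n → ℕ
  α G i j = ind (adj G i j)

  deg : ∀ {n} → Graph n → Fin n → ℕ
  deg G i = sum (α G i)

  α-sym : ∀ {n} (G : Graph n) i j → α G i j ≡ α G j i
  α-sym G i j = cong ind (adj-sym G i j)

  degree≡deg : ∀ {n} (G : Graph n) i → degree G i ≡ deg G i
  degree≡deg G i = count≡sum (adj G i)
    where
    count≡sum : ∀ {n} (b : Fin n → Bool) → ∣ tabulate b ∣ ≡ sum (ind ∘ b)
    count≡sum {zero}  b = refl
    count≡sum {suc n} b with b zero
    ... | true  = cong suc (count≡sum (b ∘ suc))
    ... | false = count≡sum (b ∘ suc)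

  handshake : ∀ {n} (G : Graph n) → 2 ∣ sum (deg G)
  handshake G = sym-sum-even (α G) (α-sym G) (λ i → cong ind (adj-irrefl G i))

  adj⇒≢ : ∀ {n} (G : Graph n) {i j} → adj G i j ≡ true → i ≢ j
  adj⇒≢ G {i} ij refl = contradiction (trans (sym ij) (adj-irrefl G i)) λ ()

  complement : ∀ {n} → Graph n → Graph n
  complement G = record
    { adj        = λ i j → not (adj G i j) ∧ adj (K _) i j
    ; adj-sym    = λ i j → cong₂ (λ a b → not a ∧ b) (adj-sym G i j) (adj-sym (K _) i j)
    ; adj-irrefl = λ i → trans (cong (not (adj G i i) ∧_) (adj-irrefl (K _) i)) (∧-comm _ false)
    }

  deg+codeg : ∀ {n} (G : Graph n) i → deg G i + deg (complement G) i + 1 ≡ n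
  deg+codeg {n} G i = begin
    deg G i + deg (complement G) i + 1
      ≡⟨ cong₂ _+_ (∑-distrib-+ (α G i) (α (complement G) i)) (sum-δ₁ i) ⟨
    sum (λ j → α G i j + α (complement G) i j) + sum (λ j → δ j i)
      ≡⟨ ∑-distrib-+ (λ j → α G i j + α (complement G) i j) (λ j → δ j i) ⟨
    sum (λ j → α G i j + α (complement G) i j + δ j i)
      ≡⟨ sum-cong-≗ pointwise ⟩
    sum {n} (λ _ → 1)
      ≡⟨ trans (sum-const n 1) (ℕ.*-identityʳ n) ⟩
    n ∎
    where
    open ≡-Reasoning
    pointwise : ∀ j → α G i j + α (complement G) i j + δ j i ≡ 1
    pointwise j with adj G i j in ij | i ≟ j | j ≟ i
    ... | _     | yes p | no ¬q = contradiction (sym p) ¬q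
    ... | _     | no ¬p | yes q = contradiction (sym q) ¬p
    ... | true  | yes refl | yes _ = contradiction refl (adj⇒≢ G ij)
    ... | true  | no _  | no _ = refl
    ... | false | yes _ | yes _ = refl
    ... | false | no _  | no _ = refl

  -- Switching a single edge.

  joins : ∀ {n} → Fin n → Fin n → Fin n → Fin n → Bool
  joins a b i j = does (i ≟ a) ∧ does (j ≟ b) ∨ does (i ≟ b) ∧ does (j ≟ a)

  joins-sym : ∀ {n} (a b i j : Fin n) → joins a b i j ≡ joins a b j i
  joins-sym a b i j = trans (∨-comm (does (i ≟ a) ∧ does (j ≟ b)) _)
    (cong₂ _∨_ (∧-comm (does (i ≟ b)) _) (∧-comm (does (i ≟ a)) _))

  joins-true : ∀ {n} (a b i j : Fin n) → joins a b i j ≡ true →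
    (i ≡ a × j ≡ b) ⊎ (i ≡ b × j ≡ a)
  joins-true a b i j p with i ≟ a | j ≟ b | i ≟ b | j ≟ a
  ... | yes q | yes r | _     | _     = inj₁ (q , r)
  ... | yes _ | no _  | yes q | yes r = inj₂ (q , r)
  ... | no _  | _     | yes q | yes r = inj₂ (q , r)
  joins-true a b i j () | yes _ | no _ | yes _ | no _
  joins-true a b i j () | yes _ | no _ | no _  | _
  joins-true a b i j () | no _  | _    | yes _ | no _
  joins-true a b i j () | no _  | _    | no _  | _

  ind-joins : ∀ {n} (a b i j : Fin n) → a ≢ b →
    ind (joins a b i j) ≡ δ i a * δ j b + δ i b * δ j a
  ind-joins a b i j a≢b with i ≟ a | j ≟ b | i ≟ b | j ≟ a
  ... | yes refl | _     | yes refl | _     = contradiction refl a≢b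
  ... | yes _    | yes _ | no _     | _     = refl
  ... | yes _    | no _  | no _     | _     = refl
  ... | no _     | _     | yes _    | yes _ = refl
  ... | no _     | _     | yes _    | no _  = refl
  ... | no _     | _     | no _     | _     = refl

  -- With `xor`, adding and removing an edge are one construction; the hypothesis on `adj G a b` in
  -- `deg-add` and `deg-remove` decides which of the two takes place.
  toggle : ∀ {n} → Graph n → (a b : Fin n) → a ≢ b → Graph n
  toggle G a b a≢b = record
    { adj        = λ i j → joins a b i j xor adj G i j
    ; adj-sym    = λ i j → cong₂ _xor_ (joins-sym a b i j) (adj-sym G i j)
    ; adj-irrefl = irrefl
    }
    where
    irrefl : ∀ i → joins a b i i xor adj G i i ≡ false
    irrefl i rewrite adj-irrefl G i with joins a b i i in eq
    ... | false = refl
    ... | true with joins-true a b i i eq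
    ...   | inj₁ (refl , r) = contradiction r a≢b
    ...   | inj₂ (refl , r) = contradiction (sym r) a≢b

  sum-ind-joins : ∀ {n} (a b i : Fin n) → a ≢ b →
    sum (λ j → ind (joins a b i j)) ≡ δ i a + δ i b
  sum-ind-joins a b i a≢b = begin
    sum (λ j → ind (joins a b i j))
      ≡⟨ sum-cong-≗ (λ j → trans (ind-joins a b i j a≢b)
           (cong₂ _+_ (ℕ.*-comm (δ i a) (δ j b)) (ℕ.*-comm (δ i b) (δ j a)))) ⟩
    sum (λ j → δ j b * δ i a + δ j a * δ i b)
      ≡⟨ ∑-distrib-+ (λ j → δ j b * δ i a) (λ j → δ j a * δ i b) ⟩
    sum (λ j → δ j b * δ i a) + sum (λ j → δ j a * δ i b)
      ≡⟨ cong₂ _+_ (sum-δ b (λ _ → δ i a)) (sum-δ a (λ _ → δ i b)) ⟩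
    δ i a + δ i b ∎
    where open ≡-Reasoning

  adj-joined : ∀ {n} (G : Graph n) {a b i j} c → adj G a b ≡ c → joins a b i j ≡ true → adj G i j ≡ c
  adj-joined G {a} {b} {i} {j} c ab ij with joins-true a b i j ij
  ... | inj₁ (refl , refl) = ab
  ... | inj₂ (refl , refl) = trans (adj-sym G b a) ab

  deg-add : ∀ {n} (G : Graph n) {a b} (a≢b : a ≢ b) → adj G a b ≡ false → ∀ i →
    deg (toggle G a b a≢b) i ≡ deg G i + (δ i a + δ i b)
  deg-add G {a} {b} a≢b ab i = begin
    deg (toggle G a b a≢b) i
      ≡⟨ sum-cong-≗ pointwise ⟩
    sum (λ j → α G i j + ind (joins a b i j))
      ≡⟨ ∑-distrib-+ (α G i) _ ⟩
    deg G i + sum (λ j → ind (joins a b i j))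
      ≡⟨ cong (deg G i +_) (sum-ind-joins a b i a≢b) ⟩
    deg G i + (δ i a + δ i b) ∎
    where
    open ≡-Reasoning
    pointwise : ∀ j → α (toggle G a b a≢b) i j ≡ α G i j + ind (joins a b i j)
    pointwise j with joins a b i j in eq
    ... | false = sym (ℕ.+-identityʳ _)
    ... | true rewrite adj-joined G {i = i} {j} false ab eq = refl

  deg-remove : ∀ {n} (G : Graph n) {a b} (a≢b : a ≢ b) → adj G a b ≡ true → ∀ i →
    deg (toggle G a b a≢b) i + (δ i a + δ i b) ≡ deg G i
  deg-remove G {a} {b} a≢b ab i = begin
    deg (toggle G a b a≢b) i + (δ i a + δ i b)
      ≡⟨ cong (deg (toggle G a b a≢b) i +_) (sum-ind-joins a b i a≢b) ⟨
    deg (toggle G a b a≢b) i + sum (λ j → ind (joins a b i j))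
      ≡⟨ ∑-distrib-+ (α (toggle G a b a≢b) i) _ ⟨
    sum (λ j → α (toggle G a b a≢b) i j + ind (joins a b i j))
      ≡⟨ sum-cong-≗ pointwise ⟩
    deg G i ∎
    where
    open ≡-Reasoning
    pointwise : ∀ j → α (toggle G a b a≢b) i j + ind (joins a b i j) ≡ α G i j
    pointwise j with joins a b i j in eq
    ... | false = ℕ.+-identityʳ _
    ... | true rewrite adj-joined G {i = i} {j} true ab eq = refl

  -- Partial factors and their potential.

  _⊆ᴳ_ : ∀ {n} → Graph n → Graph n → Set
  F ⊆ᴳ G = ∀ i j → adj F i j ≡ true → adj G i j ≡ true

  toggle-⊆ : ∀ {n} {F G : Graph n} {a b} (a≢b : a ≢ b) → F ⊆ᴳ G → adj G a b ≡ true →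
    toggle F a b a≢b ⊆ᴳ G
  toggle-⊆ {G = G} {a} {b} a≢b F⊆G ab i j p with joins a b i j in eq
  ... | true  = adj-joined G true ab eq
  ... | false = F⊆G i j p

  toggle-other : ∀ {n} (F : Graph n) {a b i j} (a≢b : a ≢ b) →
    (i ≡ a → j ≢ b) → (i ≡ b → j ≢ a) → adj (toggle F a b a≢b) i j ≡ adj F i j
  toggle-other F {a} {b} {i} {j} a≢b ¬ab ¬ba with joins a b i j in eq
  ... | false = refl
  ... | true with joins-true a b i j eq
  ...   | inj₁ (p , q) = contradiction q (¬ab p)
  ...   | inj₂ (p , q) = contradiction q (¬ba p)

  -- The deficiency is a field tied to the degree by an equation, which both bounds the degrees by
  -- `k` and avoids truncated subtraction.
  record PartialFactor {n} (k : ℕ) (G : Graph n) : Set where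
    field
      graph   : Graph n
      sub     : graph ⊆ᴳ G
      def     : Fin n → ℕ
      deg+def : ∀ i → deg graph i + def i ≡ k

  open PartialFactor

  -- The unit makes every deficiency cost something, so adding an edge always gains; the codegree
  -- makes a deficiency cheaper where few edges of `G` are absent.
  weight : ∀ {n} → Graph n → Fin n → ℕ
  weight G v = suc (deg (complement G) v)

  potential : ∀ {n k} {G : Graph n} → PartialFactor k G → ℕ
  potential {G = G} P = sum (λ v → def P v * weight G v)

  emptyFactor : ∀ {n} k (G : Graph n) → PartialFactor k G
  emptyFactor {n} k G = record
    { graph   = record { adj = λ _ _ → false ; adj-sym = λ _ _ → refl ; adj-irrefl = λ _ → refl }
    ; sub     = λ _ _ ()
    ; def     = λ _ → k
    ; deg+def = λ _ → cong (_+ k) (sum-≡0 {n} (λ _ → refl))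
    }

  fullFactor : ∀ {n k} {G : Graph n} (P : PartialFactor k G) → (∀ i → def P i ≡ 0) → Factor k G
  fullFactor P def≡0 = record
    { factor   = graph P
    ; subgraph = sub P
    ; regular  = λ i → trans (degree≡deg (graph P) i) (trans (sym (ℕ.+-identityʳ _))
        (trans (cong (deg (graph P) i +_) (sym (def≡0 i))) (deg+def P i)))
    }

  δ≤ : ∀ {n} {u : Fin n} (f : Fin n → ℕ) → 0 < f u → ∀ i → δ i u ≤ f i
  δ≤ {u = u} f 0<fu i with i ≟ u
  ... | yes refl = 0<fu
  ... | no _     = z≤n

  -- Each exchange is recorded as a balance, with `q` the deficiency removed and `p` the deficiency
  -- created, so no subtraction occurs.
  potential-change : ∀ {n k} {G : Graph n} (P P′ : PartialFactor k G) (p q : Fin n → ℕ) →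
    (∀ i → def P′ i + q i ≡ def P i + p i) →
    potential P′ + sum (λ i → q i * weight G i) ≡ potential P + sum (λ i → p i * weight G i)
  potential-change {G = G} P P′ p q change = begin
    potential P′ + sum (λ i → q i * w i)
      ≡⟨ ∑-distrib-+ (λ i → def P′ i * w i) (λ i → q i * w i) ⟨
    sum (λ i → def P′ i * w i + q i * w i)
      ≡⟨ sum-cong-≗ (λ i → trans (sym (ℕ.*-distribʳ-+ (w i) (def P′ i) (q i)))
           (trans (cong (_* w i) (change i)) (ℕ.*-distribʳ-+ (w i) (def P i) (p i)))) ⟩
    sum (λ i → def P i * w i + p i * w i)
      ≡⟨ ∑-distrib-+ (λ i → def P i * w i) (λ i → p i * w i) ⟩
    potential P + sum (λ i → p i * w i) ∎
    where
    open ≡-Reasoning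
    w = weight G

  -- Exchanges: adding an edge and shifting a deficiency.

  record Missing {n k} {G : Graph n} (P : PartialFactor k G) (u v : Fin n) : Set where
    constructor missing
    field
      inside  : adj G u v ≡ true
      outside : adj (graph P) u v ≡ false

  module _ {n k} {G : Graph n} (P : PartialFactor k G) {u v : Fin n} (uv : Missing P u v)
    (0<u : 0 < def P u) (0<v : 0 < def P v) where
    open Missing uv

    private
      u≢v : u ≢ v
      u≢v = adj⇒≢ G inside

      δδ≤ : ∀ i → δ i u + δ i v ≤ def P i
      δδ≤ i with i ≟ u | i ≟ v
      ... | yes refl | yes refl = contradiction refl u≢v
      ... | yes refl | no _     = 0<u
      ... | no _     | yes refl = 0<v
      ... | no _     | no _     = z≤n

      def′ : Fin n → ℕ
      def′ i = def P i ∸ (δ i u + δ i v)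

      def-change : ∀ i → def′ i + (δ i u + δ i v) ≡ def P i
      def-change i = ℕ.m∸n+n≡m (δδ≤ i)

      balance : ∀ d e f → d + e + f ≡ d + (f + e)
      balance = solve-∀

    addEdge : PartialFactor k G
    addEdge = record
      { graph   = toggle (graph P) u v u≢v
      ; sub     = toggle-⊆ {F = graph P} {G} u≢v (sub P) inside
      ; def     = def′
      ; deg+def = λ i → trans (cong (_+ def′ i) (deg-add (graph P) u≢v outside i))
          (trans (balance (deg (graph P) i) (δ i u + δ i v) (def′ i))
          (trans (cong (deg (graph P) i +_) (def-change i)) (deg+def P i)))
      }

    addEdge-potential : potential addEdge + (weight G u + weight G v) ≡ potential P
    addEdge-potential = begin
      potential addEdge + (weight G u + weight G v)
        ≡⟨ cong (potential addEdge +_) (sym (trans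
             (trans (sum-cong-≗ (λ i → ℕ.*-distribʳ-+ (weight G i) (δ i u) (δ i v)))
               (∑-distrib-+ (λ i → δ i u * weight G i) (λ i → δ i v * weight G i)))
             (cong₂ _+_ (sum-δ u (weight G)) (sum-δ v (weight G))))) ⟩
      potential addEdge + sum (λ i → (δ i u + δ i v) * weight G i)
        ≡⟨ potential-change P addEdge (λ _ → 0) _
             (λ i → trans (def-change i) (sym (ℕ.+-identityʳ (def P i)))) ⟩
      potential P + sum {n} (λ i → 0)
        ≡⟨ trans (cong (potential P +_) (sum-≡0 {n} (λ _ → refl))) (ℕ.+-identityʳ _) ⟩
      potential P ∎
      where open ≡-Reasoning

  -- Moves one unit of deficiency from u to x by replacing the edge vx by uv.
  module _ {n k} {G : Graph n} (P : PartialFactor k G) {u v x : Fin n} (uv : Missing P u v)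
    (0<u : 0 < def P u) (vx : adj (graph P) v x ≡ true) where
    open Missing uv

    private
      u≢v : u ≢ v
      u≢v = adj⇒≢ G inside

      v≢x : v ≢ x
      v≢x = adj⇒≢ (graph P) vx

      removed : Graph n
      removed = toggle (graph P) v x v≢x

      x≢u : x ≢ u
      x≢u refl = contradiction (trans (sym vx) (trans (adj-sym (graph P) v u) outside)) λ ()

      uv∉removed : adj removed u v ≡ false
      uv∉removed = trans (toggle-other (graph P) v≢x (λ u≡v _ → u≢v u≡v) (λ u≡x _ → x≢u (sym u≡x))) outside

      swapped : Graph n
      swapped = toggle removed u v u≢v

      def′ : Fin n → ℕ
      def′ i = (def P i + δ i x) ∸ δ i u

    shift-def : ∀ i → def′ i + δ i u ≡ def P i + δ i x
    shift-def i = ℕ.m∸n+n≡m (ℕ.≤-trans (δ≤ (def P) 0<u i) (ℕ.m≤m+n _ (δ i x)))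

    private
      deg-swapped : ∀ i → deg swapped i + δ i x ≡ deg (graph P) i + δ i u
      deg-swapped i = trans (cong (_+ δ i x) (deg-add removed u≢v uv∉removed i))
        (trans (regroup (deg removed i) (δ i u) (δ i v) (δ i x))
          (cong (_+ δ i u) (deg-remove (graph P) v≢x vx i)))
        where
        regroup : ∀ d a b c → d + (a + b) + c ≡ d + (b + c) + a
        regroup = solve-∀

      balance : ∀ d d′ e e′ a b → d′ + b ≡ d + a → e′ + a ≡ e + b → d′ + e′ ≡ d + e
      balance d d′ e e′ a b p q = ℕ.+-cancelʳ-≡ (a + b) (d′ + e′) (d + e)
        (trans (regroup d′ e′ a b) (trans (cong₂ _+_ p q) (regroup′ d e a b)))
        where
        regroup : ∀ d e a b → d + e + (a + b) ≡ (d + b) + (e + a)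
        regroup = solve-∀
        regroup′ : ∀ d e a b → (d + a) + (e + b) ≡ d + e + (a + b)
        regroup′ = solve-∀

    shift : PartialFactor k G
    shift = record
      { graph   = swapped
      ; sub     = toggle-⊆ {F = removed} {G} u≢v
          (toggle-⊆ {F = graph P} {G} v≢x (sub P) (sub P v x vx)) inside
      ; def     = def′
      ; deg+def = λ i → trans
          (balance _ _ (def P i) (def′ i) (δ i u) (δ i x) (deg-swapped i) (shift-def i))
          (deg+def P i)
      }

    shift-potential : potential shift + weight G u ≡ potential P + weight G x
    shift-potential = trans (cong (potential shift +_) (sym (sum-δ u (weight G))))
      (trans (potential-change P shift (λ i → δ i x) (λ i → δ i u) shift-def)
        (cong (potential P +_) (sum-δ x (weight G))))

    shift-def-x : 0 < def shift x
    shift-def-x = ℕ.≤-trans (ℕ.m≤n+m 1 (def P x)) (ℕ.≤-reflexive (sym (begin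
      def′ x              ≡⟨ ℕ.+-identityʳ (def′ x) ⟨
      def′ x + 0          ≡⟨ cong (def′ x +_) (δ-≢ x≢u) ⟨
      def′ x + δ x u      ≡⟨ shift-def x ⟩
      def P x + δ x x     ≡⟨ cong (def P x +_) (δ-refl x) ⟩
      def P x + 1         ∎)))
      where open ≡-Reasoning

    shift-def-≥ : ∀ i → def P i ≤ def shift i + δ i u
    shift-def-≥ i = ℕ.≤-trans (ℕ.m≤m+n _ (δ i x)) (ℕ.≤-reflexive (sym (shift-def i)))

    -- The shift touches only `vx` and `uv`. Since `vx` is in the factor, `w` is not `v`, and `x` is
    -- no end of `uv`. An edge at `x` can therefore be added right after a shift.
    shift-missing : ∀ {w} → Missing P w x → Missing shift w x
    shift-missing {w} wx = missing (Missing.inside wx)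
      (trans (toggle-other removed {i = w} {x} u≢v (λ _ x≡v → v≢x (sym x≡v)) (λ _ x≡u → x≢u x≡u))
      (trans (toggle-other (graph P) {i = w} {x} v≢x (λ w≡v _ → w≢v w≡v) (λ _ x≡v → v≢x (sym x≡v)))
        (Missing.outside wx)))
      where
      w≢v : w ≢ v
      w≢v refl = contradiction (trans (sym vx) (Missing.outside wx)) λ ()

  -- Counting around a deficient vertex.

  size : ∀ {n} → (Fin n → Bool) → ℕ
  size X = sum (λ i → ind (X i))

  -- Σ_X deg counts the edges inside X twice, and there are at most |X| (|X| - 1) / 2 of them.
  sum-deg-within : ∀ {n} (C : Graph n) (X : Fin n → Bool) →
    2 * sum (λ i → ind (X i) * deg C i) + size X ≤ sum (deg C) + size X * size X
  sum-deg-within {n} C X = begin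
    2 * sum (λ i → x i * deg C i) + size X
      ≡⟨ cong (λ t → t + size X) (double (sum (λ i → x i * deg C i))) ⟩
    sum (λ i → x i * deg C i) + sum (λ i → x i * deg C i) + size X
      ≡⟨ cong₂ _+_ (cong₂ _+_ rows cols) diagonal ⟩
    sum (λ i → sum (λ j → x i * α C i j)) + sum (λ i → sum (λ j → x j * α C i j))
      + sum (λ i → sum (λ j → δ j i * x i))
      ≡⟨ cong (_+ sum (λ i → sum (λ j → δ j i * x i))) (sum₂-+ (λ i j → x i * α C i j) _) ⟨
    sum (λ i → sum (λ j → x i * α C i j + x j * α C i j)) + sum (λ i → sum (λ j → δ j i * x i))
      ≡⟨ sum₂-+ (λ i j → x i * α C i j + x j * α C i j) _ ⟨
    sum (λ i → sum (λ j → x i * α C i j + x j * α C i j + δ j i * x i))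
      ≤⟨ sum-mono (λ i → sum-mono (pointwise i)) ⟩
    sum (λ i → sum (λ j → α C i j + x i * x j))
      ≡⟨ sum₂-+ (α C) (λ i j → x i * x j) ⟩
    sum (deg C) + sum (λ i → sum (λ j → x i * x j))
      ≡⟨ cong (sum (deg C) +_) (sum-cong-≗ (λ i → *-distribˡ-sum (x i) x)) ⟨
    sum (deg C) + sum (λ i → x i * size X)
      ≡⟨ cong (sum (deg C) +_) (*-distribʳ-sum (size X) x) ⟨
    sum (deg C) + size X * size X ∎
    where
    open ℕ.≤-Reasoning
    x : Fin n → ℕ
    x i = ind (X i)
    double : ∀ a → 2 * a ≡ a + a
    double = solve-∀
    sum₂-+ : (f g : Fin n → Fin n → ℕ) → sum (λ i → sum (λ j → f i j + g i j)) ≡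
      sum (λ i → sum (f i)) + sum (λ i → sum (g i))
    sum₂-+ f g = trans (sum-cong-≗ (λ i → ∑-distrib-+ (f i) (g i)))
      (∑-distrib-+ (λ i → sum (f i)) (λ i → sum (g i)))
    rows : sum (λ i → x i * deg C i) ≡ sum (λ i → sum (λ j → x i * α C i j))
    rows = sum-cong-≗ (λ i → *-distribˡ-sum (x i) (α C i))
    cols : sum (λ i → x i * deg C i) ≡ sum (λ i → sum (λ j → x j * α C i j))
    cols = trans rows (trans (∑-comm (λ i j → x i * α C i j))
      (sum-cong-≗ (λ i → sum-cong-≗ (λ j → cong (x j *_) (α-sym C j i)))))
    diagonal : size X ≡ sum (λ i → sum (λ j → δ j i * x i))
    diagonal = sum-cong-≗ (λ i → sym (sum-δ i (λ _ → x i)))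
    -- Off the diagonal this is `xc + yc ≤ c + xy` for bits; on the diagonal `C` vanishes and
    -- `x * x` pays for the term that sums to `size X`.
    pointwise : ∀ i j → x i * α C i j + x j * α C i j + δ j i * x i ≤ α C i j + x i * x j
    off-diagonal : ∀ a b c → ind a * ind c + ind b * ind c + 0 ≤ ind c + ind a * ind b
    off-diagonal true  true  true  = ℕ.≤-refl
    off-diagonal true  true  false = z≤n
    off-diagonal true  false true  = ℕ.≤-refl
    off-diagonal true  false false = z≤n
    off-diagonal false true  true  = ℕ.≤-refl
    off-diagonal false true  false = z≤n
    off-diagonal false false _     = z≤n
    on-diagonal : ∀ a → ind a * 0 + ind a * 0 + 1 * ind a ≤ 0 + ind a * ind a
    on-diagonal true  = ℕ.≤-refl
    on-diagonal false = z≤n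
    pointwise i j with j ≟ i
    ... | yes refl rewrite adj-irrefl C i = on-diagonal (X i)
    ... | no _     = off-diagonal (X i) (X j) (adj C i j)

  module _ {n k} {G : Graph n} (P : PartialFactor k G) where

    missing? : Fin n → Fin n → Bool
    missing? u v = adj G u v ∧ not (adj (graph P) u v)

    D : Fin n → Fin n → ℕ
    D u v = ind (missing? u v)

    missing?-sound : ∀ {u v} → missing? u v ≡ true → Missing P u v
    missing?-sound {u} {v} p with adj G u v in g | adj (graph P) u v in f
    ... | true | false = missing g f
    missing?-sound {u} {v} () | true  | true
    missing?-sound {u} {v} () | false | _

    missing?-complete : ∀ {u v} → Missing P u v → missing? u v ≡ true
    missing?-complete (missing g f) rewrite g | f = refl

    slack : Fin n → ℕ
    slack u = sum (D u)

    slack+deg : ∀ u → slack u + deg (graph P) u ≡ deg G u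
    slack+deg u = trans (sym (∑-distrib-+ (D u) (α (graph P) u))) (sum-cong-≗ pointwise)
      where
      pointwise : ∀ v → D u v + α (graph P) u v ≡ α G u v
      pointwise v with adj G u v in g | adj (graph P) u v in f
      ... | true  | true  = refl
      ... | true  | false = refl
      ... | false | false = refl
      ... | false | true  = contradiction (trans (sym (sub P u v f)) g) λ ()

    deg≤k : ∀ v → deg (graph P) v ≤ k
    deg≤k v = ℕ.≤-trans (ℕ.m≤m+n _ (def P v)) (ℕ.≤-reflexive (deg+def P v))

    -- What a switch consumes: one unit of deficiency at each end, hence two units if the ends
    -- coincide.
    DeficientPair : Fin n → Fin n → Set
    DeficientPair u w = (u ≢ w × 0 < def P u × 0 < def P w) ⊎ (u ≡ w × 2 ≤ def P u)

    deficientʳ : ∀ {u w} → DeficientPair u w → 0 < def P w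
    deficientʳ (inj₁ (_ , _ , 0<w)) = 0<w
    deficientʳ (inj₂ (refl , 2≤u))  = ℕ.<-trans (s≤s z≤n) 2≤u

    -- Counts the alternating walks from `u` to `y`: a missing edge followed by an edge of the
    -- factor.
    reach : Fin n → Fin n → ℕ
    reach u y = sum (λ x → D u x * α (graph P) x y)

    reach≤deg : ∀ u y → reach u y ≤ deg (graph P) y
    reach≤deg u y = sum-mono (λ x → ℕ.≤-trans (ind-*≤ (missing? u x) (α (graph P) x y))
      (ℕ.≤-reflexive (α-sym (graph P) x y)))

    reach-≡0 : ∀ {u y} → (∀ x → Missing P u x → adj (graph P) x y ≡ true → ⊥) → reach u y ≡ 0
    reach-≡0 {u} {y} none = sum-≡0 pointwise
      where
      pointwise : ∀ x → D u x * α (graph P) x y ≡ 0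
      pointwise x with missing? u x in m | adj (graph P) x y in f
      ... | false | _     = refl
      ... | true  | false = refl
      ... | true  | true  = ⊥-elim (none x (missing?-sound m) f)

    reach-self : ∀ u → reach u u ≡ 0
    reach-self u = reach-≡0 (λ x ux xu → contradiction
      (trans (sym xu) (trans (adj-sym (graph P) x u) (Missing.outside ux))) λ ())

    -- Local optimality under the three moves. `NoShift` is an inequality because a shift changes
    -- the potential by the difference of the weights of `x` and `u`.
    NoAdd NoSwitch NoShift : Set
    NoAdd = ∀ {u v} → Missing P u v → 0 < def P u → 0 < def P v → ⊥
    NoSwitch = ∀ {u w x y} → DeficientPair u w → Missing P u x →
      adj (graph P) x y ≡ true → Missing P w y → ⊥
    NoShift = ∀ {u v x} → Missing P u v → 0 < def P u → adj (graph P) v x ≡ true →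
      deg (complement G) u ≤ deg (complement G) x

    module _ (noAdd : NoAdd) {u} (0<u : 0 < def P u) where

      saturated : ∀ {v} → Missing P u v → def P v ≡ 0
      saturated {v} uv with def P v in eq
      ... | zero  = refl
      ... | suc _ = ⊥-elim (noAdd uv 0<u (subst (0 <_) (sym eq) (s≤s z≤n)))

      deg-saturated : ∀ {v} → Missing P u v → deg (graph P) v ≡ k
      deg-saturated {v} uv = trans (sym (ℕ.+-identityʳ _))
        (trans (cong (deg (graph P) v +_) (sym (saturated uv))) (deg+def P v))

      -- Without an edge to add, every missing neighbour of `u` is saturated and continues `k`
      -- alternating walks.
      sum-reach : slack u * k ≡ sum (reach u)
      sum-reach = begin
        slack u * k
          ≡⟨ *-distribʳ-sum k (D u) ⟩
        sum (λ x → D u x * k)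
          ≡⟨ sum-cong-≗ pointwise ⟩
        sum (λ x → D u x * deg (graph P) x)
          ≡⟨ sum-cong-≗ (λ x → *-distribˡ-sum (D u x) (α (graph P) x)) ⟩
        sum (λ x → sum (λ y → D u x * α (graph P) x y))
          ≡⟨ ∑-comm (λ x y → D u x * α (graph P) x y) ⟩
        sum (reach u) ∎
        where
        open ≡-Reasoning
        pointwise : ∀ x → D u x * k ≡ D u x * deg (graph P) x
        pointwise x with missing? u x in m
        ... | false = refl
        ... | true  = cong (1 *_) (sym (deg-saturated (missing?-sound m)))

      slack-pair : NoSwitch → ∀ {w} → DeficientPair u w → ∀ t →
        t ≡ 0 ⊎ (u ≢ w × t ≤ def P w) →
        slack u * k + k + k * slack w + t ≤ n * k
      slack-pair noSwitch {w} uw t t? = begin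
        slack u * k + k + k * slack w + t
          ≡⟨ cong₂ _+_ (cong₂ _+_ (cong₂ _+_ sum-reach (sym (sum-δ u (λ _ → k))))
               (*-distribˡ-sum k (D w))) (sym (sum-δ w (λ _ → t))) ⟩
        sum (reach u) + sum (λ y → δ y u * k) + sum (λ y → k * D w y) + sum (λ y → δ y w * t)
          ≡⟨ trans (∑-distrib-+ (λ y → reach u y + δ y u * k + k * D w y) _)
               (cong (_+ sum (λ y → δ y w * t))
                 (trans (∑-distrib-+ (λ y → reach u y + δ y u * k) _)
                   (cong (_+ sum (λ y → k * D w y)) (∑-distrib-+ (reach u) _)))) ⟨
        sum (λ y → reach u y + δ y u * k + k * D w y + δ y w * t)
          ≤⟨ sum-mono pointwise ⟩
        sum {n} (λ _ → k)
          ≡⟨ sum-const n k ⟩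
        n * k ∎
        where
        open ℕ.≤-Reasoning
        0<w : 0 < def P w
        0<w = deficientʳ uw
        t-at-u : u ≡ w → t ≡ 0
        t-at-u u≡w = [ (λ t≡0 → t≡0) , (λ (u≢w , _) → contradiction u≡w u≢w) ]′ t?
        t≤def : t ≤ def P w
        t≤def = [ (λ { refl → z≤n }) , proj₂ ]′ t?
        simp₁ : ∀ k → 0 + 0 * k + k * 1 + 0 * t ≡ k
        simp₁ k = trans (ℕ.+-identityʳ (k * 1)) (ℕ.*-identityʳ k)
        pointwise : ∀ y → reach u y + δ y u * k + k * D w y + δ y w * t ≤ k
        pointwise y with missing? w y in m
        ... | true = ℕ.≤-reflexive (trans
                (cong₂ (λ a b → a + b * k + k * 1 + δ y w * t)
                  (reach-≡0 (λ x ux xy → noSwitch uw ux xy wy)) (δ-≢ y≢u))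
                (trans (cong (λ a → k * 1 + a * t) (δ-≢ y≢w)) (simp₁ k)))
          where
          wy : Missing P w y
          wy = missing?-sound m
          y≢u : y ≢ u
          y≢u refl = noAdd wy 0<w 0<u
          y≢w : y ≢ w
          y≢w refl = adj⇒≢ G (Missing.inside wy) refl
        ... | false with y ≟ u
        ...   | yes refl rewrite reach-self u with u ≟ w
        ...     | yes u≡w rewrite t-at-u u≡w = ℕ.≤-reflexive (simp₂ k)
          where
          simp₂ : ∀ k → 1 * k + k * 0 + 1 * 0 ≡ k
          simp₂ = solve-∀
        ...     | no _ = ℕ.≤-reflexive (simp₃ k)
          where
          simp₃ : ∀ k → 1 * k + k * 0 + 0 ≡ k
          simp₃ = solve-∀
        pointwise y | false | no _ with y ≟ w
        ...     | yes refl = begin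
          reach u w + 0 + k * 0 + 1 * t ≡⟨ simp₄ (reach u w) k t ⟩
          reach u w + t                 ≤⟨ ℕ.+-mono-≤ (reach≤deg u w) t≤def ⟩
          deg (graph P) w + def P w     ≡⟨ deg+def P w ⟩
          k                             ∎
          where
          simp₄ : ∀ r k t → r + 0 + k * 0 + 1 * t ≡ r + t
          simp₄ = solve-∀
        ...     | no _ = begin
          reach u y + 0 + k * 0 + 0 ≡⟨ simp₅ (reach u y) k ⟩
          reach u y                 ≤⟨ reach≤deg u y ⟩
          deg (graph P) y           ≤⟨ deg≤k y ⟩
          k                         ∎
          where
          simp₅ : ∀ r k → r + 0 + k * 0 + 0 ≡ r
          simp₅ = solve-∀

      module _ (noShift : NoShift) where

        private
          db : Fin n → ℕ
          db = deg (complement G)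

        -- `X` consists of `u` and the `k` factor neighbours of `v`, all of codegree at least that
        -- of `u`. `sum-deg-within` limits how much codegree `k + 1` vertices can carry.
        codeg-closed-neighbourhood : ∀ {v} → Missing P u v →
          2 * (suc k * db u) + suc k ≤ sum db + suc k * suc k
        codeg-closed-neighbourhood {v} uv = begin
          2 * (suc k * db u) + suc k
            ≡⟨ cong (λ s → 2 * (s * db u) + s) (sym size-X) ⟩
          2 * (size X * db u) + size X
            ≡⟨ cong (λ s → 2 * s + size X) (*-distribʳ-sum (db u) (λ i → ind (X i))) ⟩
          2 * sum (λ i → ind (X i) * db u) + size X
            ≤⟨ ℕ.+-monoˡ-≤ (size X) (ℕ.*-monoʳ-≤ 2 (sum-mono pointwise)) ⟩
          2 * sum (λ i → ind (X i) * db i) + size X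
            ≤⟨ sum-deg-within (complement G) X ⟩
          sum db + size X * size X
            ≡⟨ cong (λ s → sum db + s * s) size-X ⟩
          sum db + suc k * suc k ∎
          where
          open ℕ.≤-Reasoning
          X : Fin n → Bool
          X i with i ≟ u
          ... | yes _ = true
          ... | no _  = adj (graph P) v i
          ind-X : ∀ i → ind (X i) ≡ δ i u + α (graph P) v i
          ind-X i with i ≟ u
          ... | yes refl = sym (cong (λ b → 1 + ind b)
                  (trans (adj-sym (graph P) v u) (Missing.outside uv)))
          ... | no _ = refl
          size-X : size X ≡ suc k
          size-X = trans (sum-cong-≗ ind-X) (trans (∑-distrib-+ (λ i → δ i u) (α (graph P) v))
            (cong₂ _+_ (sum-δ₁ u) (deg-saturated uv)))
          pointwise : ∀ i → ind (X i) * db u ≤ ind (X i) * db i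
          pointwise i with i ≟ u
          ... | yes refl = ℕ.≤-refl
          ... | no _ with adj (graph P) v i in vi
          ...   | true  = ℕ.*-monoʳ-≤ 1 (noShift uv 0<u vi)
          ...   | false = z≤n

        codeg-reached : ∀ {w} → u ≢ w → 0 < def P w →
          slack u * k * db u + k * db u + db w ≤ k * sum db
        codeg-reached {w} u≢w 0<w = begin
          slack u * k * db u + k * db u + db w
            ≡⟨ cong (λ t → t * db u + k * db u + db w) sum-reach ⟩
          sum (reach u) * db u + k * db u + db w
            ≡⟨ cong₂ _+_ (cong₂ _+_ (*-distribʳ-sum (db u) (reach u))
                 (sym (sum-δ u (λ y → k * db y)))) (sym (sum-δ w db)) ⟩
          sum (λ y → reach u y * db u) + sum (λ y → δ y u * (k * db y)) + sum (λ y → δ y w * db y)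
            ≤⟨ ℕ.+-monoˡ-≤ _ (ℕ.+-monoˡ-≤ _ (sum-mono raise)) ⟩
          sum (λ y → reach u y * db y) + sum (λ y → δ y u * (k * db y)) + sum (λ y → δ y w * db y)
            ≡⟨ trans (∑-distrib-+ (λ y → reach u y * db y + δ y u * (k * db y)) _)
                 (cong (_+ sum (λ y → δ y w * db y)) (∑-distrib-+ (λ y → reach u y * db y) _)) ⟨
          sum (λ y → reach u y * db y + δ y u * (k * db y) + δ y w * db y)
            ≤⟨ sum-mono pointwise ⟩
          sum (λ y → k * db y)
            ≡⟨ *-distribˡ-sum k db ⟨
          k * sum db ∎
          where
          open ℕ.≤-Reasoning
          raise : ∀ y → reach u y * db u ≤ reach u y * db y
          raise y with db u ℕ.≤? db y
          ... | yes u≤y = ℕ.*-monoʳ-≤ (reach u y) u≤y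
          ... | no u≰y = ℕ.≤-reflexive (trans (cong (_* db u) r≡0) (cong (_* db y) (sym r≡0)))
            where
            r≡0 : reach u y ≡ 0
            r≡0 = reach-≡0 (λ x ux xy → u≰y (noShift ux 0<u xy))
          pointwise : ∀ y → reach u y * db y + δ y u * (k * db y) + δ y w * db y ≤ k * db y
          pointwise y with y ≟ u | y ≟ w
          ... | yes refl | yes refl = contradiction refl u≢w
          ... | yes refl | no _ rewrite reach-self u = ℕ.≤-reflexive (simp (k * db u))
            where
            simp : ∀ a → 1 * a + 0 ≡ a
            simp = solve-∀
          ... | no _ | yes refl = begin
            reach u w * db w + 0 + 1 * db w ≡⟨ simp (reach u w) (db w) ⟩
            (reach u w + 1) * db w          ≤⟨ ℕ.*-monoˡ-≤ (db w) (ℕ.+-mono-≤ (reach≤deg u w) 0<w) ⟩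
            (deg (graph P) w + def P w) * db w ≡⟨ cong (_* db w) (deg+def P w) ⟩
            k * db w ∎
            where
            simp : ∀ r d → r * d + 0 + 1 * d ≡ (r + 1) * d
            simp = solve-∀
          ... | no _ | no _ = begin
            reach u y * db y + 0 + 0 ≡⟨ trans (ℕ.+-identityʳ _) (ℕ.+-identityʳ _) ⟩
            reach u y * db y         ≤⟨ ℕ.*-monoˡ-≤ (db y) (ℕ.≤-trans (reach≤deg u y) (deg≤k y)) ⟩
            k * db y                 ∎

  -- A certificate for linear arithmetic: `l ≤ r` is a nonnegative combination of known inequalities
  -- and `s` the slack, so only an identity is left for the ring solver.
  ≤-linear : ∀ {a b l r} s → l ≤ r → a + r + s ≡ b + l → a ≤ b
  ≤-linear {a} {b} {l} {r} s l≤r eq = ℕ.+-cancelʳ-≤ l a b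
    (ℕ.≤-trans (ℕ.+-monoʳ-≤ a l≤r) (ℕ.≤-trans (ℕ.m≤m+n (a + r) s) (ℕ.≤-reflexive eq)))

  -- Turns numerical contradictions into evaluation: at literals the premise is `refl`.
  impossible : ∀ {a b} → (a ≤ᵇ b) ≡ false → a ≤ b → ⊥
  impossible a≰b a≤b = subst T a≰b (ℕ.≤⇒≤ᵇ a≤b)

  -- Arithmetic of stuck partial factors.

  -- The constraints satisfied by a stuck partial factor: s and d are the codegrees of two deficient
  -- vertices, D is the slack at the first one and E the sum of all codegrees.
  record StuckNumbers (k n s d D E : ℕ) : Set where
    field
      4k≤n+1 : 4 * k ≤ n + 1
      low    : n + 2 ≤ 2 * s + 2 * k
      high   : 2 * (suc k * s) + suc k ≤ E + suc k * suc k
      E≤     : E + 4 ≤ 2 * n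
      slack≥ : n ≤ D + k + s
      tie    : n + 3 ≤ 2 * s + 2 * k ⊎
               (n + 2 ≤ s + d + 2 * k × D * k * s + k * s + d ≤ k * E)

  module _ {k n s d D E : ℕ} (N : StuckNumbers k n s d D E) where
    open StuckNumbers N

    s-above : ∀ m → (n + 2 ≤ᵇ 2 * m + 2 * k) ≡ false → m < s
    s-above m fails = [ (λ s≤m → ⊥-elim (impossible fails (ℕ.≤-trans low
      (ℕ.+-monoˡ-≤ (2 * k) (ℕ.*-monoʳ-≤ 2 s≤m))))) , (λ m<s → m<s) ]′ (ℕ.≤-<-connex s m)

    s-below : ∀ e m → (2 * (suc k * suc m) + suc k ≤ᵇ e + suc k * suc k) ≡ false →
      E + 4 ≤ e + 4 → s ≤ m
    s-below e m fails E+4≤ = [ (λ s≤m → s≤m) , (λ m<s → ⊥-elim (impossible fails (ℕ.≤-trans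
      (ℕ.+-monoˡ-≤ (suc k) (ℕ.*-monoʳ-≤ 2 (ℕ.*-monoʳ-≤ (suc k) m<s)))
      (ℕ.≤-trans high (ℕ.+-monoˡ-≤ (suc k * suc k) (ℕ.+-cancelʳ-≤ 4 E e E+4≤)))))) ]′
      (ℕ.≤-<-connex s m)

  -- `low` and `high` are both met by `s ≡ 3`. The count over all walks decides: `D ≥ 3` and `d ≥ 3`
  -- lead to `27 ≤ 24`.
  stuck-2-8 : ∀ {s d D E} → StuckNumbers 2 8 s d D E → s ≡ 3 → ⊥
  stuck-2-8 {d = d} {D} {E} N refl with StuckNumbers.tie N
  ... | inj₁ h = impossible refl h
  ... | inj₂ (h , h′) = impossible refl (ℕ.≤-trans
    (ℕ.+-mono-≤ (ℕ.+-monoˡ-≤ 6 (ℕ.*-monoˡ-≤ 3 (ℕ.*-monoˡ-≤ 2 3≤D))) 3≤d)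
    (ℕ.≤-trans h′ (ℕ.*-monoʳ-≤ 2 (ℕ.+-cancelʳ-≤ 4 E 12 (StuckNumbers.E≤ N)))))
    where
    3≤D : 3 ≤ D
    3≤D = ℕ.+-cancelʳ-≤ 2 3 D (ℕ.+-cancelʳ-≤ 3 5 (D + 2) (StuckNumbers.slack≥ N))
    3≤d : 3 ≤ d
    3≤d = ℕ.+-cancelˡ-≤ 3 3 d (ℕ.+-cancelʳ-≤ 4 6 (3 + d) h)

  -- As before, with `D ≥ 5` and `d ≥ 4` leading to `76 ≤ 60`.
  stuck-3-12 : ∀ {s d D E} → StuckNumbers 3 12 s d D E → s ≡ 4 → ⊥
  stuck-3-12 {d = d} {D} {E} N refl with StuckNumbers.tie N
  ... | inj₁ h = impossible refl h
  ... | inj₂ (h , h′) = impossible refl (ℕ.≤-trans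
    (ℕ.+-mono-≤ (ℕ.+-monoˡ-≤ 12 (ℕ.*-monoˡ-≤ 4 (ℕ.*-monoˡ-≤ 3 5≤D))) 4≤d)
    (ℕ.≤-trans h′ (ℕ.*-monoʳ-≤ 3 (ℕ.+-cancelʳ-≤ 4 E 20 (StuckNumbers.E≤ N)))))
    where
    5≤D : 5 ≤ D
    5≤D = ℕ.+-cancelʳ-≤ 3 5 D (ℕ.+-cancelʳ-≤ 4 8 (D + 3) (StuckNumbers.slack≥ N))
    4≤d : 4 ≤ d
    4≤d = ℕ.+-cancelˡ-≤ 4 4 d (ℕ.+-cancelʳ-≤ 6 8 (4 + d) h)

  module _ {j n s d D E : ℕ} (N : StuckNumbers (suc j) n s d D E) where
    open StuckNumbers N

    -- Eliminates `s` and `E`: `low` times `k + 1`, plus `high`, plus `E≤`.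
    stuck-n≤ : j * n + 2 ≤ 3 * (j * j) + 7 * j
    stuck-n≤ = ≤-linear 0
      (ℕ.+-mono-≤ (ℕ.*-monoʳ-≤ (2 + j) low) (ℕ.+-mono-≤ high E≤)) (eq j n s E)
      where
      eq : ∀ j n s E →
        j * n + 2 + ((2 + j) * (2 * s + 2 * suc j) + (E + suc (suc j) * suc (suc j) + 2 * n)) + 0
        ≡ 3 * (j * j) + 7 * j
          + ((2 + j) * (n + 2) + (2 * (suc (suc j) * s) + suc (suc j) + (E + 4)))
      eq = solve-∀

    n-below : ∀ m → (j * suc m + 2 ≤ᵇ 3 * (j * j) + 7 * j) ≡ false → n ≤ m
    n-below m fails = [ (λ n≤m → n≤m) , (λ m<n → ⊥-elim (impossible fails
      (ℕ.≤-trans (ℕ.+-monoˡ-≤ 2 (ℕ.*-monoʳ-≤ j m<n)) stuck-n≤))) ]′ (ℕ.≤-<-connex n m)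

    -- Adding `j` times `4k ≤ n + 1` eliminates `n` as well; the quadratic leaves only `k` = 2, 3,
    -- 4.
    stuck-j² : j * j + 2 ≤ 4 * j
    stuck-j² = ≤-linear 0 (ℕ.+-mono-≤ stuck-n≤ (ℕ.*-monoʳ-≤ j 4k≤n+1)) (eq j n)
      where
      eq : ∀ j n → j * j + 2 + (3 * (j * j) + 7 * j + j * (n + 1)) + 0
        ≡ 4 * j + (j * n + 2 + j * (4 * suc j))
      eq = solve-∀

  -- At order `4k - 1`, `low` and `high` confine `s` to disjoint ranges. The constants 10, 18 and 26
  -- here and below are `2n - 4`, the largest `E` allowed.
  stuck-2-7 : ∀ {s d D E} → StuckNumbers 2 7 s d D E → ⊥
  stuck-2-7 N = ℕ.<⇒≱ (s-above N 2 refl) (s-below N 10 2 refl (StuckNumbers.E≤ N))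

  stuck-3-11 : ∀ {s d D E} → StuckNumbers 3 11 s d D E → ⊥
  stuck-3-11 N = ℕ.<⇒≱ (s-above N 3 refl) (s-below N 18 3 refl (StuckNumbers.E≤ N))

  stuck-4-15 : ∀ {s d D E} → StuckNumbers 4 15 s d D E → ⊥
  stuck-4-15 N = ℕ.<⇒≱ (s-above N 4 refl) (s-below N 26 4 refl (StuckNumbers.E≤ N))

  n-values : ∀ {m n} → m ≤ n → n ≤ suc m → n ≡ m ⊎ n ≡ suc m
  n-values m≤n n≤1+m with ℕ.m≤n⇒m<n∨m≡n m≤n
  ... | inj₁ m<n = inj₂ (ℕ.≤-antisym n≤1+m m<n)
  ... | inj₂ m≡n = inj₁ (sym m≡n)

  stuck-2 : ∀ {n s d D E} → n ≡ 7 ⊎ n ≡ 8 → StuckNumbers 2 n s d D E → ⊥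
  stuck-2 (inj₁ refl) N = stuck-2-7 N
  stuck-2 (inj₂ refl) N = stuck-2-8 N
    (ℕ.≤-antisym (s-below N 12 3 refl (StuckNumbers.E≤ N)) (s-above N 2 refl))

  stuck-3 : ∀ {n s d D E} → n ≡ 11 ⊎ n ≡ 12 → StuckNumbers 3 n s d D E → ⊥
  stuck-3 (inj₁ refl) N = stuck-3-11 N
  stuck-3 (inj₂ refl) N = stuck-3-12 N
    (ℕ.≤-antisym (s-below N 20 4 refl (StuckNumbers.E≤ N)) (s-above N 3 refl))

  stuck-4 : ∀ {n s d D E} → n ≡ 15 → StuckNumbers 4 n s d D E → ⊥
  stuck-4 refl N = stuck-4-15 N

  -- The upper bound from `stuck-n≤` against `n ≥ 4k - 1` leaves the orders 7, 8 for `k` = 2, then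
  -- 11, 12 for `k` = 3, and 15 for `k` = 4.
  no-stuck-numbers : ∀ k {n s d D E} → 1 ≤ k → StuckNumbers k n s d D E → ⊥
  no-stuck-numbers 1 _ N = impossible refl (stuck-j² N)
  no-stuck-numbers 2 {n} _ N =
    stuck-2 (n-values (ℕ.+-cancelʳ-≤ 1 7 n (StuckNumbers.4k≤n+1 N)) (n-below N 8 refl)) N
  no-stuck-numbers 3 {n} _ N =
    stuck-3 (n-values (ℕ.+-cancelʳ-≤ 1 11 n (StuckNumbers.4k≤n+1 N)) (n-below N 12 refl)) N
  no-stuck-numbers 4 {n} _ N =
    stuck-4 (ℕ.≤-antisym (n-below N 15 refl) (ℕ.+-cancelʳ-≤ 1 15 n (StuckNumbers.4k≤n+1 N))) N
  no-stuck-numbers (suc (suc (suc (suc (suc i))))) _ N = impossible refl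
    (≤-linear {2} {0} (i * i + 4 * i) (stuck-j² N) (eq i))
    where
    eq : ∀ i → 2 + 4 * (4 + i) + (i * i + 4 * i) ≡ 0 + ((4 + i) * (4 + i) + 2)
    eq = solve-∀

  -- Local search for a factor.

  module _ {n k} {G : Graph n} (P : PartialFactor k G) where

    private
      db : Fin n → ℕ
      db = deg (complement G)

      F : Graph n
      F = graph P

    Smaller : Set
    Smaller = ∃[ P′ ] potential {k = k} {G} P′ < potential P

    Missing-dec : ∀ u v → Dec (Missing P u v)
    Missing-dec u v = map′ (missing?-sound P) (missing?-complete P) (missing? P u v ≟ᵇ true)

    DeficientPair-dec : ∀ u w → Dec (DeficientPair P u w)
    DeficientPair-dec u w =
      (¬? (u ≟ w) ×-dec (0 ℕ.<? def P u) ×-dec (0 ℕ.<? def P w))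
      ⊎-dec ((u ≟ w) ×-dec (2 ℕ.≤? def P u))

    DeficientPair-sym : ∀ {u w} → DeficientPair P u w → DeficientPair P w u
    DeficientPair-sym (inj₁ (u≢w , 0<u , 0<w)) = inj₁ ((λ w≡u → u≢w (sym w≡u)) , 0<w , 0<u)
    DeficientPair-sym (inj₂ (refl , 2≤u))      = inj₂ (refl , 2≤u)

    deficientˡ : ∀ {u w} → DeficientPair P u w → 0 < def P u
    deficientˡ uw = deficientʳ P (DeficientPair-sym uw)

    add-or-none : Smaller ⊎ NoAdd P
    add-or-none with any? (λ u → any? (λ v → Missing-dec u v ×-dec (0 ℕ.<? def P u) ×-dec (0 ℕ.<? def P v)))
    ... | no none = inj₂ (λ uv 0<u 0<v → none (_ , _ , uv , 0<u , 0<v))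
    ... | yes (u , v , uv , 0<u , 0<v) = inj₁ (addEdge P uv 0<u 0<v ,
      subst (potential (addEdge P uv 0<u 0<v) <_) (addEdge-potential P uv 0<u 0<v)
        (ℕ.m<m+n _ (s≤s z≤n)))

    shift-or-none : Smaller ⊎ NoShift P
    shift-or-none with any? (λ u → any? (λ v → any? (λ x → Missing-dec u v ×-dec (0 ℕ.<? def P u)
      ×-dec (adj F v x ≟ᵇ true) ×-dec (db x ℕ.<? db u))))
    ... | no none = inj₂ (λ uv 0<u vx → ℕ.≮⇒≥ (λ x<u → none (_ , _ , _ , uv , 0<u , vx , x<u)))
    ... | yes (u , v , x , uv , 0<u , vx , x<u) = inj₁ (shift P uv 0<u vx ,
      ℕ.+-cancelʳ-< (weight G u) _ (potential P)
        (subst (_< potential P + weight G u) (sym (shift-potential P uv 0<u vx))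
          (ℕ.+-monoʳ-< (potential P) (s≤s x<u))))

    -- A switch shifts one unit from `u` to `y` and then adds `wy`. The weight of `y` enters and
    -- leaves again, so the potential drops by the weights of `u` and `w`, whatever they are.
    switch-or-none : Smaller ⊎ NoSwitch P
    switch-or-none with any? (λ u → any? (λ w → any? (λ x → any? (λ y → DeficientPair-dec u w
      ×-dec Missing-dec u x ×-dec (adj F x y ≟ᵇ true) ×-dec Missing-dec w y))))
    ... | no none = inj₂ (λ uw ux xy wy → none (_ , _ , _ , _ , uw , ux , xy , wy))
    ... | yes (u , w , x , y , uw , ux , xy , wy) = inj₁ (P₂ , smaller)
      where
      0<u : 0 < def P u
      0<u = deficientˡ uw
      P₁ : PartialFactor k G
      P₁ = shift P ux 0<u xy
      wy₁ : Missing P₁ w y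
      wy₁ = shift-missing P ux 0<u xy wy
      0<w₁ : DeficientPair P u w → 0 < def P₁ w
      0<w₁ (inj₁ (u≢w , _ , 0<w)) = ℕ.≤-trans 0<w (ℕ.≤-trans (shift-def-≥ P ux 0<u xy w)
        (ℕ.≤-reflexive (trans (cong (def P₁ w +_) (δ-≢ (λ w≡u → u≢w (sym w≡u)))) (ℕ.+-identityʳ _))))
      0<w₁ (inj₂ (refl , 2≤u)) = ℕ.+-cancelʳ-≤ 1 1 (def P₁ u) (ℕ.≤-trans 2≤u
        (ℕ.≤-trans (shift-def-≥ P ux 0<u xy u) (ℕ.≤-reflexive (cong (def P₁ u +_) (δ-refl u)))))
      0<y₁ : 0 < def P₁ y
      0<y₁ = shift-def-x P ux 0<u xy
      P₂ : PartialFactor k G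
      P₂ = addEdge P₁ wy₁ (0<w₁ uw) 0<y₁
      smaller : potential P₂ < potential P
      smaller = ≤-linear (deg (complement G) u + weight G w)
        (ℕ.≤-reflexive (cong₂ _+_ (addEdge-potential P₁ wy₁ (0<w₁ uw) 0<y₁)
          (shift-potential P ux 0<u xy)))
        (eq (potential P₂) (potential P) (weight G w) (weight G y) (db u) (potential P₁))
        where
        eq : ∀ p₂ p w y u p₁ → suc p₂ + (p₁ + (p + y)) + (u + w) ≡ p + (p₂ + (w + y) + (p₁ + suc u))
        eq = solve-∀

    module _ (noAdd : NoAdd P) (noShift : NoShift P) (noSwitch : NoSwitch P)
      (1≤k : 1 ≤ k) (4k≤ : 4 * k ≤ n + 1) (2∣kn : 2 ∣ k * n)
      (k≤deg : ∀ v → k ≤ deg G v) (codeg≤ : sum db + 4 ≤ 2 * n) where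

      private
        -- Two expressions for the degree of `u` in `G`: `slack + k - def` and `n - 1 - codeg`.
        slack-codeg : ∀ u → slack P u + k + db u + 1 ≡ n + def P u
        slack-codeg u = trans (cong (λ t → slack P u + t + db u + 1) (sym (deg+def P u)))
          (trans (eq (slack P u) (deg F u) (def P u) (db u))
            (cong (_+ def P u) (trans (cong (λ t → t + db u + 1) (slack+deg P u)) (deg+codeg G u))))
          where
          eq : ∀ s f d c → s + (f + d) + c + 1 ≡ s + f + c + 1 + d
          eq = solve-∀

        slack-large : ∀ {u} → 0 < def P u → n ≤ slack P u + k + db u
        slack-large {u} 0<u = ≤-linear 0 (ℕ.+-mono-≤ 0<u (ℕ.≤-reflexive (sym (slack-codeg u))))
          (eq n (slack P u + k + db u) (def P u))
          where
          eq : ∀ n s d → n + (d + (s + 1)) + 0 ≡ s + (1 + (n + d))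
          eq = solve-∀

        -- The minimum degree enters here: a deficient vertex has factor degree below `k ≤ deg G u`.
        missing-exists : ∀ {u} → 0 < def P u → ∃[ v ] Missing P u v
        missing-exists {u} 0<u with 0<sum⇒∃0< (D P u) (≤-linear 0
          (ℕ.+-mono-≤ 0<u (ℕ.+-mono-≤ (k≤deg u)
            (ℕ.+-mono-≤ (ℕ.≤-reflexive (sym (slack+deg P u))) (ℕ.≤-reflexive (deg+def P u)))))
          (eq (slack P u) (deg F u) (deg G u) k (def P u)))
          where
          eq : ∀ s f g k d → 1 + (d + (g + (s + f + k))) + 0 ≡ s + (1 + (k + (g + (f + d))))
          eq = solve-∀
        ... | v , 0<Duv = v , missing?-sound P (0<ind 0<Duv)

        stuck-pair : ∀ {u w} → DeficientPair P u w → db w ≤ db u → ⊥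
        stuck-pair {u} {w} uw w≤u =
          no-stuck-numbers k {n} {db u} {db w} {slack P u} {sum db} 1≤k (record
            { 4k≤n+1 = 4k≤
            ; low    = low uw
            ; high   = codeg-closed-neighbourhood P noAdd 0<u noShift (proj₂ (missing-exists 0<u))
            ; E≤     = codeg≤
            ; slack≥ = slack-large 0<u
            ; tie    = tie uw
            })
          where
          0<u : 0 < def P u
          0<u = deficientˡ uw
          instance
            k-nonZero : NonZero k
            k-nonZero = >-nonZero 1≤k
          distinct : u ≢ w → 0 < def P w → n + 2 ≤ db u + db w + 2 * k
          distinct u≢w 0<w = ≤-linear 0
            (ℕ.+-mono-≤ (slack-large 0<u) (ℕ.+-mono-≤ (slack-large 0<w) slacks))
            (eq n (slack P u) (slack P w) (db u) (db w) k)
            where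
            -- The unit `t` of deficiency at `w` makes the count strict, and strictness survives the
            -- division by `k`.
            slacks : suc (slack P u + slack P w + 1) ≤ n
            slacks = ℕ.*-cancelʳ-< k _ n (ℕ.≤-trans (ℕ.≤-reflexive (eq′ (slack P u) (slack P w) k))
              (slack-pair P noAdd 0<u noSwitch uw 1 (inj₂ (u≢w , 0<w))))
              where
              eq′ : ∀ s t k → suc ((s + t + 1) * k) ≡ s * k + k + k * t + 1
              eq′ = solve-∀
            eq : ∀ n s t c d k → n + 2 + (s + k + c + (t + k + d + n)) + 0
              ≡ c + d + 2 * k + (n + (n + suc (s + t + 1)))
            eq = solve-∀
          same : u ≡ w → 2 ≤ def P u → n + 3 ≤ 2 * db u + 2 * k
          same refl 2≤u = ≤-linear 0
            (ℕ.+-mono-≤ (ℕ.*-monoʳ-≤ 2 (ℕ.+-mono-≤ 2≤u (ℕ.≤-reflexive (sym (slack-codeg u))))) slacks)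
            (eq n (slack P u) (db u) k (def P u))
            where
            slacks : slack P u + slack P u + 1 ≤ n
            slacks = ℕ.*-cancelʳ-≤ _ n k (ℕ.≤-trans (ℕ.≤-reflexive (eq′ (slack P u) k))
              (slack-pair P noAdd 0<u noSwitch uw 0 (inj₁ refl)))
              where
              eq′ : ∀ s k → (s + s + 1) * k ≡ s * k + k + k * s + 0
              eq′ = solve-∀
            eq : ∀ n s c k d → n + 3 + (2 * (d + (s + k + c + 1)) + n) + 0
              ≡ 2 * c + 2 * k + (2 * (2 + (n + d)) + (s + s + 1))
            eq = solve-∀
          low : DeficientPair P u w → n + 2 ≤ 2 * db u + 2 * k
          low (inj₁ (u≢w , _ , 0<w)) = ≤-linear 0 (ℕ.+-mono-≤ w≤u (distinct u≢w 0<w))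
            (eq n (db u) (db w) k)
            where
            eq : ∀ n c d k → n + 2 + (c + (c + d + 2 * k)) + 0 ≡ 2 * c + 2 * k + (d + (n + 2))
            eq = solve-∀
          low (inj₂ (u≡w , 2≤u)) = ℕ.≤-trans (ℕ.+-monoʳ-≤ n (s≤s (s≤s z≤n))) (same u≡w 2≤u)
          -- Two units at one vertex sharpen `low` by one; two distinct vertices give the count over
          -- all walks instead.
          tie : DeficientPair P u w → n + 3 ≤ 2 * db u + 2 * k ⊎
            (n + 2 ≤ db u + db w + 2 * k × slack P u * k * db u + k * db u + db w ≤ k * sum db)
          tie (inj₁ (u≢w , _ , 0<w)) =
            inj₂ (distinct u≢w 0<w , codeg-reached P noAdd 0<u noShift u≢w 0<w)
          tie (inj₂ (u≡w , 2≤u)) = inj₁ (same u≡w 2≤u)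

        def-even : 2 ∣ sum (def P)
        def-even = ∣m+n∣m⇒∣n (subst (2 ∣_) total 2∣kn) (handshake F)
          where
          total : k * n ≡ sum (deg F) + sum (def P)
          total = trans (ℕ.*-comm k n) (trans (sym (sum-const n k))
            (trans (sum-cong-≗ (λ i → sym (deg+def P i))) (∑-distrib-+ (deg F) (def P))))

        -- Otherwise the total deficiency would be 1, but it is even because `k * n` is.
        deficient-pair : ∀ {u} → 0 < def P u → ∃[ w ] DeficientPair P u w
        deficient-pair {u} 0<u with any? (DeficientPair-dec u)
        ... | yes found = found
        ... | no none = contradiction (∣⇒≤ (subst (2 ∣_) total def-even)) λ { (s≤s ()) }
          where
          def≡δ : ∀ i → def P i ≡ δ i u
          def≡δ i with i ≟ u
          ... | yes refl = ℕ.≤-antisym (ℕ.≮⇒≥ (λ 2≤u → none (u , inj₂ (refl , 2≤u)))) 0<u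
          ... | no i≢u = ℕ.n≤0⇒n≡0 (ℕ.≮⇒≥ (λ 0<i → none (i , inj₁ ((λ u≡i → i≢u (sym u≡i)) , 0<u , 0<i))))
          total : sum (def P) ≡ 1
          total = trans (sum-cong-≗ def≡δ) (sum-δ₁ u)

      stuck⇒full : ∀ u → def P u ≡ 0
      stuck⇒full u = ℕ.n≤0⇒n≡0 (ℕ.≮⇒≥ λ 0<u → let w , uw = deficient-pair 0<u in
        [ stuck-pair (DeficientPair-sym uw) , stuck-pair uw ]′ (ℕ.≤-total (db u) (db w)))

  factor-of-dense : ∀ {k n} (G : Graph n) → 1 ≤ k → 4 * k ≤ n + 1 → 2 ∣ k * n →
    (∀ v → k ≤ deg G v) → sum (deg (complement G)) + 4 ≤ 2 * n → Factor k G
  factor-of-dense {k} G 1≤k 4k≤ 2∣kn k≤deg codeg≤ = improve (emptyFactor k G) (<-wellFounded _)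
    where
    improve : (P : PartialFactor k G) → Acc _<_ (potential P) → Factor k G
    improve P (acc rec) with add-or-none P | shift-or-none P | switch-or-none P
    ... | inj₁ (P′ , less) | _ | _ = improve P′ (rec less)
    ... | inj₂ _ | inj₁ (P′ , less) | _ = improve P′ (rec less)
    ... | inj₂ _ | inj₂ _ | inj₁ (P′ , less) = improve P′ (rec less)
    ... | inj₂ noAdd | inj₂ noShift | inj₂ noSwitch = fullFactor P
      (stuck⇒full P noAdd noShift noSwitch 1≤k 4k≤ 2∣kn k≤deg codeg≤)

module SpectralComparison where

  open FactorExistence using
    (ind; ind≤1; δ; δ-≢; sum-δ; sum-δ₁; sum-const; sum-mono; α; α-sym; deg; adj⇒≢; complement;
     deg+codeg; ≤-linear; factor-of-dense)
  open import Algebra.Bundles using (CommutativeRing)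
  open import Data.Bool.Base using (Bool; true; false)
  open import Data.Empty using (⊥-elim)
  open import Data.Fin.Base using (Fin; zero; suc; splitAt; _↑ʳ_)
  import Data.Fin.Properties as Fin
  open import Data.Integer.Base as ℤ using (+[1+_]; -[1+_])
  import Data.Integer.Properties as ℤ
  open import Data.Nat.Base as ℕ using (ℕ; zero; suc)
  open import Data.Nat.Divisibility using (_∣_)
  import Data.Nat.Properties as ℕ
  open import Data.Nat.Tactic.RingSolver using (solve-∀)
  open import Data.Product.Base using (∃-syntax; Σ-syntax; _×_; _,_; proj₁; proj₂)
  open import Data.Rational.Base
  open import Data.Rational.Properties
  open import Data.Rational.Unnormalised.Base as ℚᵘ using (mkℚᵘ; *≡*; *≤*)
  import Data.Rational.Unnormalised.Properties as ℚᵘ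
  open import Data.Sum.Base using (_⊎_; inj₁; inj₂; [_,_]′; map₁)
  open import Function.Base using (_∘_)
  open import Level using (0ℓ)
  open import Relation.Binary.PropositionalEquality
  open import Relation.Nullary using (¬_; Dec; does; yes; no; contradiction)
  open import Relation.Nullary.Decidable using (dec⇒maybe; dec-true; dec-false)
  import Tactic.RingSolver as ℚ-Tactic
  open import Tactic.RingSolver.Core.AlmostCommutativeRing
    using (AlmostCommutativeRing; fromCommutativeRing)
  import Algebra.Properties.Semiring.Sum ℕ.+-*-semiring as Σℕ
  open import Algebra.Properties.Semiring.Sum (CommutativeRing.semiring +-*-commutativeRing)
    using (sum; sum-cong-≗; ∑-distrib-+; ∑-comm; *-distribˡ-sum; *-distribʳ-sum)

  -- Rational arithmetic.

  ℚ-ring : AlmostCommutativeRing 0ℓ 0ℓ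
  ℚ-ring = fromCommutativeRing +-*-commutativeRing (λ p → dec⇒maybe (0ℚ ≟ p))

  ≤-linearℚ : ∀ {a b l r} s → 0ℚ ≤ s → l ≤ r → a + r + s ≡ b + l → a ≤ b
  ≤-linearℚ {a} {b} {l} {r} s 0≤s l≤r eq = begin
    a                     ≡⟨ e₁ a r ⟩
    (a + r + 0ℚ) + (- r)  ≤⟨ +-monoˡ-≤ (- r) (+-monoʳ-≤ (a + r) 0≤s) ⟩
    (a + r + s) + (- r)   ≡⟨ cong (_+ (- r)) eq ⟩
    (b + l) + (- r)       ≤⟨ +-monoˡ-≤ (- r) (+-monoʳ-≤ b l≤r) ⟩
    (b + r) + (- r)       ≡⟨ e₂ b r ⟩
    b                     ∎
    where
    open ≤-Reasoning
    e₁ : ∀ a r → a ≡ (a + r + 0ℚ) + (- r)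
    e₁ = ℚ-Tactic.solve-∀ ℚ-ring
    e₂ : ∀ a r → (a + r) + (- r) ≡ a
    e₂ = ℚ-Tactic.solve-∀ ℚ-ring

  <-linearℚ : ∀ {a b l r} s → 0ℚ ≤ s → l < r → a + r + s ≡ b + l → a < b
  <-linearℚ {a} {b} {l} {r} s 0≤s l<r eq = begin-strict
    a                     ≡⟨ e₁ a r ⟩
    (a + r + 0ℚ) + (- r)  ≤⟨ +-monoˡ-≤ (- r) (+-monoʳ-≤ (a + r) 0≤s) ⟩
    (a + r + s) + (- r)   ≡⟨ cong (_+ (- r)) eq ⟩
    (b + l) + (- r)       <⟨ +-monoˡ-< (- r) (+-monoʳ-< b l<r) ⟩
    (b + r) + (- r)       ≡⟨ e₂ b r ⟩
    b                     ∎
    where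
    open ≤-Reasoning
    e₁ : ∀ a r → a ≡ (a + r + 0ℚ) + (- r)
    e₁ = ℚ-Tactic.solve-∀ ℚ-ring
    e₂ : ∀ a r → (a + r) + (- r) ≡ a
    e₂ = ℚ-Tactic.solve-∀ ℚ-ring

  0≤1 : 0ℚ ≤ 1ℚ
  0≤1 = nonNegative⁻¹ 1ℚ

  0<1 : 0ℚ < 1ℚ
  0<1 = positive⁻¹ 1ℚ

  *-monoˡ-≤ : ∀ {p q r} → 0ℚ ≤ r → p ≤ q → r * p ≤ r * q
  *-monoˡ-≤ {r = r} 0≤r = *-monoˡ-≤-nonNeg r {{nonNegative 0≤r}}

  *-monoʳ-≤ : ∀ {p q r} → 0ℚ ≤ r → p ≤ q → p * r ≤ q * r
  *-monoʳ-≤ {r = r} 0≤r = *-monoʳ-≤-nonNeg r {{nonNegative 0≤r}}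

  0≤* : ∀ {p q} → 0ℚ ≤ p → 0ℚ ≤ q → 0ℚ ≤ p * q
  0≤* {p} {q} 0≤p 0≤q = nonNegative⁻¹ (p * q)
    {{nonNeg*nonNeg⇒nonNeg p {{nonNegative 0≤p}} q {{nonNegative 0≤q}}}}

  0≤+ : ∀ {p q} → 0ℚ ≤ p → 0ℚ ≤ q → 0ℚ ≤ p + q
  0≤+ = +-mono-≤

  0<* : ∀ {p q} → 0ℚ < p → 0ℚ < q → 0ℚ < p * q
  0<* {p} {q} 0<p 0<q = positive⁻¹ (p * q) {{pos*pos⇒pos p {{positive 0<p}} q {{positive 0<q}}}}

  0<½ : 0ℚ < ½
  0<½ = positive⁻¹ ½

  divide : ∀ {b e} → 0ℚ < b → 0ℚ < e → ∃[ d ] 0ℚ < d × b * d ≡ e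
  divide {b} {e} 0<b 0<e = 1/ b * e
    , 0<* (positive⁻¹ (1/ b) {{1/pos⇒pos b}}) 0<e
    , trans (sym (*-assoc b (1/ b) e)) (trans (cong (_* e) (*-inverseʳ b)) (*-identityˡ e))
    where
    instance
      posB : Positive b
      posB = positive 0<b
      nzB : NonZero b
      nzB = pos⇒nonZero b

  -- Recursive instead of a fraction, so that `ι (suc n)` unfolds to the polynomial `1ℚ + ι n`.
  ι : ℕ → ℚ
  ι zero    = 0ℚ
  ι (suc n) = 1ℚ + ι n

  0≤ι : ∀ n → 0ℚ ≤ ι n
  0≤ι zero    = ≤-refl
  0≤ι (suc n) = 0≤+ 0≤1 (0≤ι n)

  ι-mono : ∀ {m n} → m ℕ.≤ n → ι m ≤ ι n
  ι-mono {n = n} ℕ.z≤n   = 0≤ι n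
  ι-mono (ℕ.s≤s m≤n) = +-monoʳ-≤ 1ℚ (ι-mono m≤n)

  ι-+ : ∀ m n → ι (m ℕ.+ n) ≡ ι m + ι n
  ι-+ zero    n = sym (+-identityˡ (ι n))
  ι-+ (suc m) n = trans (cong (1ℚ +_) (ι-+ m n)) (sym (+-assoc 1ℚ (ι m) (ι n)))

  ι-* : ∀ m n → ι (m ℕ.* n) ≡ ι m * ι n
  ι-* zero    n = sym (*-zeroˡ (ι n))
  ι-* (suc m) n = trans (ι-+ n (m ℕ.* n)) (trans (cong (λ t → ι n + t) (ι-* m n)) (e (ι m) (ι n)))
    where
    e : ∀ a b → b + a * b ≡ (1ℚ + a) * b
    e = ℚ-Tactic.solve-∀ ℚ-ring

  ι-sum : ∀ {n} (f : Fin n → ℕ) → sum (ι ∘ f) ≡ ι (Σℕ.sum f)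
  ι-sum {zero}  f = refl
  ι-sum {suc n} f = trans (cong (ι (f zero) +_) (ι-sum (f ∘ suc))) (sym (ι-+ (f zero) _))

  sum-monoℚ : ∀ {n} {f g : Fin n → ℚ} → (∀ i → f i ≤ g i) → sum f ≤ sum g
  sum-monoℚ {zero}  f≤g = ≤-refl
  sum-monoℚ {suc n} f≤g = +-mono-≤ (f≤g zero) (sum-monoℚ (f≤g ∘ suc))

  0≤sum : ∀ {n} {f : Fin n → ℚ} → (∀ i → 0ℚ ≤ f i) → 0ℚ ≤ sum f
  0≤sum {zero}  0≤f = ≤-refl
  0≤sum {suc n} 0≤f = 0≤+ (0≤f zero) (0≤sum (0≤f ∘ suc))

  term≤sum : ∀ {n} {f : Fin n → ℚ} → (∀ i → 0ℚ ≤ f i) → ∀ i → f i ≤ sum f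
  term≤sum {suc n} {f} 0≤f zero    = ≤-trans (≤-reflexive (sym (+-identityʳ (f zero))))
    (+-monoʳ-≤ (f zero) (0≤sum (0≤f ∘ suc)))
  term≤sum {suc n} {f} 0≤f (suc i) = ≤-trans (term≤sum (0≤f ∘ suc) i)
    (≤-trans (≤-reflexive (sym (+-identityˡ _))) (+-monoˡ-≤ _ (0≤f zero)))

  ∣sum∣≤ : ∀ {n} (f : Fin n → ℚ) → ∣ sum f ∣ ≤ sum (λ i → ∣ f i ∣)
  ∣sum∣≤ {zero}  f = ≤-refl
  ∣sum∣≤ {suc n} f = ≤-trans (∣p+q∣≤∣p∣+∣q∣ (f zero) _) (+-monoʳ-≤ ∣ f zero ∣ (∣sum∣≤ (f ∘ suc)))

  p≤∣p∣ : ∀ p → p ≤ ∣ p ∣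
  p≤∣p∣ p with ≤-total 0ℚ p
  ... | inj₁ 0≤p = ≤-reflexive (sym (0≤p⇒∣p∣≡p 0≤p))
  ... | inj₂ p≤0 = ≤-trans p≤0 (0≤∣p∣ p)

  toℚᵘ-ι : ∀ n → toℚᵘ (ι n) ℚᵘ.≃ mkℚᵘ (ℤ.+ n) 0
  toℚᵘ-ι zero    = ℚᵘ.≃-refl
  toℚᵘ-ι (suc n) = ℚᵘ.≃-trans (toℚᵘ-homo-+ 1ℚ (ι n))
    (ℚᵘ.≃-trans (ℚᵘ.+-congʳ ℚᵘ.1ℚᵘ (toℚᵘ-ι n))
      (*≡* (trans (ℤ.*-identityʳ _) (trans (cong (λ t → (ℤ.+ 1) ℤ.+ t) (ℤ.*-identityʳ (ℤ.+ n)))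
        (sym (ℤ.*-identityʳ (ℤ.+ suc n)))))))

  -- The denominator of `ε` serves as the multiplier: the product is the numerator.
  archimedean : ∀ {ε} → 0ℚ < ε → ∃[ n ] 1ℚ ≤ ι n * ε
  archimedean {mkℚ +[1+ a ] d _} _ = suc d , toℚᵘ-cancel-≤ (ℚᵘ.≤-respʳ-≃
    (ℚᵘ.≃-sym (ℚᵘ.≃-trans (toℚᵘ-homo-* (ι (suc d)) _) (ℚᵘ.*-congʳ (toℚᵘ-ι (suc d)))))
    (*≤* (subst₂ ℤ._≤_
      (sym (trans (ℤ.*-identityˡ _) (cong +[1+_] (ℕ.+-identityʳ d))))
      (sym (ℤ.*-identityʳ _))
      (ℤ.+≤+ (ℕ.m≤m*n (suc d) (suc a))))))
  archimedean {mkℚ (ℤ.+ zero) d _} (*<* (ℤ.+<+ ()))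
  archimedean {mkℚ -[1+ a ] d _} (*<* ())

  -- Collatz-Wielandt for approximate eigenvectors.

  -- Pairing the approximate eigenvalue equation for y with the weights x, and using the symmetry of a.
  module _ {n} (a : Fin n → Fin n → ℚ) (a-sym : ∀ i j → a i j ≡ a j i) (0≤a : ∀ i j → 0ℚ ≤ a i j)
    {q μ ε η : ℚ} (x y : Fin n → ℚ) (1≤x : ∀ i → 1ℚ ≤ x i) (0≤ε : 0ℚ ≤ ε) (q+ε≤μ : q + ε ≤ μ)
    (super : ∀ i → sum (λ j → a i j * x j) ≤ q * x i)
    (near : ∀ i → ∣ sum (λ j → a i j * y j) - μ * y i ∣ ≤ η)
    where

    private
      0≤x : ∀ i → 0ℚ ≤ x i
      0≤x i = ≤-trans 0≤1 (1≤x i)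

      W : ℚ
      W = sum (λ i → x i * ∣ y i ∣)

      0≤x∣y∣ : ∀ i → 0ℚ ≤ x i * ∣ y i ∣
      0≤x∣y∣ i = 0≤* (0≤x i) (0≤∣p∣ (y i))

      row : ∀ i → μ * ∣ y i ∣ ≤ sum (λ j → a i j * ∣ y j ∣) + η
      row i = begin
        μ * ∣ y i ∣             ≤⟨ *-monoʳ-≤ (0≤∣p∣ (y i)) (p≤∣p∣ μ) ⟩
        ∣ μ ∣ * ∣ y i ∣         ≡⟨ ∣p*q∣≡∣p∣*∣q∣ μ (y i) ⟨
        ∣ μ * y i ∣             ≡⟨ cong ∣_∣ (e Ay (μ * y i)) ⟩
        ∣ Ay - (Ay - μ * y i) ∣ ≤⟨ ∣p-q∣≤∣p∣+∣q∣ Ay (Ay - μ * y i) ⟩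
        ∣ Ay ∣ + ∣ Ay - μ * y i ∣ ≤⟨ +-mono-≤ (∣sum∣≤ (λ j → a i j * y j)) (near i) ⟩
        sum (λ j → ∣ a i j * y j ∣) + η ≡⟨ cong (_+ η) (sum-cong-≗ (λ j → trans
          (∣p*q∣≡∣p∣*∣q∣ (a i j) (y j)) (cong (_* ∣ y j ∣) (0≤p⇒∣p∣≡p (0≤a i j))))) ⟩
        sum (λ j → a i j * ∣ y j ∣) + η ∎
        where
        open ≤-Reasoning
        Ay : ℚ
        Ay = sum (λ j → a i j * y j)
        e : ∀ s t → t ≡ s - (s - t)
        e = ℚ-Tactic.solve-∀ ℚ-ring

      swapped : sum (λ i → x i * sum (λ j → a i j * ∣ y j ∣)) ≤ q * W
      swapped = begin
        sum (λ i → x i * sum (λ j → a i j * ∣ y j ∣))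
          ≡⟨ sum-cong-≗ (λ i → *-distribˡ-sum (x i) (λ j → a i j * ∣ y j ∣)) ⟩
        sum (λ i → sum (λ j → x i * (a i j * ∣ y j ∣)))
          ≡⟨ ∑-comm (λ i j → x i * (a i j * ∣ y j ∣)) ⟩
        sum (λ j → sum (λ i → x i * (a i j * ∣ y j ∣)))
          ≡⟨ sum-cong-≗ (λ j → trans (sum-cong-≗ (λ i → trans
               (cong (λ t → x i * (t * ∣ y j ∣)) (a-sym i j)) (e (x i) (a j i) ∣ y j ∣)))
               (sym (*-distribʳ-sum ∣ y j ∣ (λ i → a j i * x i)))) ⟩
        sum (λ j → sum (λ i → a j i * x i) * ∣ y j ∣)
          ≤⟨ sum-monoℚ (λ j → *-monoʳ-≤ (0≤∣p∣ (y j)) (super j)) ⟩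
        sum (λ j → q * x j * ∣ y j ∣)
          ≡⟨ trans (sum-cong-≗ (λ j → *-assoc q (x j) ∣ y j ∣))
               (sym (*-distribˡ-sum q (λ j → x j * ∣ y j ∣))) ⟩
        q * W ∎
        where
        open ≤-Reasoning
        e : ∀ u v w → u * (v * w) ≡ (v * u) * w
        e = ℚ-Tactic.solve-∀ ℚ-ring

      total : μ * W ≤ q * W + η * sum x
      total = begin
        μ * W
          ≡⟨ trans (*-distribˡ-sum μ (λ i → x i * ∣ y i ∣)) (sum-cong-≗ (λ i → e μ (x i) ∣ y i ∣)) ⟩
        sum (λ i → x i * (μ * ∣ y i ∣))
          ≤⟨ sum-monoℚ (λ i → *-monoˡ-≤ (0≤x i) (row i)) ⟩
        sum (λ i → x i * (sum (λ j → a i j * ∣ y j ∣) + η))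
          ≡⟨ trans (sum-cong-≗ (λ i → *-distribˡ-+ (x i) (sum (λ j → a i j * ∣ y j ∣)) η))
               (∑-distrib-+ (λ i → x i * sum (λ j → a i j * ∣ y j ∣)) (λ i → x i * η)) ⟩
        sum (λ i → x i * sum (λ j → a i j * ∣ y j ∣)) + sum (λ i → x i * η)
          ≤⟨ +-monoˡ-≤ _ swapped ⟩
        q * W + sum (λ i → x i * η)
          ≡⟨ cong (λ t → q * W + t) (trans (sym (*-distribʳ-sum η x)) (*-comm (sum x) η)) ⟩
        q * W + η * sum x ∎
        where
        open ≤-Reasoning
        e : ∀ u v w → u * (v * w) ≡ v * (u * w)
        e = ℚ-Tactic.solve-∀ ℚ-ring

    -- `total` and `q + ε ≤ μ` bound `ε * W` by `η * sum x`, and `W` exceeds each single `∣ y i ∣`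
    -- because `1 ≤ x`.
    approximate-eigenvector-small : ∀ i → ε * ∣ y i ∣ ≤ η * sum x
    approximate-eigenvector-small i = ≤-trans (*-monoˡ-≤ 0≤ε (≤-trans
        (≤-trans (≤-reflexive (sym (*-identityˡ ∣ y i ∣))) (*-monoʳ-≤ (0≤∣p∣ (y i)) (1≤x i)))
        (term≤sum 0≤x∣y∣ i)))
      (≤-linearℚ 0ℚ ≤-refl (+-mono-≤ total (*-monoʳ-≤ (0≤sum 0≤x∣y∣) q+ε≤μ))
        (e ε W η (sum x) q μ))
      where
      e : ∀ ε W η X q μ → ε * W + (q * W + η * X + μ * W) + 0ℚ ≡ η * X + (μ * W + (q + ε) * W)
      e = ℚ-Tactic.solve-∀ ℚ-ring

  α-ℚ : ∀ {n} → Graph n → Fin n → Fin n → ℚ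
  α-ℚ G i j = ι (α G i j)

  -- Positivity is normalised to `1 ≤ x`, so that no minimum of `x` appears in the estimates.
  Supersolution : ∀ {n} → Graph n → ℚ → Set
  Supersolution {n} G q = Σ[ x ∈ (Fin n → ℚ) ] (∀ i → 1ℚ ≤ x i) ×
    (∀ i → sum (λ j → α-ℚ G i j * x j) ≤ q * x i)

  *-seq : ∀ x y t → seq x t * seq y t ≡ seq (x *ℝ y) t
  *-seq x y t = refl

  dot-seq : ∀ {n} (a y : Fin n → ℝ) (c : Fin n → ℚ) t → (∀ j → c j ≡ seq (a j) t) →
    sum (λ j → c j * seq (y j) t) ≡ seq (sumℝ (λ j → a j *ℝ y j)) t
  dot-seq {zero}  a y c t a≡c = refl
  dot-seq {suc n} a y c t a≡c = cong₂ _+_ (cong (_* seq (y zero) t) (a≡c zero))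
    (dot-seq (a ∘ suc) (y ∘ suc) (c ∘ suc) t (a≡c ∘ suc))

  entry-seq : ∀ {n} (G : Graph n) i j t → α-ℚ G i j ≡ seq (adjacencyMatrix G i j) t
  entry-seq G i j t with adj G i j
  ... | true  = +-identityʳ 1ℚ
  ... | false = refl

  *ᵥ-seq : ∀ {n} (G : Graph n) (y : Fin n → ℝ) i t →
    sum (λ j → α-ℚ G i j * seq (y j) t) ≡ seq ((adjacencyMatrix G *ᵥ y) i) t
  *ᵥ-seq G y i t = dot-seq (adjacencyMatrix G i) y (α-ℚ G i) t (λ j → entry-seq G i j t)

  Residual< : ∀ {n} → Graph n → (Fin n → ℝ) → ℝ → ℚ → Fin n → ℕ → Set
  Residual< G y μ η i t = ∣ sum (λ j → α-ℚ G i j * seq (y j) t) - seq μ t * seq (y i) t ∣ < η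

  subst-residual : ∀ {r r′ s s′ η} → r ≡ r′ → s ≡ s′ → ∣ r - s ∣ < η → ∣ r′ - s′ ∣ < η
  subst-residual refl refl h = h

  subst-residual′ : ∀ {r r′ s s′ η} → r ≡ r′ → s ≡ s′ → ∣ r′ - s′ ∣ < η → ∣ r - s ∣ < η
  subst-residual′ refl refl h = h

  residual-of-eigenvector : ∀ {n} (G : Graph n) (y : Fin n → ℝ) (μ : ℝ) i →
    (adjacencyMatrix G *ᵥ y) i ≈ℝ μ *ℝ y i →
    ∀ η → 0ℚ < η → ∃[ N ] (∀ t → N ℕ.≤ t → Residual< G y μ η i t)
  residual-of-eigenvector G y μ i eigen η 0<η = proj₁ (eigen η 0<η) , λ t N≤t →
    subst-residual′ (*ᵥ-seq G y i t) (*-seq μ (y i) t) (proj₂ (eigen η 0<η) t N≤t)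

  -- ℚ has η: left implicit, these arguments would be solved numerator by numerator.
  eigenvector-of-residual : ∀ {n} (G : Graph n) (y : Fin n → ℝ) (μ : ℝ) i →
    (∀ η → 0ℚ < η → ∃[ N ] (∀ t → N ℕ.≤ t → Residual< G y μ η i t)) →
    (adjacencyMatrix G *ᵥ y) i ≈ℝ μ *ℝ y i
  eigenvector-of-residual G y μ i near η 0<η = proj₁ (near η 0<η) , λ t N≤t →
    subst-residual {sum (λ j → α-ℚ G i j * seq (y j) t)} {seq ((adjacencyMatrix G *ᵥ y) i) t}
      {seq μ t * seq (y i) t} {seq (μ *ℝ y i) t} {η}
      (*ᵥ-seq G y i t) (*-seq μ (y i) t) (proj₂ (near η 0<η) t N≤t)

  eventually-all : ∀ {n} {P : Fin n → ℕ → Set} → (∀ i → ∃[ N ] (∀ t → N ℕ.≤ t → P i t)) →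
    ∃[ N ] (∀ t → N ℕ.≤ t → ∀ i → P i t)
  eventually-all {zero}  ev = 0 , λ _ _ ()
  eventually-all {suc n} ev with ev zero | eventually-all (ev ∘ suc)
  ... | M , p | N , q = M ℕ.⊔ N , λ where
    t M⊔N≤t zero    → p t (ℕ.m⊔n≤o⇒m≤o M N M⊔N≤t)
    t M⊔N≤t (suc i) → q t (ℕ.m⊔n≤o⇒n≤o M N M⊔N≤t) i

  -- If `μ` exceeded `q` by `ε`, the vanishing residual would force every coordinate of the
  -- eigenvector to 0.
  supersolution-bound : ∀ {n} (G : Graph n) {q μ} → Supersolution G q →
    IsEigenvalue (adjacencyMatrix G) μ → ¬ (fromℚ q <ℝ μ)
  supersolution-bound {n} G {q} {μ} (x , 1≤x , super) (y , y≉0 , eigen) (ε , 0<ε , N , gap) =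
    -- The added 1 keeps the divisor positive and makes `η * sum x < ε * δ′` strict.
    y≉0 λ i δ′ 0<δ′ → vanishes i δ′ (divide {1ℚ + sum x} {ε * δ′} 0<1+X (0<* 0<ε 0<δ′))
    where
    0<1+X : 0ℚ < 1ℚ + sum x
    0<1+X = +-mono-<-≤ 0<1 (0≤sum (λ i → ≤-trans 0≤1 (1≤x i)))
    small : ∀ η t → N ℕ.≤ t → (∀ i → Residual< G y μ η i t) → ∀ i → ε * ∣ seq (y i) t ∣ ≤ η * sum x
    small η t N≤t near = approximate-eigenvector-small (α-ℚ G)
      (λ i j → cong ι (α-sym G i j)) (λ i j → 0≤ι (α G i j)) {q} {seq μ t} {ε} {η}
      x (λ j → seq (y j) t) 1≤x (<⇒≤ 0<ε) (<⇒≤ (gap t N≤t)) super (λ j → <⇒≤ (near j))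
    vanishes : ∀ i δ′ → (∃[ η ] 0ℚ < η × (1ℚ + sum x) * η ≡ ε * δ′) →
      ∃[ M ] (∀ t → M ℕ.≤ t → ∣ seq (y i) t - 0ℚ ∣ < δ′)
    vanishes i δ′ (η , 0<η , η-eq) = N ℕ.⊔ M , λ t N⊔M≤t →
      subst (λ s → ∣ s ∣ < δ′) (sym (+-identityʳ (seq (y i) t)))
        (*-cancelˡ-<-nonNeg ε {{nonNegative (<⇒≤ 0<ε)}}
          (≤-<-trans (small η t (ℕ.m⊔n≤o⇒m≤o N M N⊔M≤t)
            (proj₂ eventually t (ℕ.m⊔n≤o⇒n≤o N M N⊔M≤t)) i) ηX<))
      where
      eventually : ∃[ M ] (∀ t → M ℕ.≤ t → ∀ i → Residual< G y μ η i t)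
      eventually = eventually-all {P = Residual< G y μ η}
        (λ j → residual-of-eigenvector G y μ j (eigen j) η 0<η)
      M : ℕ
      M = proj₁ eventually
      e : ∀ η X → η * X + η + 0ℚ ≡ (1ℚ + X) * η + 0ℚ
      e = ℚ-Tactic.solve-∀ ℚ-ring
      ηX< : η * sum x < ε * δ′
      ηX< = <-linearℚ 0ℚ ≤-refl 0<η (trans (e η (sum x)) (cong (_+ 0ℚ) η-eq))

  sum-constℚ : ∀ n c → sum {n} (λ _ → c) ≡ ι n * c
  sum-constℚ zero    c = sym (*-zeroˡ c)
  sum-constℚ (suc n) c = trans (cong (c +_) (sum-constℚ n c)) (e (ι n) c)
    where
    e : ∀ N c → c + N * c ≡ (1ℚ + N) * c
    e = ℚ-Tactic.solve-∀ ℚ-ring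

  sum-δℚ : ∀ {n} (a : Fin n) → sum (λ i → ι (δ i a)) ≡ 1ℚ
  sum-δℚ a = trans (ι-sum (λ i → δ i a)) (trans (cong ι (sum-δ₁ a)) (+-identityʳ 1ℚ))

  -- Graphs with too few edges.

  module _ {n} (G : Graph n) (1≤deg : ∀ i → 1 ℕ.≤ deg G i) where

    -- This row sum of `A²` adds the degrees of the neighbours of `i`. It omits the degree of `i`
    -- and those of its non-neighbours, each at least 1, together at least `n - 1`.
    two-walks : ∀ i → Σℕ.sum (λ j → α G i j ℕ.* deg G j) ℕ.+ n ℕ.≤ Σℕ.sum (deg G) ℕ.+ 1
    two-walks i = ≤-linear 0
      (ℕ.+-mono-≤ bound (ℕ.≤-reflexive (sym (deg+codeg G i))))
      (eq (Σℕ.sum (λ j → α G i j ℕ.* deg G j)) n (Σℕ.sum (deg G)) (deg G i) (deg (complement G) i))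
      where
      eq : ∀ s n t d c → s ℕ.+ n ℕ.+ (t ℕ.+ (d ℕ.+ c ℕ.+ 1)) ℕ.+ 0 ≡ t ℕ.+ 1 ℕ.+ (s ℕ.+ c ℕ.+ d ℕ.+ n)
      eq = solve-∀
      codegree : Fin n → ℕ
      codegree = deg (complement G)
      pointwise : ∀ j → α G i j ℕ.* deg G j ℕ.+ α (complement G) i j ℕ.+ δ j i ℕ.* deg G j ℕ.≤ deg G j
      pointwise j with adj G i j in ij | i Fin.≟ j | j Fin.≟ i
      ... | _     | yes p    | no ¬q = contradiction (sym p) ¬q
      ... | _     | no ¬p    | yes q = contradiction (sym q) ¬p
      ... | true  | yes refl | yes _ = contradiction refl (adj⇒≢ G ij)
      ... | true  | no _     | no _  = ℕ.≤-reflexive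
        (trans (ℕ.+-identityʳ _) (trans (ℕ.+-identityʳ _) (ℕ.+-identityʳ _)))
      ... | false | yes _    | yes _ = ℕ.≤-reflexive (ℕ.+-identityʳ _)
      ... | false | no _     | no _  = 1≤deg j
      bound : Σℕ.sum (λ j → α G i j ℕ.* deg G j) ℕ.+ codegree i ℕ.+ deg G i ℕ.≤ Σℕ.sum (deg G)
      bound = ℕ.≤-trans (ℕ.≤-reflexive (sym (trans
          (Σℕ.∑-distrib-+ (λ j → α G i j ℕ.* deg G j ℕ.+ α (complement G) i j) (λ j → δ j i ℕ.* deg G j))
          (cong₂ ℕ._+_ (Σℕ.∑-distrib-+ (λ j → α G i j ℕ.* deg G j) (α (complement G) i))
            (sum-δ i (deg G))))))
        (sum-mono pointwise)

    module _ {c : ℕ} (n≡2+c : n ≡ 2 ℕ.+ c)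
      (sparse : 2 ℕ.* n ℕ.≤ Σℕ.sum (deg (complement G)) ℕ.+ 3) where

      -- Since `S = n² - n - E`, the hypothesis `2n ≤ E + 3` turns `S + 1 - n` into at most
      -- `(n - 2)²`.
      two-walks≤ : ∀ i → Σℕ.sum (λ j → α G i j ℕ.* deg G j) ℕ.≤ c ℕ.* c
      two-walks≤ i = conclude (two-walks i)
        where
        S E s : ℕ
        S = Σℕ.sum (deg G)
        E = Σℕ.sum (deg (complement G))
        s = Σℕ.sum (λ j → α G i j ℕ.* deg G j)
        total : S ℕ.+ E ℕ.+ n ℕ.* 1 ≡ n ℕ.* n
        total = trans (sym (trans (Σℕ.∑-distrib-+ (λ j → deg G j ℕ.+ deg (complement G) j) (λ _ → 1))
            (cong₂ ℕ._+_ (Σℕ.∑-distrib-+ (deg G) (deg (complement G))) (sum-const n 1))))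
          (trans (Σℕ.sum-cong-≗ (deg+codeg G)) (sum-const n n))
        conclude : s ℕ.+ n ℕ.≤ S ℕ.+ 1 → s ℕ.≤ c ℕ.* c
        conclude walks = ≤-linear 0 (ℕ.+-mono-≤ walks (ℕ.+-mono-≤ sparse
            (ℕ.≤-reflexive (trans total (cong₂ ℕ._*_ n≡2+c n≡2+c)))))
          (trans (eq s S E c)
            (cong (λ t → c ℕ.* c ℕ.+ (s ℕ.+ t ℕ.+ (2 ℕ.* t ℕ.+ (S ℕ.+ E ℕ.+ t ℕ.* 1)))) (sym n≡2+c)))
          where
          eq : ∀ s S E c → s ℕ.+ (S ℕ.+ 1 ℕ.+ (E ℕ.+ 3 ℕ.+ (2 ℕ.+ c) ℕ.* (2 ℕ.+ c))) ℕ.+ 0 ≡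
            c ℕ.* c ℕ.+ (s ℕ.+ (2 ℕ.+ c) ℕ.+ (2 ℕ.* (2 ℕ.+ c) ℕ.+ (S ℕ.+ E ℕ.+ (2 ℕ.+ c) ℕ.* 1)))
          eq = solve-∀

      -- For x = c + deg, A x ≤ c x amounts to A deg ≤ c².
      sparse-supersolution : Supersolution G (ι c)
      sparse-supersolution = (λ i → ι (c ℕ.+ deg G i)) , 1≤x , super
        where
        1≤x : ∀ i → 1ℚ ≤ ι (c ℕ.+ deg G i)
        1≤x i = ≤-trans (≤-reflexive (sym (+-identityʳ 1ℚ)))
          (ι-mono {1} (ℕ.≤-trans (1≤deg i) (ℕ.m≤n+m _ c)))
        nat : ∀ i → Σℕ.sum (λ j → α G i j ℕ.* (c ℕ.+ deg G j)) ℕ.≤ c ℕ.* (c ℕ.+ deg G i)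
        nat i = ℕ.≤-trans (ℕ.≤-reflexive (trans
            (Σℕ.sum-cong-≗ (λ j → trans (ℕ.*-distribˡ-+ (α G i j) c (deg G j))
              (cong (ℕ._+ α G i j ℕ.* deg G j) (ℕ.*-comm (α G i j) c))))
            (trans (Σℕ.∑-distrib-+ (λ j → c ℕ.* α G i j) (λ j → α G i j ℕ.* deg G j))
              (cong (ℕ._+ Σℕ.sum (λ j → α G i j ℕ.* deg G j)) (sym (Σℕ.*-distribˡ-sum c (α G i)))))))
          (ℕ.≤-trans (ℕ.+-monoʳ-≤ (c ℕ.* deg G i) (two-walks≤ i))
            (ℕ.≤-reflexive (trans (ℕ.+-comm (c ℕ.* deg G i) (c ℕ.* c))
              (sym (ℕ.*-distribˡ-+ c c (deg G i))))))
        super : ∀ i → sum (λ j → α-ℚ G i j * ι (c ℕ.+ deg G j)) ≤ ι c * ι (c ℕ.+ deg G i)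
        super i = ≤-trans (≤-reflexive (trans
            (sum-cong-≗ (λ j → sym (ι-* (α G i j) (c ℕ.+ deg G j))))
            (ι-sum (λ j → α G i j ℕ.* (c ℕ.+ deg G j)))))
          (≤-trans (ι-mono (nat i)) (≤-reflexive (ι-* c (c ℕ.+ deg G i))))

  -- Graphs with a vertex of low degree.

  -- b, a and c are the weights of v, of its neighbours and of the remaining vertices, modelled on an
  -- eigenvector of K_j ∇ (K₁ ∪ K_{m+1}).
  module _ {n j m : ℕ} (G : Graph n) (n≡ : n ≡ 2 ℕ.+ (j ℕ.+ m)) (v : Fin n) (degv≤j : deg G v ℕ.≤ j)
    {q a b c : ℚ} (1≤b : 1ℚ ≤ b) (1≤c : 1ℚ ≤ c) (c≤a : c ≤ a)
    (row-v : ι j * a ≤ q * b)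
    (row-near : (ι j - 1ℚ) * a + b + (1ℚ + ι m) * c ≤ q * a)
    (row-far : ι j * a + ι m * c ≤ q * c)
    where

    private
      pick : Bool → Bool → ℚ
      pick true  _     = b
      pick false true  = a
      pick false false = c

      x : Fin n → ℚ
      x i = pick (does (i Fin.≟ v)) (adj G v i)

      1≤pick : ∀ s t → 1ℚ ≤ pick s t
      1≤pick true  _     = 1≤b
      1≤pick false true  = ≤-trans 1≤c c≤a
      1≤pick false false = 1≤c

      1≤x : ∀ i → 1ℚ ≤ x i
      1≤x i = 1≤pick (does (i Fin.≟ v)) (adj G v i)

      0≤x : ∀ i → 0ℚ ≤ x i
      0≤x i = ≤-trans 0≤1 (1≤x i)

      x-v : x v ≡ b
      x-v = cong (λ s → pick s (adj G v v)) (dec-true (v Fin.≟ v) refl)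

      x-near : ∀ {i} → adj G v i ≡ true → x i ≡ a
      x-near {i} vi = cong₂ pick (dec-false (i Fin.≟ v) (λ i≡v → adj⇒≢ G vi (sym i≡v))) vi

      x-far : ∀ {i} → i ≢ v → adj G v i ≡ false → x i ≡ c
      x-far {i} i≢v vi = cong₂ pick (dec-false (i Fin.≟ v) i≢v) vi

      -- Linear in the indicators, so that `sum x` depends on `G` only through the degree of `v`.
      pick-linear : ∀ s t → (s ≡ true → t ≡ false) →
        pick s t ≡ c + ((a - c) * ι (ind t) + (b - c) * ι (ind s))
      pick-linear true true excl = contradiction (excl refl) λ ()
      pick-linear true false _ = e a b c
        where
        e : ∀ a b c → b ≡ c + ((a - c) * 0ℚ + (b - c) * (1ℚ + 0ℚ))
        e = ℚ-Tactic.solve-∀ ℚ-ring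
      pick-linear false true _ = e a b c
        where
        e : ∀ a b c → a ≡ c + ((a - c) * (1ℚ + 0ℚ) + (b - c) * 0ℚ)
        e = ℚ-Tactic.solve-∀ ℚ-ring
      pick-linear false false _ = e a b c
        where
        e : ∀ a b c → c ≡ c + ((a - c) * 0ℚ + (b - c) * 0ℚ)
        e = ℚ-Tactic.solve-∀ ℚ-ring

      v-nonadjacent : ∀ i → does (i Fin.≟ v) ≡ true → adj G v i ≡ false
      v-nonadjacent i p with i Fin.≟ v
      ... | yes refl = adj-irrefl G v

      sum-x : sum x ≡ ι n * c + ((a - c) * ι (deg G v) + (b - c) * 1ℚ)
      sum-x = trans (sum-cong-≗ (λ i → pick-linear (does (i Fin.≟ v)) (adj G v i) (v-nonadjacent i)))
        (trans (∑-distrib-+ (λ _ → c) (λ i → (a - c) * ι (α G v i) + (b - c) * ι (δ i v)))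
          (cong₂ _+_ (sum-constℚ n c)
            (trans (∑-distrib-+ (λ i → (a - c) * ι (α G v i)) (λ i → (b - c) * ι (δ i v)))
              (cong₂ _+_
                (trans (sym (*-distribˡ-sum (a - c) (λ i → ι (α G v i))))
                  (cong ((a - c) *_) (ι-sum (α G v))))
                (trans (sym (*-distribˡ-sum (b - c) (λ i → ι (δ i v))))
                  (cong ((b - c) *_) (sum-δℚ v)))))))

      ιn : ι n ≡ 1ℚ + (1ℚ + (ι j + ι m))
      ιn = trans (cong ι n≡) (cong (λ t → 1ℚ + (1ℚ + t)) (ι-+ j m))

      0≤a-c : 0ℚ ≤ a - c
      0≤a-c = ≤-trans (≤-reflexive (sym (+-inverseʳ c))) (+-monoˡ-≤ (- c) c≤a)

      -- Having fewer than `j` neighbours only lowers the total, because `c ≤ a`.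
      sum-x≤ : sum x ≤ b + ι j * a + (1ℚ + ι m) * c
      sum-x≤ = begin
        sum x
          ≡⟨ sum-x ⟩
        ι n * c + ((a - c) * ι (deg G v) + (b - c) * 1ℚ)
          ≤⟨ +-monoʳ-≤ (ι n * c) (+-monoˡ-≤ ((b - c) * 1ℚ) (*-monoˡ-≤ 0≤a-c (ι-mono degv≤j))) ⟩
        ι n * c + ((a - c) * ι j + (b - c) * 1ℚ)
          ≡⟨ cong (λ t → t * c + ((a - c) * ι j + (b - c) * 1ℚ)) ιn ⟩
        (1ℚ + (1ℚ + (ι j + ι m))) * c + ((a - c) * ι j + (b - c) * 1ℚ)
          ≡⟨ e (ι j) (ι m) a b c ⟩
        b + ι j * a + (1ℚ + ι m) * c ∎
        where
        open ≤-Reasoning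
        e : ∀ J M a b c → (1ℚ + (1ℚ + (J + M))) * c + ((a - c) * J + (b - c) * 1ℚ) ≡
          b + J * a + (1ℚ + M) * c
        e = ℚ-Tactic.solve-∀ ℚ-ring

      weighted≤sum : (w : Fin n → ℕ) → (∀ i → w i ℕ.≤ 1) → sum (λ i → ι (w i) * x i) ≤ sum x
      weighted≤sum w w≤1 = sum-monoℚ (λ i → ≤-trans
        (*-monoʳ-≤ (0≤x i) (ι-mono (w≤1 i)))
        (≤-reflexive (trans (cong (_* x i) (+-identityʳ 1ℚ)) (*-identityˡ (x i)))))

      weighted-+ : (w w′ : Fin n → ℕ) → sum (λ i → ι (w i ℕ.+ w′ i) * x i) ≡
        sum (λ i → ι (w i) * x i) + sum (λ i → ι (w′ i) * x i)
      weighted-+ w w′ = trans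
        (sum-cong-≗ (λ i → trans (cong (_* x i) (ι-+ (w i) (w′ i)))
          (*-distribʳ-+ (x i) (ι (w i)) (ι (w′ i)))))
        (∑-distrib-+ (λ i → ι (w i) * x i) (λ i → ι (w′ i) * x i))

      weighted-δ : ∀ u → sum (λ i → ι (δ i u) * x i) ≡ x u
      weighted-δ u = trans (sum-cong-≗ (λ i → at i (i Fin.≟ u)))
        (trans (sym (*-distribʳ-sum (x u) (λ i → ι (δ i u))))
          (trans (cong (_* x u) (sum-δℚ u)) (*-identityˡ (x u))))
        where
        at : ∀ i → Dec (i ≡ u) → ι (δ i u) * x i ≡ ι (δ i u) * x u
        at i (yes refl) = refl
        at i (no i≢u) = trans (cong (λ t → ι t * x i) (δ-≢ i≢u))
          (trans (trans (*-zeroˡ (x i)) (sym (*-zeroˡ (x u)))) (cong (λ t → ι t * x u) (sym (δ-≢ i≢u))))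

      Ax : Fin n → ℚ
      Ax i = sum (λ j → α-ℚ G i j * x j)

      -- Rows are bounded by what they miss from the total: a neighbour of `v` misses itself, and in
      -- `Ax-far` a vertex not adjacent to `v` also misses `v`. With `sum-x≤` these become the rows
      -- of the model graph.
      Ax-near : ∀ i → Ax i + x i ≤ sum x
      Ax-near i = ≤-trans
        (≤-reflexive (sym (trans (weighted-+ (α G i) (λ j → δ j i)) (cong (Ax i +_) (weighted-δ i)))))
        (weighted≤sum (λ j → α G i j ℕ.+ δ j i) w≤1)
        where
        w≤1 : ∀ j → α G i j ℕ.+ δ j i ℕ.≤ 1
        w≤1 j with j Fin.≟ i
        ... | yes refl rewrite adj-irrefl G j = ℕ.≤-refl
        ... | no _ = ℕ.≤-trans (ℕ.≤-reflexive (ℕ.+-identityʳ _)) (ind≤1 (adj G i j))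

      Ax-far : ∀ i → i ≢ v → adj G v i ≡ false → Ax i + x i + x v ≤ sum x
      Ax-far i i≢v vi = ≤-trans
        (≤-reflexive (sym (trans (weighted-+ (λ j → α G i j ℕ.+ δ j i) (λ j → δ j v))
          (cong₂ _+_ (trans (weighted-+ (α G i) (λ j → δ j i)) (cong (Ax i +_) (weighted-δ i)))
            (weighted-δ v)))))
        (weighted≤sum (λ j → α G i j ℕ.+ δ j i ℕ.+ δ j v) w≤1)
        where
        w≤1 : ∀ j → α G i j ℕ.+ δ j i ℕ.+ δ j v ℕ.≤ 1
        w≤1 j with j Fin.≟ i | j Fin.≟ v
        ... | yes refl | yes refl = contradiction refl i≢v
        ... | yes refl | no _ rewrite adj-irrefl G j = ℕ.≤-refl
        ... | no _ | yes refl rewrite trans (adj-sym G i j) vi = ℕ.≤-refl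
        ... | no _ | no _ = ℕ.≤-trans
          (ℕ.≤-reflexive (trans (ℕ.+-identityʳ _) (ℕ.+-identityʳ _))) (ind≤1 (adj G i j))

      Ax-v : Ax v ≡ ι (deg G v) * a
      Ax-v = trans (sum-cong-≗ (λ i → at i (adj G v i) refl))
        (trans (sym (*-distribʳ-sum a (λ i → ι (α G v i)))) (cong (_* a) (ι-sum (α G v))))
        where
        at : ∀ i s → adj G v i ≡ s → ι (α G v i) * x i ≡ ι (α G v i) * a
        at i true  vi = cong (ι (α G v i) *_) (x-near vi)
        at i false vi = trans (cong (λ t → ι (ind t) * x i) vi)
          (trans (trans (*-zeroˡ (x i)) (sym (*-zeroˡ a))) (cong (λ t → ι (ind t) * a) (sym vi)))

      row : ∀ i → Dec (i ≡ v) → ∀ s → adj G v i ≡ s → Ax i ≤ q * x i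
      row i (yes refl) _ _ = ≤-trans (≤-reflexive Ax-v)
        (≤-trans (*-monoʳ-≤ (≤-trans 0≤1 (≤-trans 1≤c c≤a)) (ι-mono degv≤j))
          (≤-trans row-v (≤-reflexive (cong (q *_) (sym x-v)))))
      row i (no _) true vi = ≤-trans
        (≤-linearℚ 0ℚ ≤-refl (+-mono-≤ (subst (λ t → Ax i + t ≤ sum x) (x-near vi) (Ax-near i))
            (+-mono-≤ sum-x≤ row-near))
          (e (Ax i) (sum x) (ι j) (ι m) a b c q))
        (≤-reflexive (cong (q *_) (sym (x-near vi))))
        where
        e : ∀ r s J M a b c q → r + (s + (b + J * a + (1ℚ + M) * c + q * a)) + 0ℚ ≡
          q * a + (r + a + (s + ((J - 1ℚ) * a + b + (1ℚ + M) * c)))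
        e = ℚ-Tactic.solve-∀ ℚ-ring
      row i (no i≢v) false vi = ≤-trans
        (≤-linearℚ 0ℚ ≤-refl (+-mono-≤
            (subst₂ (λ t u → Ax i + t + u ≤ sum x) (x-far i≢v vi) x-v (Ax-far i i≢v vi))
            (+-mono-≤ sum-x≤ row-far))
          (e (Ax i) (sum x) (ι j) (ι m) a b c q))
        (≤-reflexive (cong (q *_) (sym (x-far i≢v vi))))
        where
        e : ∀ r s J M a b c q → r + (s + (b + J * a + (1ℚ + M) * c + q * c)) + 0ℚ ≡
          q * c + (r + c + b + (s + (J * a + M * c)))
        e = ℚ-Tactic.solve-∀ ℚ-ring

    low-degree-supersolution : Supersolution G q
    low-degree-supersolution = x , 1≤x , λ i → row i (i Fin.≟ v) (adj G v i) refl

  -- Roots by bisection.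

  ∣p-q∣≤ : ∀ {p q l u} → l ≤ p → p ≤ u → l ≤ q → q ≤ u → ∣ p - q ∣ ≤ u - l
  ∣p-q∣≤ {p} {q} {l} {u} l≤p p≤u l≤q q≤u = [ (λ eq → ≤-trans (≤-reflexive eq) up) ,
      (λ eq → ≤-trans (≤-reflexive eq) down) ]′ (∣p∣≡p∨∣p∣≡-p (p - q))
    where
    up : p - q ≤ u - l
    up = +-mono-≤ p≤u (neg-antimono-≤ l≤q)
    e : ∀ p q → - (p - q) ≡ q - p
    e = ℚ-Tactic.solve-∀ ℚ-ring
    down : - (p - q) ≤ u - l
    down = ≤-trans (≤-reflexive (e p q)) (+-mono-≤ q≤u (neg-antimono-≤ l≤p))

  ½^ : ℕ → ℚ
  ½^ zero    = 1ℚ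
  ½^ (suc n) = ½ * ½^ n

  0≤½^ : ∀ n → 0ℚ ≤ ½^ n
  0≤½^ zero    = 0≤1
  0≤½^ (suc n) = 0≤* (<⇒≤ 0<½) (0≤½^ n)

  ½-double : ∀ p → ½ * p + ½ * p ≡ p
  ½-double p = trans (sym (*-distribʳ-+ p ½ ½)) (*-identityˡ p)

  -- Bernoulli's inequality `n + 1 ≤ 2^n`, with the power moved to the left.
  ½^*ι≤1 : ∀ n → ½^ n * ι (suc n) ≤ 1ℚ
  ½^*ι≤1 zero    = ≤-reflexive (trans (*-identityˡ _) (+-identityʳ 1ℚ))
  ½^*ι≤1 (suc n) = ≤-trans
    (≤-linearℚ (h * ι n) (0≤* (0≤* (<⇒≤ 0<½) (0≤½^ n)) (0≤ι n)) ≤-refl (e h (ι n)))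
    (≤-trans (≤-reflexive (cong (_* ι (suc n)) (½-double (½^ n)))) (½^*ι≤1 n))
    where
    h : ℚ
    h = ½ * ½^ n
    e : ∀ h N → h * (1ℚ + (1ℚ + N)) + 0ℚ + h * N ≡ (h + h) * (1ℚ + N) + 0ℚ
    e = ℚ-Tactic.solve-∀ ℚ-ring

  ½^-small : ∀ {ε} → 0ℚ < ε → ∃[ N ] ½^ N < ε
  ½^-small {ε} 0<ε = N , *-cancelʳ-<-nonNeg (ι (suc N)) {{nonNegative (0≤ι (suc N))}}
      (≤-<-trans (½^*ι≤1 N) (≤-<-trans (proj₂ (archimedean 0<ε)) Nε<))
    where
    N : ℕ
    N = proj₁ (archimedean 0<ε)
    e : ∀ n ε → n * ε + ε + 0ℚ ≡ ε * (1ℚ + n) + 0ℚ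
    e = ℚ-Tactic.solve-∀ ℚ-ring
    Nε< : ι N * ε < ε * ι (suc N)
    Nε< = <-linearℚ 0ℚ ≤-refl 0<ε (e (ι N) ε)

  -- Approximation from one side: `above` is what a supersolution needs at each stage, `limit` what
  -- makes the limit an eigenvalue. `g` is only ever evaluated at rationals, where comparison with
  -- `d` is decidable.
  record Root (g : ℚ → ℚ) (d : ℚ) : Set where
    field
      approx : ℕ → ℚ
      isCauchy : Cauchy approx
      0≤approx : ∀ t → 0ℚ ≤ approx t
      above  : ∀ t → d ≤ g (approx t)
      limit  : ∀ ε → 0ℚ < ε → ∃[ N ] (∀ t → N ℕ.≤ t → g (approx t) < d + ε)

  -- A one-sided Lipschitz bound stands in for continuity; it is applied with `y` and `x` the two
  -- ends of a bracket.
  module Bisection (g : ℚ → ℚ) {L d : ℚ} (0≤L : 0ℚ ≤ L)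
    (lipschitz : ∀ {x y} → 0ℚ ≤ y → y ≤ x → x ≤ 1ℚ → g x ≤ g y + L * (x - y))
    (g0≤d : g 0ℚ ≤ d) (d≤g1 : d ≤ g 1ℚ) where

    record Bracket (w : ℚ) : Set where
      field
        lo hi  : ℚ
        0≤lo   : 0ℚ ≤ lo
        lo≤hi  : lo ≤ hi
        hi≤1   : hi ≤ 1ℚ
        below  : g lo ≤ d
        above  : d ≤ g hi
        width  : hi - lo ≡ w
    open Bracket

    record Within {w w′} (B : Bracket w) (B′ : Bracket w′) : Set where
      constructor within
      field
        lo≤ : lo B ≤ lo B′
        hi≤ : hi B′ ≤ hi B

    module _ {w} (B : Bracket w) where
      private
        mid : ℚ
        mid = ½ * (lo B + hi B)

        lo≤mid : lo B ≤ mid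
        lo≤mid = ≤-trans (≤-reflexive (sym (½-double (lo B))))
          (≤-trans (+-monoʳ-≤ (½ * lo B) (*-monoˡ-≤ (<⇒≤ 0<½) (lo≤hi B)))
            (≤-reflexive (sym (*-distribˡ-+ ½ (lo B) (hi B)))))

        mid≤hi : mid ≤ hi B
        mid≤hi = ≤-trans (≤-reflexive (*-distribˡ-+ ½ (lo B) (hi B)))
          (≤-trans (+-monoˡ-≤ (½ * hi B) (*-monoˡ-≤ (<⇒≤ 0<½) (lo≤hi B)))
            (≤-reflexive (½-double (hi B))))

        widthˡ : mid - lo B ≡ ½ * w
        widthˡ = trans (cong (λ s → mid - s) (sym (½-double (lo B))))
          (trans (e ½ (lo B) (hi B)) (cong (½ *_) (width B)))
          where
          e : ∀ h l u → h * (l + u) - (h * l + h * l) ≡ h * (u - l)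
          e = ℚ-Tactic.solve-∀ ℚ-ring

        widthʳ : hi B - mid ≡ ½ * w
        widthʳ = trans (cong (λ s → s - mid) (sym (½-double (hi B))))
          (trans (e ½ (lo B) (hi B)) (cong (½ *_) (width B)))
          where
          e : ∀ h l u → (h * u + h * u) - h * (l + u) ≡ h * (u - l)
          e = ℚ-Tactic.solve-∀ ℚ-ring

      halve : Dec (d ≤ g mid) → Σ[ B′ ∈ Bracket (½ * w) ] Within B B′
      halve (yes d≤) = record
        { lo = lo B ; hi = mid ; 0≤lo = 0≤lo B ; lo≤hi = lo≤mid ; hi≤1 = ≤-trans mid≤hi (hi≤1 B)
        ; below = below B ; above = d≤ ; width = widthˡ } , within ≤-refl mid≤hi
      halve (no d≰) = record
        { lo = mid ; hi = hi B ; 0≤lo = ≤-trans (0≤lo B) lo≤mid ; lo≤hi = mid≤hi ; hi≤1 = hi≤1 B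
        ; below = <⇒≤ (≰⇒> d≰) ; above = above B ; width = widthʳ } , within lo≤mid ≤-refl

      next : Σ[ B′ ∈ Bracket (½ * w) ] Within B B′
      next = halve (d ≤? g mid)

    bracket : ∀ t → Bracket (½^ t)
    bracket zero = record
      { lo = 0ℚ ; hi = 1ℚ ; 0≤lo = ≤-refl ; lo≤hi = 0≤1 ; hi≤1 = ≤-refl
      ; below = g0≤d ; above = d≤g1 ; width = refl }
    bracket (suc t) = proj₁ (next (bracket t))

    nested : ∀ {s t} → s ℕ.≤′ t → Within (bracket s) (bracket t)
    nested ℕ.≤′-refl = within ≤-refl ≤-refl
    nested (ℕ.≤′-step {t} s≤t) = within
      (≤-trans (Within.lo≤ (nested s≤t)) (Within.lo≤ (proj₂ (next (bracket t)))))
      (≤-trans (Within.hi≤ (proj₂ (next (bracket t)))) (Within.hi≤ (nested s≤t)))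

    private
      hi-near : ∀ N {m n} → N ℕ.≤ m → N ℕ.≤ n → ∣ hi (bracket m) - hi (bracket n) ∣ ≤ ½^ N
      hi-near N N≤m N≤n = ≤-trans
        (∣p-q∣≤ (lower N≤m) (upper N≤m) (lower N≤n) (upper N≤n))
        (≤-reflexive (width (bracket N)))
        where
        lower : ∀ {m} → N ℕ.≤ m → lo (bracket N) ≤ hi (bracket m)
        lower {m} N≤m = ≤-trans (Within.lo≤ (nested (ℕ.≤⇒≤′ N≤m))) (lo≤hi (bracket m))
        upper : ∀ {m} → N ℕ.≤ m → hi (bracket m) ≤ hi (bracket N)
        upper N≤m = Within.hi≤ (nested (ℕ.≤⇒≤′ N≤m))

      -- Read off from the nested brackets, whose widths these powers are.
      ½^-antitone : ∀ {s t} → s ℕ.≤ t → ½^ t ≤ ½^ s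
      ½^-antitone {s} {t} s≤t = subst₂ _≤_ (width (bracket t)) (width (bracket s))
        (+-mono-≤ (Within.hi≤ (nested (ℕ.≤⇒≤′ s≤t))) (neg-antimono-≤ (Within.lo≤ (nested (ℕ.≤⇒≤′ s≤t)))))

      g-hi≤ : ∀ t → g (hi (bracket t)) ≤ d + L * ½^ t
      g-hi≤ t = ≤-trans (lipschitz (0≤lo (bracket t)) (lo≤hi (bracket t)) (hi≤1 (bracket t)))
        (+-mono-≤ (below (bracket t)) (≤-reflexive (cong (L *_) (width (bracket t)))))

      limit : ∀ {ε} → ∃[ η ] 0ℚ < η × (1ℚ + L) * η ≡ ε →
        ∃[ N ] (∀ t → N ℕ.≤ t → g (hi (bracket t)) < d + ε)
      limit {ε} (η , 0<η , eq) = proj₁ (½^-small 0<η) , λ t N≤t →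
        ≤-<-trans (g-hi≤ t) (+-monoʳ-< d (≤-<-trans
          (*-monoˡ-≤ 0≤L (≤-trans (½^-antitone N≤t) (<⇒≤ (proj₂ (½^-small 0<η)))))
          (<-linearℚ 0ℚ ≤-refl 0<η (trans (e L η) (cong (_+ 0ℚ) eq)))))
        where
        e : ∀ L η → L * η + η + 0ℚ ≡ (1ℚ + L) * η + 0ℚ
        e = ℚ-Tactic.solve-∀ ℚ-ring

    root : Root g d
    root = record
      { approx   = λ t → hi (bracket t)
      ; isCauchy = λ ε 0<ε → proj₁ (½^-small 0<ε) , λ m n N≤m N≤n →
          ≤-<-trans (hi-near _ N≤m N≤n) (proj₂ (½^-small 0<ε))
      ; 0≤approx = λ t → ≤-trans (0≤lo (bracket t)) (lo≤hi (bracket t))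
      ; above    = λ t → above (bracket t)
      ; limit    = λ ε 0<ε → limit (divide (+-mono-<-≤ 0<1 0≤L) 0<ε)
      }

  -- Block-constant eigenvectors of `K j ∇ (K 1 ∪ K p)`.

  sum-splitAt : ∀ m {n} (f : Fin m ⊎ Fin n → ℚ) →
    sum (f ∘ splitAt m) ≡ sum (f ∘ inj₁) + sum (f ∘ inj₂)
  sum-splitAt zero    f = sym (+-identityˡ (sum (f ∘ inj₂)))
  sum-splitAt (suc m) f = trans (cong (f (inj₁ zero) +_) (sum-splitAt m (f ∘ map₁ suc)))
    (sym (+-assoc (f (inj₁ zero)) _ _))

  deg-K : ∀ {n} (i : Fin n) → deg (K n) i ℕ.+ 1 ≡ n
  deg-K {n} i = trans (cong (deg (K n) i ℕ.+_) (sym (sum-δ₁ i)))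
    (trans (sym (Σℕ.∑-distrib-+ (α (K n) i) (λ j → δ j i)))
      (trans (Σℕ.sum-cong-≗ pointwise) (trans (sum-const n 1) (ℕ.*-identityʳ n))))
    where
    pointwise : ∀ j → α (K n) i j ℕ.+ δ j i ≡ 1
    pointwise j with i Fin.≟ j | j Fin.≟ i
    ... | yes _ | yes _ = refl
    ... | no _  | no _  = refl
    ... | yes p | no ¬q = contradiction (sym p) ¬q
    ... | no ¬p | yes q = contradiction (sym q) ¬p

  ι-deg-K : ∀ {n} (i : Fin n) → ι (deg (K n) i) ≡ ι n - 1ℚ
  ι-deg-K {n} i = trans (e (ι (deg (K n) i)))
    (cong (_- 1ℚ) (trans (sym (ι-+ (deg (K n) i) 1)) (cong ι (deg-K i))))
    where
    e : ∀ d → d ≡ (d + (1ℚ + 0ℚ)) - 1ℚ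
    e = ℚ-Tactic.solve-∀ ℚ-ring

  sum-K : ∀ {n} (i : Fin n) c → sum (λ j → ι (α (K n) i j) * c) ≡ (ι n - 1ℚ) * c
  sum-K {n} i c = trans (sym (*-distribʳ-sum c (λ j → ι (α (K n) i j))))
    (cong (_* c) (trans (ι-sum (α (K n) i)) (ι-deg-K i)))

  sum-ones : ∀ n c → sum {n} (λ _ → ι 1 * c) ≡ ι n * c
  sum-ones n c = trans (sum-constℚ n (ι 1 * c))
    (cong (ι n *_) (trans (cong (_* c) (+-identityʳ 1ℚ)) (*-identityˡ c)))

  sum-zeros : ∀ n c → sum {n} (λ _ → ι 0 * c) ≡ 0ℚ
  sum-zeros n c = trans (sum-constℚ n (ι 0 * c))
    (trans (cong (ι n *_) (*-zeroˡ c)) (*-zeroʳ (ι n)))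

  module _ (j p : ℕ) {M : ℚ} (ιp : ι p ≡ 1ℚ + M) (A B C : ℝ) where

    private
      inner : Fin 1 ⊎ Fin p → ℝ
      inner (inj₁ _) = B
      inner (inj₂ _) = C

      outer : Fin j ⊎ Fin (1 ℕ.+ p) → ℝ
      outer (inj₁ _) = A
      outer (inj₂ w) = inner (splitAt 1 w)

    blockVector : Fin (j ℕ.+ (1 ℕ.+ p)) → ℝ
    blockVector i = outer (splitAt j i)

    module _ (t : ℕ) where

      a b c : ℚ
      a = seq A t
      b = seq B t
      c = seq C t

      rowOf : Fin j ⊎ Fin (1 ℕ.+ p) → ℚ
      rowOf s = sum (λ u → ι (ind (Combine.adj⊎ true (K j) (K 1 ∪ K p) s (inj₁ u))) * a)
        + sum (λ w → ι (ind (Combine.adj⊎ true (K j) (K 1 ∪ K p) s (inj₂ w))) * seq (inner (splitAt 1 w)) t)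

      row-split : ∀ i →
        sum (λ i′ → α-ℚ (K j ∇ (K 1 ∪ K p)) i i′ * seq (blockVector i′) t) ≡ rowOf (splitAt j i)
      row-split i = sum-splitAt j
        (λ s → ι (ind (Combine.adj⊎ true (K j) (K 1 ∪ K p) (splitAt j i) s)) * seq (outer s) t)

      row₁ : ∀ u → rowOf (inj₁ u) ≡ (ι j - 1ℚ) * a + b + (1ℚ + M) * c
      row₁ u = trans (cong₂ _+_ (sum-K u a)
          (trans (sum-splitAt 1 (λ s → ι 1 * seq (inner s) t))
            (cong₂ _+_ (sum-ones 1 b) (trans (sum-ones p c) (cong (_* c) ιp)))))
        (e (ι j) (M) a b c)
        where
        e : ∀ J M a b c → (J - 1ℚ) * a + ((1ℚ + 0ℚ) * b + (1ℚ + M) * c) ≡ (J - 1ℚ) * a + b + (1ℚ + M) * c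
        e = ℚ-Tactic.solve-∀ ℚ-ring

      innerRow : Fin 1 ⊎ Fin p → ℚ
      innerRow s = sum (λ z → ι (ind (Combine.adj⊎ false (K 1) (K p) s (inj₁ z))) * b)
        + sum (λ z → ι (ind (Combine.adj⊎ false (K 1) (K p) s (inj₂ z))) * c)

      row₂ : ∀ w → rowOf (inj₂ w) ≡ ι j * a + innerRow (splitAt 1 w)
      row₂ w = cong₂ _+_ (sum-ones j a)
        (sum-splitAt 1 (λ s → ι (ind (Combine.adj⊎ false (K 1) (K p) (splitAt 1 w) s)) * seq (inner s) t))

      innerRow₁ : ∀ z → innerRow (inj₁ z) ≡ 0ℚ
      innerRow₁ z = trans (cong₂ _+_ (sum-K z b) (sum-zeros p c)) (e b)
        where
        e : ∀ b → ((1ℚ + 0ℚ) - 1ℚ) * b + 0ℚ ≡ 0ℚ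
        e = ℚ-Tactic.solve-∀ ℚ-ring

      innerRow₂ : ∀ z → innerRow (inj₂ z) ≡ M * c
      innerRow₂ z = trans (cong₂ _+_ (sum-zeros 1 b)
          (trans (sum-K z c) (cong (λ q → (q - 1ℚ) * c) ιp))) (e (M) c)
        where
        e : ∀ M c → 0ℚ + ((1ℚ + M) - 1ℚ) * c ≡ M * c
        e = ℚ-Tactic.solve-∀ ℚ-ring

    -- Only the rows of the dominating vertices carry the error of the bisection; the other two
    -- kinds hold exactly at every stage.
    module _ {μ : ℝ}
      (row-A : Fin j → ∀ ε → 0ℚ < ε → ∃[ N ] (∀ t → N ℕ.≤ t →
        ∣ ((ι j - 1ℚ) * seq A t + seq B t + (1ℚ + M) * seq C t) - seq μ t * seq A t ∣ < ε))
      (row-B : ∀ t → ι j * seq A t ≡ seq μ t * seq B t)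
      (row-C : ∀ t → ι j * seq A t + M * seq C t ≡ seq μ t * seq C t)
      where

      private
        Close : Fin j ⊎ Fin (1 ℕ.+ p) → Set
        Close s = ∀ ε → 0ℚ < ε → ∃[ N ] (∀ t → N ℕ.≤ t → ∣ rowOf t s - seq μ t * seq (outer s) t ∣ < ε)

        ∣p-p∣<ε : ∀ {p q ε} → p ≡ q → 0ℚ < ε → ∣ p - q ∣ < ε
        ∣p-p∣<ε {p} {ε = ε} refl 0<ε = subst (_< ε) (sym (cong ∣_∣ (+-inverseʳ p))) 0<ε

        -- ℚ operations unfold even on open terms, so conversion is avoided below the arithmetic.
        outer-A : ∀ u → outer (inj₁ u) ≡ A
        outer-A u = refl
        outer-inner : ∀ w → outer (inj₂ w) ≡ inner (splitAt 1 w)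
        outer-inner w = refl
        inner-B : ∀ z → inner (inj₁ z) ≡ B
        inner-B z = refl
        inner-C : ∀ z → inner (inj₂ z) ≡ C
        inner-C z = refl
        blockVector-outer : ∀ i → blockVector i ≡ outer (splitAt j i)
        blockVector-outer i = refl

        inner-equation : ∀ t s → ι j * seq A t + innerRow t s ≡ seq μ t * seq (inner s) t
        inner-equation t (inj₁ z) = trans (cong (ι j * seq A t +_) (innerRow₁ t z))
          (trans (+-identityʳ (ι j * seq A t)) (trans (row-B t)
            (cong (λ x → seq μ t * seq x t) (sym (inner-B z)))))
        inner-equation t (inj₂ z) = trans (cong (ι j * seq A t +_) (innerRow₂ t z))
          (trans (row-C t) (cong (λ x → seq μ t * seq x t) (sym (inner-C z))))

        outer-equation : ∀ t w → rowOf t (inj₂ w) ≡ seq μ t * seq (outer (inj₂ w)) t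
        outer-equation t w = trans (row₂ t w) (trans (inner-equation t (splitAt 1 w))
          (cong (λ x → seq μ t * seq x t) (sym (outer-inner w))))

        close : ∀ s → Close s
        close (inj₁ u) ε 0<ε = proj₁ (row-A u ε 0<ε) , λ t N≤t →
          subst₂ (λ r x → ∣ r - seq μ t * seq x t ∣ < ε) (sym (row₁ t u)) (sym (outer-A u))
            (proj₂ (row-A u ε 0<ε) t N≤t)
        close (inj₂ w) ε 0<ε = 0 , λ t _ → ∣p-p∣<ε (outer-equation t w) 0<ε

      blockVector-residual : ∀ i ε → 0ℚ < ε →
        ∃[ N ] (∀ t → N ℕ.≤ t → Residual< (K j ∇ (K 1 ∪ K p)) blockVector μ ε i t)
      blockVector-residual i ε 0<ε = proj₁ (close (splitAt j i) ε 0<ε) , λ t N≤t →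
        subst-residual′ {sum (λ i′ → α-ℚ (K j ∇ (K 1 ∪ K p)) i i′ * seq (blockVector i′) t)}
          {rowOf t (splitAt j i)}
          {seq μ t * seq (blockVector i) t} {seq μ t * seq (outer (splitAt j i)) t} {ε}
          (row-split t i) (cong (λ x → seq μ t * seq x t) (blockVector-outer i))
          (proj₂ (close (splitAt j i) ε 0<ε) t N≤t)

      blockVector-eigen : ∀ i → (adjacencyMatrix (K j ∇ (K 1 ∪ K p)) *ᵥ blockVector) i ≈ℝ μ *ℝ blockVector i
      blockVector-eigen i =
        eigenvector-of-residual (K j ∇ (K 1 ∪ K p)) blockVector μ i (blockVector-residual i)

      blockVector-eigenvalue : Fin p → ¬ (C ≈ℝ 0ℝ) → IsEigenvalue (adjacencyMatrix (K j ∇ (K 1 ∪ K p))) μ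
      blockVector-eigenvalue z C≉0 = blockVector , (λ all≈0 → C≉0
        -- `suc z` skips the vertex of `K 1`; on the clique the vector takes the value `C`.
        (subst (λ s → outer s ≈ℝ 0ℝ) (Fin.splitAt-↑ʳ j (1 ℕ.+ p) (suc z)) (all≈0 (j ↑ʳ suc z))))
        , blockVector-eigen

  -- An eigenvalue of `H` whose terms all admit supersolutions.

  ∣-0∣≮1 : ∀ {p} → 1ℚ ≤ p → ¬ (∣ p - 0ℚ ∣ < 1ℚ)
  ∣-0∣≮1 {p} 1≤p small = <-irrefl refl (≤-<-trans
    (≤-trans 1≤p (≤-trans (≤-reflexive (e p)) (p≤∣p∣ (p - 0ℚ)))) small)
    where
    e : ∀ p → p ≡ p - 0ℚ
    e = ℚ-Tactic.solve-∀ ℚ-ring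

  ≉0 : ∀ (x : ℝ) → (∀ t → 1ℚ ≤ seq x t) → ¬ (x ≈ℝ 0ℝ)
  ≉0 x 1≤x x≈0 = ∣-0∣≮1 {seq x N} (1≤x N) (proj₂ (x≈0 1ℚ 0<1) N ℕ.≤-refl)
    where
    N : ℕ
    N = proj₁ (x≈0 1ℚ 0<1)

  1≤* : ∀ {p q} → 1ℚ ≤ p → 1ℚ ≤ q → 1ℚ ≤ p * q
  1≤* {p} {q} 1≤p 1≤q = ≤-trans 1≤q (≤-trans (≤-reflexive (sym (*-identityˡ q)))
    (*-monoʳ-≤ (≤-trans 0≤1 1≤q) 1≤p))

  ∣d-g∣< : ∀ {d g ε} → d ≤ g → g < d + ε → ∣ d - g ∣ < ε
  ∣d-g∣< {d} {g} {ε} d≤g g<d+ε = subst (_< ε) (sym flip) (<-linearℚ 0ℚ ≤-refl g<d+ε (e₂ d g ε))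
    where
    e₁ : ∀ d g → d - g ≡ - (g - d)
    e₁ = ℚ-Tactic.solve-∀ ℚ-ring
    e₂ : ∀ d g ε → g - d + (d + ε) + 0ℚ ≡ ε + g
    e₂ = ℚ-Tactic.solve-∀ ℚ-ring
    0≤g-d : 0ℚ ≤ g - d
    0≤g-d = ≤-trans (≤-reflexive (sym (+-inverseʳ d))) (+-monoˡ-≤ (- d) d≤g)
    flip : ∣ d - g ∣ ≡ g - d
    flip = trans (cong ∣_∣ (e₁ d g)) (trans (∣-p∣≡∣p∣ (g - d)) (0≤p⇒∣p∣≡p 0≤g-d))

  -- `j + m` is `n - 2`, the value used in `sparse-supersolution`, so a single `q` below an
  -- eigenvalue of `G` excludes both low degrees and too few edges.
  Dominates : ℕ → ℕ → ℚ → Set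
  Dominates j m q = ι (j ℕ.+ m) ≤ q ×
    (∀ {n} (G : Graph n) → n ≡ 2 ℕ.+ (j ℕ.+ m) → ∀ v → deg G v ℕ.≤ j → Supersolution G q)

  DominatingEigenvalue : (j m p : ℕ) → Set
  DominatingEigenvalue j m p = ∃[ μ ] IsEigenvalue (adjacencyMatrix (K j ∇ (K 1 ∪ K p))) μ ×
    (∀ t → Dominates j m (seq μ t))

  -- Separate because the general vector has `b` and `c` multiples of `j`. Here `H` is `K 1 ∪ K p`
  -- and `m` is the eigenvalue of its clique.
  dominatingEigenvalue-0 : ∀ m p → ι p ≡ 1ℚ + ι m → Fin p → DominatingEigenvalue 0 m p
  dominatingEigenvalue-0 m p ιp z = μ
    , blockVector-eigenvalue 0 p {ι m} ιp 0ℝ 0ℝ 1ℝ {μ} (λ ())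
        (λ t → row-B {ι 0} {seq 0ℝ t} {seq 0ℝ t} {seq μ t} refl refl)
        (λ t → row-C {ι 0} {seq 0ℝ t} {seq 1ℝ t} {ι m} {seq μ t} refl refl)
        z (≉0 1ℝ (λ _ → ≤-refl {1ℚ}))
    , λ t → dominates
    where
    μ : ℝ
    μ = fromℚ (ι m)
    row-B : ∀ {J a b q} → a ≡ 0ℚ → b ≡ 0ℚ → J * a ≡ q * b
    row-B {J} {q = q} refl refl = trans (*-zeroʳ J) (sym (*-zeroʳ q))
    row-C : ∀ {J a c M q} → a ≡ 0ℚ → M ≡ q → J * a + M * c ≡ q * c
    row-C {J} {c = c} {M} refl refl = trans (cong (_+ M * c) (*-zeroʳ J)) (+-identityˡ (M * c))
    1≤2 : 1ℚ ≤ 1ℚ + 1ℚ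
    1≤2 = ≤-trans (≤-reflexive (sym (+-identityʳ 1ℚ))) (+-monoʳ-≤ 1ℚ 0≤1)
    row-v : ∀ {J M} → J ≡ 0ℚ → 0ℚ ≤ M → J * (1ℚ + 1ℚ) ≤ M * 1ℚ
    row-v {M = M} refl 0≤M = ≤-linearℚ M 0≤M (≤-refl {0ℚ}) (e M)
      where
      e : ∀ M → 0ℚ * (1ℚ + 1ℚ) + 0ℚ + M ≡ M * 1ℚ + 0ℚ
      e = ℚ-Tactic.solve-∀ ℚ-ring
    row-near : ∀ {J M} → J ≡ 0ℚ → 0ℚ ≤ M → (J - 1ℚ) * (1ℚ + 1ℚ) + 1ℚ + (1ℚ + M) * 1ℚ ≤ M * (1ℚ + 1ℚ)
    row-near {M = M} refl 0≤M = ≤-linearℚ M 0≤M (≤-refl {0ℚ}) (e M)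
      where
      e : ∀ M → (0ℚ - 1ℚ) * (1ℚ + 1ℚ) + 1ℚ + (1ℚ + M) * 1ℚ + 0ℚ + M ≡ M * (1ℚ + 1ℚ) + 0ℚ
      e = ℚ-Tactic.solve-∀ ℚ-ring
    row-far : ∀ {J M} → J ≡ 0ℚ → J * (1ℚ + 1ℚ) + M * 1ℚ ≤ M * 1ℚ
    row-far {M = M} refl = ≤-reflexive (e M)
      where
      e : ∀ M → 0ℚ * (1ℚ + 1ℚ) + M * 1ℚ ≡ M * 1ℚ
      e = ℚ-Tactic.solve-∀ ℚ-ring
    dominates : Dominates 0 m (ι m)
    -- `v` is isolated, so no vertex receives the weight `a`; the value 2 makes `row-near` read
    -- `m ≤ 2m`.
    dominates = ≤-refl {ι m} , λ {n} G n≡ v degv≤0 → low-degree-supersolution {n} {0} {m} G n≡ v degv≤0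
      {ι m} {1ℚ + 1ℚ} {1ℚ} {1ℚ} (≤-refl {1ℚ}) (≤-refl {1ℚ}) 1≤2
      (row-v {ι 0} {ι m} refl (0≤ι m)) (row-near {ι 0} {ι m} refl (0≤ι m)) (row-far {ι 0} {ι m} refl)

  0≤- : ∀ {x y} → x ≤ y → 0ℚ ≤ y - x
  0≤- {x} x≤y = ≤-trans (≤-reflexive (sym (+-inverseʳ x))) (+-monoˡ-≤ (- x) x≤y)

  p≤p+q : ∀ {p q} → 0ℚ ≤ q → p ≤ p + q
  p≤p+q {p} 0≤q = ≤-trans (≤-reflexive (sym (+-identityʳ p))) (+-monoʳ-≤ p 0≤q)

  1≤+ : ∀ {p q} → 1ℚ ≤ p → 0ℚ ≤ q → 1ℚ ≤ p + q
  1≤+ 1≤p 0≤q = ≤-trans 1≤p (p≤p+q 0≤q)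

  -- `3 + 2B + C` bounds the derivative on the unit interval. The slack is `x - y` times its excess
  -- over the difference quotient, grouped into nonnegative terms.
  cubic-lipschitz : ∀ {B C x y} → 0ℚ ≤ B → 0ℚ ≤ y → y ≤ x → x ≤ 1ℚ →
    x * x * x + B * (x * x) + C * x ≤
    y * y * y + B * (y * y) + C * y + (1ℚ + 1ℚ + 1ℚ + (1ℚ + 1ℚ) * B + C) * (x - y)
  cubic-lipschitz {B} {C} {x} {y} 0≤B 0≤y y≤x x≤1 = ≤-linearℚ
    ((x - y) * (((1ℚ - x) * (1ℚ + x) + ((1ℚ - x) + x * (1ℚ - y)) + (1ℚ - y) * (1ℚ + y))
      + B * ((1ℚ - x) + (1ℚ - y))))
    (0≤* (0≤- y≤x) (0≤+
      (0≤+ (0≤+ (0≤* (0≤- x≤1) (0≤+ 0≤1 0≤x)) (0≤+ (0≤- x≤1) (0≤* 0≤x (0≤- y≤1))))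
        (0≤* (0≤- y≤1) (0≤+ 0≤1 0≤y)))
      (0≤* 0≤B (0≤+ (0≤- x≤1) (0≤- y≤1)))))
    (≤-refl {0ℚ}) (e x y B C)
    where
    0≤x : 0ℚ ≤ x
    0≤x = ≤-trans 0≤y y≤x
    y≤1 : y ≤ 1ℚ
    y≤1 = ≤-trans y≤x x≤1
    e : ∀ x y B C → x * x * x + B * (x * x) + C * x + 0ℚ
      + (x - y) * (((1ℚ - x) * (1ℚ + x) + ((1ℚ - x) + x * (1ℚ - y)) + (1ℚ - y) * (1ℚ + y))
        + B * ((1ℚ - x) + (1ℚ - y)))
      ≡ y * y * y + B * (y * y) + C * y + (1ℚ + 1ℚ + 1ℚ + (1ℚ + 1ℚ) * B + C) * (x - y) + 0ℚ
    e = ℚ-Tactic.solve-∀ ℚ-ring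

  cubic-root : ∀ {B C d} → 0ℚ ≤ B → 0ℚ ≤ C → 0ℚ ≤ d → d ≤ 1ℚ + B + C →
    Root (λ τ → τ * τ * τ + B * (τ * τ) + C * τ) d
  cubic-root {B} {C} {d} 0≤B 0≤C 0≤d d≤ = Bisection.root
    (λ τ → τ * τ * τ + B * (τ * τ) + C * τ)
    {L = 1ℚ + 1ℚ + 1ℚ + (1ℚ + 1ℚ) * B + C} {d}
    (0≤+ (0≤+ (0≤+ (0≤+ 0≤1 0≤1) 0≤1) (0≤* (0≤+ 0≤1 0≤1) 0≤B)) 0≤C)
    (cubic-lipschitz 0≤B)
    (≤-trans (≤-reflexive (e₀ B C)) 0≤d)
    (≤-trans d≤ (≤-reflexive (e₁ B C)))
    where
    e₀ : ∀ B C → 0ℚ * 0ℚ * 0ℚ + B * (0ℚ * 0ℚ) + C * 0ℚ ≡ 0ℚ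
    e₀ = ℚ-Tactic.solve-∀ ℚ-ring
    e₁ : ∀ B C → 1ℚ + B + C ≡ 1ℚ * 1ℚ * 1ℚ + B * (1ℚ * 1ℚ) + C * 1ℚ
    e₁ = ℚ-Tactic.solve-∀ ℚ-ring

  -- In terms of q = J + M + τ the vector a = q (q - M), b = J (q - M), c = J q satisfies the
  -- eigenvalue equations up to the defect J² - (τ³ + B τ² + C τ) at the dominating vertices.
  module _ {J M q a b c τ : ℚ} (q≡ : q ≡ J + M + τ)
    (a≡ : a ≡ q * (q - M)) (b≡ : b ≡ J * (q - M)) (c≡ : c ≡ J * q) where

    low-row : J * a ≡ q * b
    low-row = go a≡ b≡
      where
      e : ∀ J M q → J * (q * (q - M)) ≡ q * (J * (q - M))
      e = ℚ-Tactic.solve-∀ ℚ-ring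
      go : ∀ {a b} → a ≡ q * (q - M) → b ≡ J * (q - M) → J * a ≡ q * b
      go refl refl = e J M q

    clique-row : J * a + M * c ≡ q * c
    clique-row = go a≡ c≡
      where
      e : ∀ J M q → J * (q * (q - M)) + M * (J * q) ≡ q * (J * q)
      e = ℚ-Tactic.solve-∀ ℚ-ring
      go : ∀ {a c} → a ≡ q * (q - M) → c ≡ J * q → J * a + M * c ≡ q * c
      go refl refl = e J M q

    dominating-row : ((J - 1ℚ) * a + b + (1ℚ + M) * c) - q * a ≡
      J * J - (τ * τ * τ + ((1ℚ + 1ℚ) * (J + M) + 1ℚ) * (τ * τ) + ((J + M) * (J + M) + M) * τ)
    dominating-row = go a≡ b≡ c≡ q≡
      where
      e : ∀ J M τ → ((J - 1ℚ) * ((J + M + τ) * (J + M + τ - M)) + J * (J + M + τ - M)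
          + (1ℚ + M) * (J * (J + M + τ))) - (J + M + τ) * ((J + M + τ) * (J + M + τ - M))
        ≡ J * J - (τ * τ * τ + ((1ℚ + 1ℚ) * (J + M) + 1ℚ) * (τ * τ) + ((J + M) * (J + M) + M) * τ)
      e = ℚ-Tactic.solve-∀ ℚ-ring
      go : ∀ {a b c q} → a ≡ q * (q - M) → b ≡ J * (q - M) → c ≡ J * q → q ≡ J + M + τ →
        ((J - 1ℚ) * a + b + (1ℚ + M) * c) - q * a ≡
        J * J - (τ * τ * τ + ((1ℚ + 1ℚ) * (J + M) + 1ℚ) * (τ * τ) + ((J + M) * (J + M) + M) * τ)
      go refl refl refl refl = e J M τ

    dominating-row-near : ∀ {ε} →
      J * J ≤ τ * τ * τ + ((1ℚ + 1ℚ) * (J + M) + 1ℚ) * (τ * τ) + ((J + M) * (J + M) + M) * τ →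
      τ * τ * τ + ((1ℚ + 1ℚ) * (J + M) + 1ℚ) * (τ * τ) + ((J + M) * (J + M) + M) * τ < J * J + ε →
      ∣ ((J - 1ℚ) * a + b + (1ℚ + M) * c) - q * a ∣ < ε
    dominating-row-near above below = go dominating-row above below
      where
      go : ∀ {r d g ε} → r ≡ d - g → d ≤ g → g < d + ε → ∣ r ∣ < ε
      go refl = ∣d-g∣<

    module _ (1≤J : 1ℚ ≤ J) (0≤M : 0ℚ ≤ M) (0≤τ : 0ℚ ≤ τ) where

      1≤q : 1ℚ ≤ q
      1≤q = subst (1ℚ ≤_) (sym q≡) (1≤+ {J + M} {τ} (1≤+ {J} {M} 1≤J 0≤M) 0≤τ)

      1≤q-M : 1ℚ ≤ q - M
      1≤q-M = go q≡
        where
        e : ∀ J M τ → J + τ ≡ J + M + τ - M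
        e = ℚ-Tactic.solve-∀ ℚ-ring
        go : ∀ {q} → q ≡ J + M + τ → 1ℚ ≤ q - M
        go refl = ≤-trans (1≤+ {J} {τ} 1≤J 0≤τ) (≤-reflexive (e J M τ))

      1≤b : 1ℚ ≤ b
      1≤b = subst (1ℚ ≤_) (sym b≡) (1≤* {J} {q - M} 1≤J 1≤q-M)

      1≤c : 1ℚ ≤ c
      1≤c = subst (1ℚ ≤_) (sym c≡) (1≤* {J} {q} 1≤J 1≤q)

      -- The difference `a - c` equals `q * τ`.
      c≤a : c ≤ a
      c≤a = go c≡ a≡ q≡ 1≤q
        where
        e : ∀ J M τ → J * (J + M + τ) + 0ℚ + (J + M + τ) * τ ≡ (J + M + τ) * (J + M + τ - M) + 0ℚ
        e = ℚ-Tactic.solve-∀ ℚ-ring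
        go : ∀ {c a q} → c ≡ J * q → a ≡ q * (q - M) → q ≡ J + M + τ → 1ℚ ≤ q → c ≤ a
        go refl refl refl 1≤q = ≤-linearℚ ((J + M + τ) * τ) (0≤* (≤-trans 0≤1 1≤q) 0≤τ)
          (≤-refl {0ℚ}) (e J M τ)

    dominating-row≤ :
      J * J ≤ τ * τ * τ + ((1ℚ + 1ℚ) * (J + M) + 1ℚ) * (τ * τ) + ((J + M) * (J + M) + M) * τ →
      (J - 1ℚ) * a + b + (1ℚ + M) * c ≤ q * a
    dominating-row≤ above = go above dominating-row
      where
      e₁ : ∀ r s g → r + g + 0ℚ ≡ (r - s) + (s + g)
      e₁ = ℚ-Tactic.solve-∀ ℚ-ring
      e₂ : ∀ s d g → (d - g) + (s + g) ≡ s + d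
      e₂ = ℚ-Tactic.solve-∀ ℚ-ring
      go : ∀ {r s d g} → d ≤ g → r - s ≡ d - g → r ≤ s
      go {r} {s} {d} {g} d≤g eq = ≤-linearℚ 0ℚ (≤-refl {0ℚ}) d≤g
        (trans (e₁ r s g) (trans (cong (_+ (s + g)) eq) (e₂ s d g)))

  -- Puts the root into the unit interval: at 1 the coefficient of `τ` alone already contains
  -- `J * J`.
  cubic-1 : ∀ {J M} → 0ℚ ≤ J → 0ℚ ≤ M →
    J * J ≤ 1ℚ + ((1ℚ + 1ℚ) * (J + M) + 1ℚ) + ((J + M) * (J + M) + M)
  cubic-1 {J} {M} 0≤J 0≤M = ≤-linearℚ (1ℚ + ((1ℚ + 1ℚ) * (J + M) + 1ℚ) + (J * M + J * M + M * M + M))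
    (0≤+ (0≤+ 0≤1 (0≤+ (0≤* (0≤+ 0≤1 0≤1) (0≤+ 0≤J 0≤M)) 0≤1))
      (0≤+ (0≤+ (0≤+ (0≤* 0≤J 0≤M) (0≤* 0≤J 0≤M)) (0≤* 0≤M 0≤M)) 0≤M))
    (≤-refl {0ℚ}) (e J M)
    where
    e : ∀ J M → J * J + 0ℚ + (1ℚ + ((1ℚ + 1ℚ) * (J + M) + 1ℚ) + (J * M + J * M + M * M + M)) ≡
      1ℚ + ((1ℚ + 1ℚ) * (J + M) + 1ℚ) + ((J + M) * (J + M) + M) + 0ℚ
    e = ℚ-Tactic.solve-∀ ℚ-ring

  dominating-cubic-root : ∀ {J M} → 0ℚ ≤ J → 0ℚ ≤ M →
    Root (λ τ → τ * τ * τ + ((1ℚ + 1ℚ) * (J + M) + 1ℚ) * (τ * τ) + ((J + M) * (J + M) + M) * τ) (J * J)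
  dominating-cubic-root 0≤J 0≤M = cubic-root
    (0≤+ (0≤* (0≤+ 0≤1 0≤1) (0≤+ 0≤J 0≤M)) 0≤1) (0≤+ (0≤* (0≤+ 0≤J 0≤M) (0≤+ 0≤J 0≤M)) 0≤M)
    (0≤* 0≤J 0≤J) (cubic-1 0≤J 0≤M)

  module _ (j m p : ℕ) (1≤ιj : 1ℚ ≤ ι j) (ιp : ι p ≡ 1ℚ + ι m) (z : Fin p)
    (ρ : Root (λ τ → τ * τ * τ + ((1ℚ + 1ℚ) * (ι j + ι m) + 1ℚ) * (τ * τ)
      + ((ι j + ι m) * (ι j + ι m) + ι m) * τ) (ι j * ι j)) where

    private
      open Root ρ

      μ μ-m A B C : ℝ
      -- The approximations of `τ` are nonnegative, so each term of `μ` is at least `j + m`.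
      μ   = fromℚ (ι j + ι m) +ℝ mkℝ approx isCauchy
      μ-m = μ +ℝ fromℚ (- ι m)
      A   = μ *ℝ μ-m
      B   = fromℚ (ι j) *ℝ μ-m
      C   = fromℚ (ι j) *ℝ μ

      μ≡ : ∀ t → seq μ t ≡ ι j + ι m + approx t
      μ≡ t = refl

      μ-m≡ : ∀ t → seq μ-m t ≡ seq μ t - ι m
      μ-m≡ t = refl

      A≡ : ∀ t → seq A t ≡ seq μ t * (seq μ t - ι m)
      A≡ t = cong (seq μ t *_) (μ-m≡ t)

      B≡ : ∀ t → seq B t ≡ ι j * (seq μ t - ι m)
      B≡ t = cong (ι j *_) (μ-m≡ t)

      C≡ : ∀ t → seq C t ≡ ι j * seq μ t
      C≡ t = refl

      row-A : Fin j → ∀ ε → 0ℚ < ε → ∃[ N ] (∀ t → N ℕ.≤ t →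
        ∣ ((ι j - 1ℚ) * seq A t + seq B t + (1ℚ + ι m) * seq C t) - seq μ t * seq A t ∣ < ε)
      row-A _ ε 0<ε = proj₁ (limit ε 0<ε) , λ t N≤t →
        dominating-row-near {ι j} {ι m} {seq μ t} {seq A t} {seq B t} {seq C t} {approx t}
          (μ≡ t) (A≡ t) (B≡ t) (C≡ t) {ε} (above t) (proj₂ (limit ε 0<ε) t N≤t)

      row-B : ∀ t → ι j * seq A t ≡ seq μ t * seq B t
      row-B t = low-row {ι j} {ι m} {seq μ t} {seq A t} {seq B t} {seq C t} {approx t}
        (μ≡ t) (A≡ t) (B≡ t) (C≡ t)

      row-C : ∀ t → ι j * seq A t + ι m * seq C t ≡ seq μ t * seq C t
      row-C t = clique-row {ι j} {ι m} {seq μ t} {seq A t} {seq B t} {seq C t} {approx t}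
        (μ≡ t) (A≡ t) (B≡ t) (C≡ t)

      0≤ιm : 0ℚ ≤ ι m
      0≤ιm = 0≤ι m

      1≤C : ∀ t → 1ℚ ≤ seq C t
      1≤C t = 1≤c {ι j} {ι m} {seq μ t} {seq A t} {seq B t} {seq C t} {approx t}
        (μ≡ t) (A≡ t) (B≡ t) (C≡ t) 1≤ιj 0≤ιm (0≤approx t)

      dominates : ∀ t → Dominates j m (seq μ t)
      dominates t = large , λ {n} G n≡ v degv≤j → low-degree-supersolution {n} {j} {m} G n≡ v degv≤j
        {seq μ t} {seq A t} {seq B t} {seq C t}
        (1≤b {ι j} {ι m} {seq μ t} {seq A t} {seq B t} {seq C t} {approx t}
          (μ≡ t) (A≡ t) (B≡ t) (C≡ t) 1≤ιj 0≤ιm (0≤approx t))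
        (1≤C t)
        (c≤a {ι j} {ι m} {seq μ t} {seq A t} {seq B t} {seq C t} {approx t}
          (μ≡ t) (A≡ t) (B≡ t) (C≡ t) 1≤ιj 0≤ιm (0≤approx t))
        (≤-reflexive {ι j * seq A t} {seq μ t * seq B t} (row-B t))
        (dominating-row≤ {ι j} {ι m} {seq μ t} {seq A t} {seq B t} {seq C t} {approx t}
          (μ≡ t) (A≡ t) (B≡ t) (C≡ t) (above t))
        (≤-reflexive {ι j * seq A t + ι m * seq C t} {seq μ t * seq C t} (row-C t))
        where
        large : ι (j ℕ.+ m) ≤ seq μ t
        large = ≤-trans {ι (j ℕ.+ m)} {ι j + ι m} {seq μ t}
          (≤-reflexive {ι (j ℕ.+ m)} {ι j + ι m} (ι-+ j m))
          (≤-trans {ι j + ι m} {ι j + ι m + approx t} {seq μ t} (p≤p+q (0≤approx t))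
            (≤-reflexive {ι j + ι m + approx t} {seq μ t} (sym (μ≡ t))))

    dominatingEigenvalue-suc : DominatingEigenvalue j m p
    dominatingEigenvalue-suc = μ
      , blockVector-eigenvalue j p {ι m} ιp A B C {μ} row-A row-B row-C z (≉0 C 1≤C)
      , dominates

  dominatingEigenvalue-pos : ∀ j m p → 1ℚ ≤ ι j → ι p ≡ 1ℚ + ι m → Fin p →
    DominatingEigenvalue j m p
  dominatingEigenvalue-pos j m p 1≤ιj ιp z = dominatingEigenvalue-suc j m p 1≤ιj ιp z
    (dominating-cubic-root {ι j} {ι m} (0≤ι j) (0≤ι m))

  ι-suc : ∀ {p m} → p ≡ suc m → ι p ≡ 1ℚ + ι m
  ι-suc refl = refl

  zero-or-1≤ι : ∀ j → 0 ≡ j ⊎ 1ℚ ≤ ι j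
  zero-or-1≤ι zero    = inj₁ refl
  zero-or-1≤ι (suc i) = inj₂ (1≤+ {1ℚ} {ι i} (≤-refl {1ℚ}) (0≤ι i))

  dominatingEigenvalue : ∀ j m p → 0 ≡ j ⊎ 1ℚ ≤ ι j → ι p ≡ 1ℚ + ι m → Fin p →
    DominatingEigenvalue j m p
  dominatingEigenvalue j m p (inj₁ 0≡j) ιp z =
    subst (λ i → DominatingEigenvalue i m p) 0≡j (dominatingEigenvalue-0 m p ιp z)
  dominatingEigenvalue j m p (inj₂ 1≤ιj) ιp z = dominatingEigenvalue-pos j m p 1≤ιj ιp z

  -- Comparison with the spectral radii.

  ∣p-q∣<⇒p<q+ : ∀ {p q η} → ∣ p - q ∣ < η → p < q + η
  ∣p-q∣<⇒p<q+ {p} {q} {η} close = <-linearℚ 0ℚ (≤-refl {0ℚ}) (≤-<-trans (p≤∣p∣ (p - q)) close) (e p q η)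
    where
    e : ∀ p q η → p + η + 0ℚ ≡ q + η + (p - q)
    e = ℚ-Tactic.solve-∀ ℚ-ring

  <-far : ∀ {a b a′ b′ η} → a + (η + η + η) < b → ∣ a′ - a ∣ < η → ∣ b - b′ ∣ < η → a′ + η < b′
  <-far {a} {b} {a′} {b′} {η} far a-near b-near = <-linearℚ 0ℚ (≤-refl {0ℚ})
    (+-mono-< far (+-mono-< (∣p-q∣<⇒p<q+ {a′} {a} {η} a-near) (∣p-q∣<⇒p<q+ {b} {b′} {η} b-near)))
    (e a b a′ b′ η)
    where
    e : ∀ a b a′ b′ η → a′ + η + (b + ((a + η) + (b′ + η))) + 0ℚ ≡ b′ + (a + (η + η + η) + (a′ + b))
    e = ℚ-Tactic.solve-∀ ℚ-ring

  <-near : ∀ {h g g′ x η ε} → h + ε < g → (1ℚ + 1ℚ + 1ℚ + 1ℚ + 1ℚ + 1ℚ) * η ≡ ε → 0ℚ < η →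
    x ≤ h + (η + η + η) → ∣ g - g′ ∣ < η → x + η < g′
  <-near {h} {g} {g′} {x} {η} gap refl 0<η x≤ near = <-linearℚ η (<⇒≤ 0<η)
    (+-mono-<-≤ (+-mono-< gap (∣p-q∣<⇒p<q+ {g} {g′} {η} near)) x≤) (e h g g′ x η)
    where
    e : ∀ h g g′ x η → x + η + (g + (g′ + η) + (h + (η + η + η))) + η ≡
      g′ + (h + (1ℚ + 1ℚ + 1ℚ + 1ℚ + 1ℚ + 1ℚ) * η + g + x)
    e = ℚ-Tactic.solve-∀ ℚ-ring

  -- Take `η = ε / 6` and a stage `t` from which all three sequences vary by less than `η`. Either
  -- the term of `x` is at most `3η` above that of `y` and stays `η` below `z`, or `y` is smaller
  -- than `x` by `η` from then on, which is excluded.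
  approximation-below : ∀ {x y z : ℝ} → ¬ (y <ℝ x) → y <ℝ z → ∃[ t ] fromℚ (seq x t) <ℝ z
  approximation-below {x} {y} {z} y≮x (ε , 0<ε , N , gap) =
    compare (divide {1ℚ + 1ℚ + 1ℚ + 1ℚ + 1ℚ + 1ℚ} {ε} 0<6 0<ε)
    where
    0<6 : 0ℚ < 1ℚ + 1ℚ + 1ℚ + 1ℚ + 1ℚ + 1ℚ
    0<6 = +-mono-< (+-mono-< (+-mono-< (+-mono-< (+-mono-< 0<1 0<1) 0<1) 0<1) 0<1) 0<1
    compare : (∃[ η ] 0ℚ < η × (1ℚ + 1ℚ + 1ℚ + 1ℚ + 1ℚ + 1ℚ) * η ≡ ε) → ∃[ t ] fromℚ (seq x t) <ℝ z
    compare (η , 0<η , 6η≡ε) = byCases (seq x t ≤? seq y t + (η + η + η))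
      where
      Nx Ny Nz t : ℕ
      Nx = proj₁ (cauchy x η 0<η)
      Ny = proj₁ (cauchy y η 0<η)
      Nz = proj₁ (cauchy z η 0<η)
      t = (N ℕ.⊔ Nx) ℕ.⊔ (Ny ℕ.⊔ Nz)
      N≤t : N ℕ.≤ t
      N≤t = ℕ.≤-trans (ℕ.m≤m⊔n N Nx) (ℕ.m≤m⊔n (N ℕ.⊔ Nx) (Ny ℕ.⊔ Nz))
      Nx≤t : Nx ℕ.≤ t
      Nx≤t = ℕ.≤-trans (ℕ.m≤n⊔m N Nx) (ℕ.m≤m⊔n (N ℕ.⊔ Nx) (Ny ℕ.⊔ Nz))
      Ny≤t : Ny ℕ.≤ t
      Ny≤t = ℕ.≤-trans (ℕ.m≤m⊔n Ny Nz) (ℕ.m≤n⊔m (N ℕ.⊔ Nx) (Ny ℕ.⊔ Nz))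
      Nz≤t : Nz ℕ.≤ t
      Nz≤t = ℕ.≤-trans (ℕ.m≤n⊔m Ny Nz) (ℕ.m≤n⊔m (N ℕ.⊔ Nx) (Ny ℕ.⊔ Nz))
      byCases : Dec (seq x t ≤ seq y t + (η + η + η)) → ∃[ t ] fromℚ (seq x t) <ℝ z
      byCases (yes x≤) = t , η , 0<η , t , λ n t≤n →
        <-near {seq y t} {seq z t} {seq z n} {seq x t} {η} {ε} (gap t N≤t) 6η≡ε 0<η x≤
          (proj₂ (cauchy z η 0<η) t n Nz≤t (ℕ.≤-trans Nz≤t t≤n))
      byCases (no x≰) = ⊥-elim (y≮x (η , 0<η , t , λ n t≤n →
        <-far {seq y t} {seq x t} {seq y n} {seq x n} {η} (≰⇒> x≰)
          (proj₂ (cauchy y η 0<η) n t (ℕ.≤-trans Ny≤t t≤n) Ny≤t)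
          (proj₂ (cauchy x η 0<η) t n Nx≤t (ℕ.≤-trans Nx≤t t≤n))))

  fromℚ-≤-<-trans : ∀ {p q x} → p ≤ q → fromℚ q <ℝ x → fromℚ p <ℝ x
  fromℚ-≤-<-trans p≤q (ε , 0<ε , N , gap) = ε , 0<ε , N , λ n N≤n →
    ≤-<-trans (+-monoˡ-≤ ε p≤q) (gap n N≤n)

  module _ {n j m : ℕ} (G : Graph n) {ρ : ℝ} (eigen : IsEigenvalue (adjacencyMatrix G) ρ)
    (n≡ : n ≡ 2 ℕ.+ (j ℕ.+ m)) (q : ℚ) (dominates : Dominates j m q) (q<ρ : fromℚ q <ℝ ρ) where

    exceeding⇒min-degree : ∀ v → suc j ℕ.≤ deg G v
    exceeding⇒min-degree v = [ (λ j<deg → j<deg) , (λ { (ℕ.s≤s deg≤j) → ⊥-elim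
      (supersolution-bound G {q} {ρ} (proj₂ dominates G n≡ v deg≤j) eigen q<ρ) }) ]′
      (ℕ.≤-<-connex (suc j) (deg G v))

    -- Relies on `exceeding⇒min-degree`: the supersolution for few edges requires that no vertex be
    -- isolated.
    exceeding⇒sparse-complement : Σℕ.sum (deg (complement G)) ℕ.+ 4 ℕ.≤ 2 ℕ.* n
    exceeding⇒sparse-complement = [ (λ enough → enough) , (λ few → ⊥-elim
      (supersolution-bound G {ι (j ℕ.+ m)} {ρ}
        (sparse-supersolution G (λ v → ℕ.≤-trans (ℕ.s≤s ℕ.z≤n) (exceeding⇒min-degree v)) n≡
          (ℕ.≤-pred (ℕ.≤-trans few (ℕ.≤-reflexive (ℕ.+-suc (Σℕ.sum (deg (complement G))) 3)))))
        eigen (fromℚ-≤-<-trans {ι (j ℕ.+ m)} {q} {ρ} (proj₁ dominates) q<ρ))) ]′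
      (ℕ.≤-<-connex (Σℕ.sum (deg (complement G)) ℕ.+ 4) (2 ℕ.* n))

  order-split : ∀ j n → 4 ℕ.* suc j ℕ.∸ 1 ℕ.≤ n → ∃[ m ] n ≡ 2 ℕ.+ (j ℕ.+ m)
  order-split j n 4k-1≤n = proj₁ difference , sym (proj₂ difference)
    where
    -- The right-hand side is what `4 * suc j ∸ 1` computes to.
    eq : ∀ j → 2 ℕ.+ j ℕ.+ (1 ℕ.+ 3 ℕ.* j) ≡ j ℕ.+ (suc j ℕ.+ (suc j ℕ.+ (suc j ℕ.+ 0)))
    eq = solve-∀
    difference : ∃[ m ] 2 ℕ.+ j ℕ.+ m ≡ n
    difference = ℕ.m≤n⇒∃[o]m+o≡n (ℕ.≤-trans (ℕ.m≤m+n (2 ℕ.+ j) (1 ℕ.+ 3 ℕ.* j))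
      (ℕ.≤-trans (ℕ.≤-reflexive (eq j)) 4k-1≤n))

  eigenvalue≤ρ : ∀ {n} (G : Graph n) {ρ μ} → IsSpectralRadius G ρ →
    IsEigenvalue (adjacencyMatrix G) μ → ¬ (ρ <ℝ μ)
  eigenvalue≤ρ G {ρ} {μ} (_ , largest) = largest μ

  H-suc : ∀ n j → K j ∇ (K 1 ∪ K (n ℕ.∸ suc j)) ≡ H[ n , suc j ]
  H-suc n j = refl

  factor-of-exceeding : ∀ {j n m} (G : Graph n) {ρ} μ → 4 ℕ.* suc j ℕ.≤ n ℕ.+ 1 → 2 ∣ suc j ℕ.* n →
    n ≡ 2 ℕ.+ (j ℕ.+ m) → IsEigenvalue (adjacencyMatrix G) ρ →
    (∀ t → Dominates j m (seq μ t)) → (∃[ t ] fromℚ (seq μ t) <ℝ ρ) → Factor (suc j) G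
  factor-of-exceeding {j} {n} {m} G {ρ} μ 4k≤n+1 2∣kn n≡ eigen dominates (t , below) =
    factor-of-dense G (ℕ.s≤s ℕ.z≤n) 4k≤n+1 2∣kn
      (exceeding⇒min-degree {n} {j} {m} G {ρ} eigen n≡ (seq μ t) (dominates t) below)
      (exceeding⇒sparse-complement {n} {j} {m} G {ρ} eigen n≡ (seq μ t) (dominates t) below)

  module _ (j n : ℕ) (4k-1≤n : 4 ℕ.* suc j ℕ.∸ 1 ℕ.≤ n) (2∣kn : 2 ∣ suc j ℕ.* n) (G : Graph n) {ρG ρH : ℝ}
    (eigenG : IsEigenvalue (adjacencyMatrix G) ρG) (spectralH : IsSpectralRadius H[ n , suc j ] ρH)
    (ρH<ρG : ρH <ℝ ρG) where

    private
      4k≤n+1 : 4 ℕ.* suc j ℕ.≤ n ℕ.+ 1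
      4k≤n+1 = ℕ.≤-trans (ℕ.s≤s 4k-1≤n) (ℕ.≤-reflexive (ℕ.+-comm 1 n))

      module _ {m : ℕ} (n≡ : n ≡ 2 ℕ.+ (j ℕ.+ m)) where

        p≡ : n ℕ.∸ suc j ≡ suc m
        p≡ = trans (cong (ℕ._∸ suc j) (trans n≡ (cong suc (sym (ℕ.+-suc j m))))) (ℕ.m+n∸m≡n (suc j) (suc m))

        fromEigenvalue : DominatingEigenvalue j m (n ℕ.∸ suc j) → Factor (suc j) G
        fromEigenvalue (μ , eigen , dominates) =
          factor-of-exceeding {j} {n} {m} G {ρG} μ 4k≤n+1 2∣kn n≡ eigenG dominates
            (approximation-below {μ} {ρH} {ρG} (eigenvalue≤ρ H[ n , suc j ] {ρH} {μ} spectralH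
              (subst (λ H → IsEigenvalue (adjacencyMatrix H) μ) (H-suc n j) eigen)) ρH<ρG)

    factor-of-ρH<ρG : Factor (suc j) G
    factor-of-ρH<ρG = fromSplit (order-split j n 4k-1≤n)
      where
      fromSplit : (∃[ m ] n ≡ 2 ℕ.+ (j ℕ.+ m)) → Factor (suc j) G
      fromSplit (m , n≡) = fromEigenvalue {m} n≡ (dominatingEigenvalue j m (n ℕ.∸ suc j) (zero-or-1≤ι j)
        (ι-suc (p≡ {m} n≡)) (subst Fin (sym (p≡ {m} n≡)) zero))

open import Data.Nat.Base using (ℕ; suc; _*_; _∸_; _≤_)
open import Data.Nat.Divisibility using (_∣_)
open import Data.Product.Base using (_,_)
open SpectralComparison using (factor-of-ρH<ρG)

corollary1p1 : (k n : ℕ) → 1 ≤ k → 4 * k ∸ 1 ≤ n → 2 ∣ k * n →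
    (G : Graph n) (ρG ρH : ℝ) →
    IsSpectralRadius G ρG → IsSpectralRadius H[ n , k ] ρH →
    ρH <ℝ ρG →
    Factor k G
corollary1p1 (suc j) n _ 4k-1≤n 2∣kn G ρG ρH (eigenG , _) spectralH ρH<ρG =
  factor-of-ρH<ρG j n 4k-1≤n 2∣kn G {ρG} {ρH} eigenG spectralH ρH<ρG
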